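{- Let $G=(V,E,\eta)$ be a $\beta$-balanced lossy flow graph that is connected and has expansion $\phi$, with $|E|=m$. Let $d \in \mathbb{R}^{V}_{\geq 0}$ satisfy $d_G \leq d \leq c\cdot d_G$ for $c \geq 1$, and let $D = \mathrm{diag}(d)$. Let $\lambda := \lambda_{\min}(D^{ -1/2}L_GD^{ -1/2})$, and let $v := v_{\min}(D^{ -1/2}L_GD^{ -1/2})$. If $\beta < 0.1$, $\phi < 0.1$, $c\lambda < 1$, and $\beta + c\lambda \leq \frac{\phi^2}{100 \log m}$, then $$\frac{\max_{i \in V} z_i}{\min_{i \in V} z_i} \leq \exp\left(O\left(\frac{(\beta + c\lambda) \log m}{\phi^2}\right)\right), \quad\text{where } z_i := \frac{v_i}{\sqrt{d_i}} \text{ for all } i \in V.$$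
   Context: An (unweighted) lossy flow graph $G=(V,E,\eta)$ has a finite vertex set $V$, a multiset $E$ of pairs $e=(a_e,b_e)$ of distinct vertices, and flow multipliers $\eta\in\mathbb{R}^E_{\ge 1}$ (all edge weights are one). Its incidence matrix $B_G\in\mathbb{R}^{E\times V}$ has row $e$ equal to $\vec 1_{b_e}-\eta_e\vec 1_{a_e}$; $L_G := B_G^\top B_G$, and $d_G\in\mathbb{R}^V$ is the vector of diagonal entries of $L_G$. The smoothed graph $\overline G=(V,E)$ is the undirected multigraph with the same vertices and edges and no multipliers. $G$ is connected if $\overline G$ is. $G$ is $\beta$-balanced if $\eta_e\le 1+\beta$ for all $e\in E$. $G$ has expansion $\phi$ if the conductance of $\overline G$, $\min_{S\subseteq V}\frac{|E(S,V\setminus S)|}{\min\{\mathrm{vol}(S),\mathrm{vol}(V\setminus S)\}}$ (with $\mathrm{vol}(S)$ the sum of the degrees in $\overline G$ of vertices of $S$), is at least $\phi$. For a PSD matrix $M$, $\lambda_{\min}(M)$ is the smallest eigenvalue and, when it is simple, $v_{\min}(M)$ is the corresponding unit eigenvector whose first non-zero coordinate is positive (for connected $G$ the smallest eigenvalue of $D^{ -1/2}L_GD^{ -1/2}$ is simple). Vector inequalities are entrywise. The $O(\cdot)$ hides an absolute constant. -}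

module Defs where

open import Algebra.Bundles using (CommutativeRing; Semiring)
open import Algebra.Structures using (IsCommutativeRing)
import Algebra.Definitions.RawMonoid as RawMonoidDefinitions
import Algebra.Definitions.RawSemiring as RawSemiringDefinitions
open import Data.Bool.Base using (Bool; if_then_else_; _∨_; _xor_)
open import Data.Fin.Base using (Fin; zero; toℕ) renaming (_<_ to _<ᶠ_)
open import Data.Fin.Properties using () renaming (_≟_ to _≟ᶠ_)
open import Data.Fin.Subset using (Subset; ∁)
import Data.List.Base as List
import Data.List.Extrema as Extrema
open import Data.Nat.Base as ℕ using (ℕ; suc; _!)
open import Data.Nat.Properties using (+-0-commutativeMonoid)
open import Data.Product.Base using (∃; ∃-syntax; _×_)
open import Data.Sum.Base using (_⊎_)
import Data.Vec.Base as Vec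
open import Data.Vec.Functional using (Vector)
import Algebra.Properties.CommutativeMonoid.Sum as CommutativeMonoidSum
open import Relation.Binary.Bundles using (TotalOrder)
open import Relation.Binary.Construct.Closure.ReflexiveTransitive using (Star)
import Relation.Binary.Construct.NonStrictToStrict as NonStrictToStrict
open import Relation.Binary.Core using (Rel)
open import Relation.Binary.PropositionalEquality.Core using (_≡_; _≢_)
open import Relation.Binary.Structures using (IsDecTotalOrder)
open import Relation.Nullary.Decidable.Core using (does; yes; no)
open import Relation.Nullary.Negation.Core using (¬_)

open CommutativeMonoidSum +-0-commutativeMonoid using () renaming (sum to sumℕ)

------------------------------------------------------------------------
-- Undirected multigraphs

-- The m edges are indexed, so parallel edges are allowed.  The order of
-- the endpoints of an edge is immaterial to every notion below.
record Multigraph (n m : ℕ) : Set where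
  field
    a b      : Fin m → Fin n
    distinct : ∀ e → a e ≢ b e

module _ {n m : ℕ} (H : Multigraph n m) where
  open Multigraph H

  Adjacent : Fin n → Fin n → Set
  Adjacent u w = ∃[ e ] ((a e ≡ u × b e ≡ w) ⊎ (a e ≡ w × b e ≡ u))

  Connected : Set
  Connected = ∀ u w → Star Adjacent u w

  countEdges : (Fin m → Bool) → ℕ
  countEdges p = sumℕ (λ e → if p e then 1 else 0)

  degree : Fin n → ℕ
  degree u = countEdges (λ e → does (a e ≟ᶠ u) ∨ does (b e ≟ᶠ u))

  vol : Subset n → ℕ
  vol S = sumℕ (λ u → if Vec.lookup S u then degree u else 0)

  cut : Subset n → ℕ
  cut S = countEdges (λ e → Vec.lookup S (a e) xor Vec.lookup S (b e))

  minVol : Subset n → ℕ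
  minVol S = vol S ℕ.⊓ vol (∁ S)

------------------------------------------------------------------------
-- The real numbers, axiomatised as a complete ordered field

-- As Agda's library has no real numbers, ℝ is an arbitrary model of these
-- axioms; classically it is unique up to isomorphism.  The order is taken
-- decidable, as it is classically.  The inverse and the supremum are total
-- operations, with no law for x ≈ 0 and for sets that are empty or
-- unbounded, respectively.
record CompleteOrderedField : Set₁ where
  infix  8 _⁻¹
  infixl 7 _*_
  infixl 6 _+_
  infix  4 _≈_ _≤_
  field
    Carrier           : Set
    _≈_ _≤_           : Rel Carrier _
    _+_ _*_           : Carrier → Carrier → Carrier
    -_ _⁻¹            : Carrier → Carrier
    0# 1#             : Carrier
    ⨆                 : (Carrier → Set) → Carrier
    isCommutativeRing : IsCommutativeRing _≈_ _+_ _*_ -_ 0# 1#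
    isDecTotalOrder   : IsDecTotalOrder _≈_ _≤_
    0≉1               : ¬ (0# ≈ 1#)
    *-inverseʳ        : ∀ x → ¬ (x ≈ 0#) → x * x ⁻¹ ≈ 1#
    +-monoʳ-≤         : ∀ x {y z} → y ≤ z → x + y ≤ x + z
    *-nonNeg          : ∀ {x y} → 0# ≤ x → 0# ≤ y → 0# ≤ x * y

  IsUpperBound : (Carrier → Set) → Carrier → Set
  IsUpperBound P u = ∀ x → P x → x ≤ u

  IsMinimum : (Carrier → Set) → Carrier → Set
  IsMinimum P x = P x × (∀ y → P y → x ≤ y)

  field
    ⨆-isLeastUpperBound : ∀ P → ∃ P → ∃ (IsUpperBound P) →
                          IsMinimum (IsUpperBound P) (⨆ P)

  commutativeRing : CommutativeRing _ _
  commutativeRing = record { isCommutativeRing = isCommutativeRing }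

  open IsDecTotalOrder isDecTotalOrder public using (_≤?_; isTotalOrder)

  totalOrder : TotalOrder _ _ _
  totalOrder = record { isTotalOrder = isTotalOrder }

  open NonStrictToStrict _≈_ _≤_ public using (_<_)
  open RawSemiringDefinitions (Semiring.rawSemiring (CommutativeRing.semiring commutativeRing)) public
    using (_^_)
  open CommutativeMonoidSum (CommutativeRing.+-commutativeMonoid commutativeRing) public
    using (sum)

  infixl 7 _/_
  _/_ : Carrier → Carrier → Carrier
  x / y = x * y ⁻¹

  fromℕ : ℕ → Carrier
  fromℕ k = RawMonoidDefinitions._×_
              (CommutativeRing.+-rawMonoid commutativeRing) k 1#

  √ : Carrier → Carrier
  √ x = ⨆ (λ y → y * y ≤ x)

  expPartialSum : Carrier → ℕ → Carrier
  expPartialSum x N =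
    sum {N} (λ k → x ^ toℕ k / fromℕ (toℕ k !))

  -- For x ≥ 0 the partial sums of ∑ₖ xᵏ/k! increase, so the value of the
  -- series is their supremum.
  exp⁺ : Carrier → Carrier
  exp⁺ x = ⨆ (λ y → ∃[ N ] y ≈ expPartialSum x N)

  exp : Carrier → Carrier
  exp x with 0# ≤? x
  ... | yes _ = exp⁺ x
  ... | no  _ = (exp⁺ (- x)) ⁻¹

  -- The natural logarithm, meaningful for x > 0.
  log : Carrier → Carrier
  log x = ⨆ (λ y → exp y ≤ x)

  -- Entries of a vector indexed by a nonempty Fin; the first argument of
  -- Extrema.max is the value it would return on an empty list.
  maxᵛ minᵛ : ∀ {n} → Vector Carrier (suc n) → Carrier
  maxᵛ z = Extrema.max totalOrder (z zero) (List.tabulate z)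
  minᵛ z = Extrema.min totalOrder (z zero) (List.tabulate z)

------------------------------------------------------------------------
-- Matrices and their smallest eigenvalue

module LinearAlgebra (ℝ : CompleteOrderedField) where
  open CompleteOrderedField ℝ

  Matrix : ℕ → ℕ → Set
  Matrix k n = Fin k → Fin n → Carrier

  infixl 7 _⊗_
  _⊗_ : ∀ {k l n} → Matrix k l → Matrix l n → Matrix k n
  (A ⊗ B) i j = sum (λ h → A i h * B h j)

  _ᵀ : ∀ {k n} → Matrix k n → Matrix n k
  (A ᵀ) i j = A j i

  _·_ : ∀ {k n} → Matrix k n → Vector Carrier n → Vector Carrier k
  (A · x) i = sum (λ j → A i j * x j)

  𝟙 : ∀ {n} → Fin n → Vector Carrier n
  𝟙 i j = if does (i ≟ᶠ j) then 1# else 0#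

  diag : ∀ {n} → Vector Carrier n → Matrix n n
  diag d i j = d i * 𝟙 i j

  IsEigenvector : ∀ {n} → Matrix n n → Carrier → Vector Carrier n → Set
  IsEigenvector M μ x = (∃[ i ] ¬ (x i ≈ 0#)) × (∀ i → (M · x) i ≈ μ * x i)

  IsEigenvalue : ∀ {n} → Matrix n n → Carrier → Set
  IsEigenvalue M μ = ∃ (IsEigenvector M μ)

  IsλMin : ∀ {n} → Matrix n n → Carrier → Set
  IsλMin M = IsMinimum (IsEigenvalue M)

  -- When the smallest eigenvalue of M is simple, this determines v uniquely.
  record IsVMin {n} (M : Matrix n n) (v : Vector Carrier n) : Set where
    field
      μ             : Carrier
      smallest      : IsλMin M μ
      eigenvector   : IsEigenvector M μ v
      unit          : sum (λ i → v i * v i) ≈ 1#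
      firstPositive : ∃[ i ] (0# < v i × (∀ j → j <ᶠ i → v j ≈ 0#))

------------------------------------------------------------------------
-- Lossy flow graphs

module LossyFlow (ℝ : CompleteOrderedField) where
  open CompleteOrderedField ℝ
  open LinearAlgebra ℝ

  record LossyFlowGraph (n m : ℕ) : Set where
    field
      a b      : Fin m → Fin n
      distinct : ∀ e → a e ≢ b e
      η        : Fin m → Carrier
      1≤η      : ∀ e → 1# ≤ η e

  module _ {n m : ℕ} (G : LossyFlowGraph n m) where
    open LossyFlowGraph G

    smoothed : Multigraph n m
    smoothed = record { a = a ; b = b ; distinct = distinct }

    incidence : Matrix m n
    incidence e u = 𝟙 (b e) u + - (η e * 𝟙 (a e) u)

    laplacian : Matrix n n
    laplacian = incidence ᵀ ⊗ incidence

    degrees : Vector Carrier n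
    degrees u = laplacian u u

    Balanced : Carrier → Set
    Balanced β = ∀ e → η e ≤ 1# + β

    -- The minimum is over those S for which the quotient is defined; in a
    -- connected graph with an edge these are the nonempty proper S.
    IsConductance : Carrier → Set
    IsConductance = IsMinimum λ κ →
      ∃[ S ] (0 ℕ.< minVol smoothed S ×
              κ ≈ fromℕ (cut smoothed S) / fromℕ (minVol smoothed S))

    HasExpansion : Carrier → Set
    HasExpansion φ = ∃[ κ ] (IsConductance κ × φ ≤ κ)

    -- D^{-1/2} L D^{-1/2} for D = diag d with d > 0
    normalizedLaplacian : Vector Carrier n → Matrix n n
    normalizedLaplacian d = D⁻½ ⊗ laplacian ⊗ D⁻½
      where
      D⁻½ : Matrix n n
      D⁻½ = diag (λ i → (√ (d i)) ⁻¹)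

{-# OPTIONS --safe #-}

-- With z = D^{-1/2} v the eigenvector equation reads L z = λ D z.  The smallest
-- eigenvalue makes M − λI positive semidefinite, and a Perron argument shows
-- z > 0.  Pairing the equation with the indicator of {z ≥ t} shows that little
-- is lost across its boundary, so by expansion a constant fraction of its cut
-- lands in {z ≥ t/(1 + δ)} with δ = 10(β + cλ)/φ; hence the volume of the
-- superlevel sets grows by 1 + φ/2 at each step, provided Σ deg·z over the set
-- is at most 2t·vol, which the growth itself propagates.  Pairing with 1/z on
-- {z ≤ t} gives the same growth for sublevel sets, because the terms of edges
-- inside the set are bounded by β².  After O(log m / φ) steps from max z and
-- from min z both sets contain more than half of the volume, so they meet.
module Submission where

open import Defs
open import Algebra.Bundles using (CommutativeRing; RawRing)
import Algebra.Properties.AbelianGroup as AbelianGroupProperties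
import Algebra.Properties.CommutativeMonoid.Sum as CommutativeMonoidSum
import Algebra.Properties.Ring as RingProperties
import Algebra.Properties.Semiring.Exp as Powers
import Algebra.Properties.Semiring.Mult as Multiples
import Algebra.Properties.Semiring.Sum as SemiringSum
import Algebra.Solver.Ring as RingSolver
open import Algebra.Solver.Ring.AlmostCommutativeRing using (fromCommutativeRing; _-Raw-AlmostCommutative⟶_)
open import Data.Bool.Base using (Bool; true; false; if_then_else_; not; _∨_; _xor_)
open import Data.Fin.Base using (Fin; zero; suc; toℕ; fromℕ<)
open import Data.Fin.Properties using () renaming (_≟_ to _≟ᶠ_)
open import Data.Fin.Subset using (∁)
open import Data.Integer.Base as ℤ using (ℤ; +_; -[1+_])
import Data.Integer.Properties as ℤ
import Data.List.Base as List
import Data.List.Extrema as Extrema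
open import Data.List.Membership.Propositional.Properties using (∈-tabulate⁻)
open import Data.List.Relation.Unary.All.Properties using (tabulate⁻)
open import Data.Maybe.Base as Maybe using (Maybe)
open import Data.Nat.Base as ℕ using (ℕ; zero; suc; _!)
import Data.Nat.Properties as ℕ
open import Data.Product.Base using (∃; ∃-syntax; _×_; _,_; proj₁; proj₂)
open import Data.Sum.Base using (_⊎_; inj₁; inj₂; [_,_]′)
open import Data.Unit.Base using (⊤)
import Data.Vec.Base as Vec
open import Data.Vec.Functional using (Vector)
import Data.Vec.Properties as Vec
open import Level using (0ℓ)
open import Relation.Binary.Bundles using (TotalOrder)
open import Relation.Binary.Construct.Closure.ReflexiveTransitive using (Star; _◅_) renaming (ε to done)
open import Relation.Binary.PropositionalEquality as ≡ using (_≡_; _≢_)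
import Relation.Binary.Reasoning.PartialOrder as PartialOrderReasoning
import Relation.Binary.Reasoning.Setoid as SetoidReasoning
open import Relation.Binary.Structures using (IsDecTotalOrder)
open import Relation.Nullary.Decidable using (yes; no; does; dec⇒maybe)
open import Relation.Nullary.Negation.Core using (¬_; contradiction)

-- The two families of level sets are not symmetric. Above t the values of z have no a priori bound
-- in terms of t, while the loss on edges inside the set and the eigenvalue term both scale with z;
-- hence the condition on Σ deg·z. It survives a step because the volume grows by 1 + φ/2 while the
-- threshold shrinks only by 1 + δ, with δ ≤ φ/5. The 10 in δ makes the total error at most 4(1 +
-- δ)/10 ≤ 1/2 of the cut, so half of the cut is absorbed. Below t, dividing by z leaves only ratios
-- of values: by AM-GM an inner edge contributes at most (η - 1)², and β² vol ≤ βφ vol ≤ β cut. For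
-- β + cλ = 0 the thresholds would not move, so that case is treated apart. The analysis starts from
-- the axioms of a complete ordered field. The smallest eigenvalue is compared with the quadratic
-- form through a supremum and Schur complements, in place of compactness or diagonalization.
-- Exponential and logarithm enter only through (1 + x)^k ≤ exp (k x) ≤ (1 - x)^(-k) for 0 ≤ x < 1.

open CommutativeMonoidSum ℕ.+-0-commutativeMonoid using () renaming (sum to sumℕ)

-- A ring solver with integer coefficients

module IntegerCoefficients (R : CommutativeRing 0ℓ 0ℓ) where
  open CommutativeRing R
  open RingProperties ring
  open AbelianGroupProperties +-abelianGroup using (⁻¹-∙-comm; ε⁻¹≈ε; ⁻¹-involutive)
  open Multiples semiring using (×-homo-+; ×1-homo-*) renaming (_×_ to _·_)
  open SetoidReasoning setoid

  -- Integers as coefficients let the solver collect and cancel terms by computation, which equality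
  -- of abstract field elements would not do.
  ⟦_⟧ℤ : ℤ → Carrier
  ⟦ + n ⟧ℤ      = n · 1#
  ⟦ -[1+ n ] ⟧ℤ = - (suc n · 1#)

  neg-homo : ∀ i → ⟦ ℤ.- i ⟧ℤ ≈ - ⟦ i ⟧ℤ
  neg-homo (+ zero)   = sym ε⁻¹≈ε
  neg-homo (+ suc n)  = refl
  neg-homo (-[1+ n ]) = sym (⁻¹-involutive _)

  x+y-[x+z] : ∀ x y z → (x + y) - (x + z) ≈ y - z
  x+y-[x+z] x y z = begin
    (x + y) - (x + z)       ≈⟨ +-cong (+-comm x y) (sym (⁻¹-∙-comm x z)) ⟩
    (y + x) + (- x - z)     ≈⟨ +-assoc y x _ ⟩
    y + (x + (- x - z))     ≈⟨ +-congˡ (sym (+-assoc x (- x) (- z))) ⟩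
    y + ((x - x) - z)       ≈⟨ +-congˡ (+-congʳ (-‿inverseʳ x)) ⟩
    y + (0# - z)            ≈⟨ +-congˡ (+-identityˡ (- z)) ⟩
    y - z                   ∎

  ⊖-homo : ∀ m n → ⟦ m ℤ.⊖ n ⟧ℤ ≈ m · 1# - n · 1#
  ⊖-homo zero    zero    = sym (-‿inverseʳ 0#)
  ⊖-homo zero    (suc n) = sym (+-identityˡ _)
  ⊖-homo (suc m) zero    = sym (trans (+-congˡ ε⁻¹≈ε) (+-identityʳ _))
  ⊖-homo (suc m) (suc n) = begin
    ⟦ suc m ℤ.⊖ suc n ⟧ℤ      ≡⟨ ≡.cong ⟦_⟧ℤ (ℤ.[1+m]⊖[1+n]≡m⊖n m n) ⟩
    ⟦ m ℤ.⊖ n ⟧ℤ              ≈⟨ ⊖-homo m n ⟩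
    m · 1# - n · 1#           ≈⟨ sym (x+y-[x+z] 1# (m · 1#) (n · 1#)) ⟩
    suc m · 1# - suc n · 1#   ∎

  +-homo : ∀ i j → ⟦ i ℤ.+ j ⟧ℤ ≈ ⟦ i ⟧ℤ + ⟦ j ⟧ℤ
  +-homo (+ m)      (+ n)      = ×-homo-+ 1# m n
  +-homo (+ m)      (-[1+ n ]) = ⊖-homo m (suc n)
  +-homo (-[1+ m ]) (+ n)      = trans (⊖-homo n (suc m)) (+-comm _ _)
  +-homo (-[1+ m ]) (-[1+ n ]) = begin
    - (suc (suc (m ℕ.+ n)) · 1#)       ≡⟨ ≡.cong (λ k → - (suc k · 1#)) (ℕ.+-suc m n) ⟨
    - ((suc m ℕ.+ suc n) · 1#)         ≈⟨ -‿cong (×-homo-+ 1# (suc m) (suc n)) ⟩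
    - (suc m · 1# + suc n · 1#)        ≈⟨ sym (⁻¹-∙-comm _ _) ⟩
    - (suc m · 1#) - suc n · 1#        ∎

  *-homo⁺ : ∀ m j → ⟦ + m ℤ.* j ⟧ℤ ≈ ⟦ + m ⟧ℤ * ⟦ j ⟧ℤ
  *-homo⁺ m (+ n) = begin
    ⟦ + m ℤ.* + n ⟧ℤ         ≡⟨ ≡.cong ⟦_⟧ℤ (ℤ.pos-* m n) ⟨
    (m ℕ.* n) · 1#           ≈⟨ ×1-homo-* m n ⟩
    (m · 1#) * (n · 1#)      ∎
  *-homo⁺ m (-[1+ n ]) = begin
    ⟦ + m ℤ.* -[1+ n ] ⟧ℤ         ≡⟨ ≡.cong ⟦_⟧ℤ (ℤ.neg-distribʳ-* (+ m) (+ suc n)) ⟨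
    ⟦ ℤ.- (+ m ℤ.* + suc n) ⟧ℤ    ≈⟨ neg-homo (+ m ℤ.* + suc n) ⟩
    - ⟦ + m ℤ.* + suc n ⟧ℤ        ≈⟨ -‿cong (*-homo⁺ m (+ suc n)) ⟩
    - ((m · 1#) * (suc n · 1#))   ≈⟨ -‿distribʳ-* _ _ ⟩
    (m · 1#) * - (suc n · 1#)     ∎

  *-homo : ∀ i j → ⟦ i ℤ.* j ⟧ℤ ≈ ⟦ i ⟧ℤ * ⟦ j ⟧ℤ
  *-homo (+ m)      j = *-homo⁺ m j
  *-homo (-[1+ m ]) j = begin
    ⟦ -[1+ m ] ℤ.* j ⟧ℤ           ≡⟨ ≡.cong ⟦_⟧ℤ (ℤ.neg-distribˡ-* (+ suc m) j) ⟨
    ⟦ ℤ.- (+ suc m ℤ.* j) ⟧ℤ      ≈⟨ neg-homo (+ suc m ℤ.* j) ⟩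
    - ⟦ + suc m ℤ.* j ⟧ℤ          ≈⟨ -‿cong (*-homo⁺ (suc m) j) ⟩
    - ((suc m · 1#) * ⟦ j ⟧ℤ)     ≈⟨ -‿distribˡ-* _ _ ⟩
    - (suc m · 1#) * ⟦ j ⟧ℤ       ∎

  -- In a solver expression con (+ 1) must denote 1# itself, not 1# + 0#.
  ⟦_⟧₁ : ℤ → Carrier
  ⟦ + 1 ⟧₁ = 1#
  ⟦ i   ⟧₁ = ⟦ i ⟧ℤ

  ⟦_⟧₁≈ : ∀ i → ⟦ i ⟧₁ ≈ ⟦ i ⟧ℤ
  ⟦ + zero ⟧₁≈        = refl
  ⟦ + suc zero ⟧₁≈    = sym (+-identityʳ 1#)
  ⟦ + suc (suc n) ⟧₁≈ = refl
  ⟦ -[1+ n ] ⟧₁≈      = refl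

  rawℤ : RawRing 0ℓ 0ℓ
  rawℤ = CommutativeRing.rawRing ℤ.+-*-commutativeRing

  ℤ⟶R : rawℤ -Raw-AlmostCommutative⟶ fromCommutativeRing R
  ℤ⟶R = record
    { ⟦_⟧    = ⟦_⟧₁
    ; +-homo = λ i j → trans ⟦ i ℤ.+ j ⟧₁≈ (trans (+-homo i j) (sym (+-cong ⟦ i ⟧₁≈ ⟦ j ⟧₁≈)))
    ; *-homo = λ i j → trans ⟦ i ℤ.* j ⟧₁≈ (trans (*-homo i j) (sym (*-cong ⟦ i ⟧₁≈ ⟦ j ⟧₁≈)))
    ; -‿homo = λ i → trans ⟦ ℤ.- i ⟧₁≈ (trans (neg-homo i) (sym (-‿cong ⟦ i ⟧₁≈)))
    ; 0-homo = refl
    ; 1-homo = refl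
    }

  coefficients-equal? : ∀ i j → Maybe (⟦ i ⟧₁ ≈ ⟦ j ⟧₁)
  coefficients-equal? i j = Maybe.map (λ i≡j → reflexive (≡.cong ⟦_⟧₁ i≡j)) (dec⇒maybe (i ℤ.≟ j))

  open RingSolver rawℤ (fromCommutativeRing R) ℤ⟶R coefficients-equal? public
    using (solve; con; _:=_; _:+_; _:*_; _:-_; :-_)

-- Arithmetic and order in an ordered field

module OrderedField (ℝ : CompleteOrderedField) where
  open CompleteOrderedField ℝ public
  open CommutativeRing commutativeRing public
    using (refl; sym; trans; reflexive; setoid; semiring
          ; +-cong; +-congˡ; +-congʳ; +-comm; +-assoc; +-identityˡ; +-identityʳ
          ; *-cong; *-congˡ; *-congʳ; *-comm; *-assoc; *-identityˡ; *-identityʳ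
          ; -‿cong; -‿inverseʳ; zeroˡ; zeroʳ; distribˡ; distribʳ)
  open IsDecTotalOrder isDecTotalOrder public
    using (_≟_; antisym; total)
    renaming (refl to ≤-refl; reflexive to ≤-reflexive; trans to ≤-trans)
  open IntegerCoefficients commutativeRing public
    using (solve; con; _:=_; _:+_; _:*_; _:-_; :-_)

  module ≤-Reasoning = PartialOrderReasoning (TotalOrder.poset totalOrder)

  2# : Carrier
  2# = fromℕ 2

  +-mono-≤ : ∀ {x y u w} → x ≤ y → u ≤ w → x + u ≤ y + w
  +-mono-≤ {x} {y} {u} {w} x≤y u≤w = ≤-trans (+-monoʳ-≤ x u≤w)
    (≤-trans (≤-reflexive (+-comm x w)) (≤-trans (+-monoʳ-≤ w x≤y) (≤-reflexive (+-comm w y))))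

  -- Polynomial inequalities are proved from a certificate: the difference of
  -- the two sides is a sum of products of terms known to be nonnegative.
  diff : ∀ {x y} → x ≤ y → 0# ≤ y + - x
  diff {x} {y} x≤y = ≤-trans (≤-reflexive (sym (-‿inverseʳ x))) (+-mono-≤ x≤y ≤-refl)

  infixl 6 _⊕_
  infixl 7 _⊛_
  _⊕_ : ∀ {x y} → 0# ≤ x → 0# ≤ y → 0# ≤ x + y
  0≤x ⊕ 0≤y = ≤-trans (≤-reflexive (sym (+-identityˡ 0#))) (+-mono-≤ 0≤x 0≤y)

  _⊛_ : ∀ {x y} → 0# ≤ x → 0# ≤ y → 0# ≤ x * y
  _⊛_ = *-nonNeg

  by : ∀ {x y p} → 0# ≤ p → y + - x ≈ p → x ≤ y
  by {x} {y} {p} 0≤p y-x≈p = begin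
    x           ≈⟨ +-identityˡ x ⟨
    0# + x      ≤⟨ +-mono-≤ 0≤p ≤-refl ⟩
    p + x       ≈⟨ +-congʳ (sym y-x≈p) ⟩
    y + - x + x ≈⟨ solve 2 (λ x y → y :- x :+ x := y) refl x y ⟩
    y           ∎
    where open ≤-Reasoning

  nonNeg : ∀ {x p} → 0# ≤ p → x ≈ p → 0# ≤ x
  nonNeg 0≤p x≈p = ≤-trans 0≤p (≤-reflexive (sym x≈p))

  ≰⇒≥ : ∀ {x y} → ¬ (x ≤ y) → y ≤ x
  ≰⇒≥ {x} {y} x≰y = [ (λ x≤y → contradiction x≤y x≰y) , (λ y≤x → y≤x) ]′ (total x y)

  -- By decidability of the order, an inequality may be proved from facts known only up to double
  -- negation. Existence statements that rest on the Archimedean property are used in this way.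
  ≤-stable : ∀ {x y} → ¬ ¬ (x ≤ y) → x ≤ y
  ≤-stable {x} {y} ¬¬x≤y with x ≤? y
  ... | yes x≤y = x≤y
  ... | no  x≰y = contradiction x≰y ¬¬x≤y

  <⇒≱ : ∀ {x y} → x < y → ¬ (y ≤ x)
  <⇒≱ (x≤y , x≉y) y≤x = x≉y (antisym x≤y y≤x)

  ≰⇒> : ∀ {x y} → ¬ (x ≤ y) → y < x
  ≰⇒> x≰y = ≰⇒≥ x≰y , λ y≈x → x≰y (≤-reflexive (sym y≈x))

  <-≤-trans : ∀ {x y w} → x < y → y ≤ w → x < w
  <-≤-trans x<y y≤w = ≰⇒> λ w≤x → <⇒≱ x<y (≤-trans y≤w w≤x)

  ≤-<-trans : ∀ {x y w} → x ≤ y → y < w → x < w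
  ≤-<-trans x≤y y<w = ≰⇒> λ w≤x → <⇒≱ y<w (≤-trans w≤x x≤y)

  -nonNeg : ∀ {x} → x ≤ 0# → 0# ≤ - x
  -nonNeg {x} x≤0 = nonNeg (diff x≤0) (solve 1 (λ x → :- x := con (+ 0) :- x) refl x)

  square-nonNeg : ∀ x → 0# ≤ x * x
  square-nonNeg x with total 0# x
  ... | inj₁ 0≤x = 0≤x ⊛ 0≤x
  ... | inj₂ x≤0 = nonNeg (-nonNeg x≤0 ⊛ -nonNeg x≤0)
    (solve 1 (λ x → x :* x := (:- x) :* (:- x)) refl x)

  0≤1 : 0# ≤ 1#
  0≤1 = nonNeg (square-nonNeg 1#) (sym (*-identityˡ 1#))

  0<1 : 0# < 1#
  0<1 = 0≤1 , 0≉1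

  x*y≈0⇒y≈0 : ∀ {x y} → ¬ (x ≈ 0#) → x * y ≈ 0# → y ≈ 0#
  x*y≈0⇒y≈0 {x} {y} x≉0 xy≈0 = begin-equality
    y                ≈⟨ *-identityˡ y ⟨
    1# * y           ≈⟨ *-congʳ (*-inverseʳ x x≉0) ⟨
    x * x ⁻¹ * y     ≈⟨ solve 3 (λ x x′ y → x :* x′ :* y := x′ :* (x :* y)) refl x (x ⁻¹) y ⟩
    x ⁻¹ * (x * y)   ≈⟨ *-congˡ xy≈0 ⟩
    x ⁻¹ * 0#        ≈⟨ zeroʳ _ ⟩
    0#               ∎
    where open ≤-Reasoning

  <-respʳ : ∀ {x y w} → y ≈ w → x < y → x < w
  <-respʳ y≈w x<y = <-≤-trans x<y (≤-reflexive y≈w)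

  *-cancelˡ-nonNeg : ∀ {x y} → 0# < x → 0# ≤ x * y → 0# ≤ y
  *-cancelˡ-nonNeg {x} {y} (0≤x , 0≉x) 0≤xy with 0# ≤? y
  ... | yes 0≤y = 0≤y
  ... | no  0≰y = ≤-reflexive (sym (x*y≈0⇒y≈0 (λ x≈0 → 0≉x (sym x≈0)) (antisym
    (by (0≤x ⊛ -nonNeg (≰⇒≥ 0≰y)) (solve 2 (λ x y → con (+ 0) :- x :* y := x :* (:- y)) refl x y))
      0≤xy)))

  *-cancelˡ-≤ : ∀ {k x y} → 0# < k → k * x ≤ k * y → x ≤ y
  *-cancelˡ-≤ {k} {x} {y} 0<k kx≤ky = by (*-cancelˡ-nonNeg 0<k
    (nonNeg (diff kx≤ky) (solve 3 (λ k x y → k :* (y :- x) := k :* y :- k :* x) refl k x y))) refl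

  *-monoˡ-≤ : ∀ {k x y} → 0# ≤ k → x ≤ y → k * x ≤ k * y
  *-monoˡ-≤ {k} {x} {y} 0≤k x≤y = by (0≤k ⊛ diff x≤y)
    (solve 3 (λ k x y → k :* y :- k :* x := k :* (y :- x)) refl k x y)

  *-mono-≤ : ∀ {x y u w} → 0# ≤ x → 0# ≤ w → x ≤ y → u ≤ w → x * u ≤ y * w
  *-mono-≤ {x} {y} {u} {w} 0≤x 0≤w x≤y u≤w = by (0≤x ⊛ diff u≤w ⊕ diff x≤y ⊛ 0≤w)
    (solve 4 (λ x y u w → y :* w :- x :* u := x :* (w :- u) :+ (y :- x) :* w) refl x y u w)

  pos≉0 : ∀ {x} → 0# < x → ¬ (x ≈ 0#)
  pos≉0 (_ , 0≉x) x≈0 = 0≉x (sym x≈0)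

  *-pos : ∀ {x y} → 0# < x → 0# < y → 0# < x * y
  *-pos 0<x 0<y = (proj₁ 0<x ⊛ proj₁ 0<y) , λ 0≈xy → pos≉0 0<y (x*y≈0⇒y≈0 (pos≉0 0<x) (sym 0≈xy))

  x*x⁻¹≈1 : ∀ {x} → 0# < x → x * x ⁻¹ ≈ 1#
  x*x⁻¹≈1 0<x = *-inverseʳ _ (pos≉0 0<x)

  ⁻¹-pos : ∀ {x} → 0# < x → 0# < x ⁻¹
  ⁻¹-pos {x} 0<x = *-cancelˡ-nonNeg 0<x (nonNeg 0≤1 (x*x⁻¹≈1 0<x)) ,
    λ 0≈x⁻¹ → 0≉1 (trans (sym (zeroʳ x)) (trans (*-congˡ 0≈x⁻¹) (x*x⁻¹≈1 0<x)))

  -- Inequalities with quotients are cleared through this law and `*-cancelˡ-≤`: multiplying by the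
  -- denominator leaves polynomials for the solver.
  *-/-cancel : ∀ {x y} → 0# < y → y * (x / y) ≈ x
  *-/-cancel {x} {y} 0<y = begin-equality
    y * (x * y ⁻¹)   ≈⟨ solve 3 (λ x y y′ → y :* (x :* y′) := x :* (y :* y′)) refl x y (y ⁻¹) ⟩
    x * (y * y ⁻¹)   ≈⟨ *-congˡ (x*x⁻¹≈1 0<y) ⟩
    x * 1#           ≈⟨ *-identityʳ x ⟩
    x                ∎
    where open ≤-Reasoning

  fromℕ-nonNeg : ∀ n → 0# ≤ fromℕ n
  fromℕ-nonNeg zero    = ≤-refl
  fromℕ-nonNeg (suc n) = 0≤1 ⊕ fromℕ-nonNeg n

  1≤fromℕ-suc : ∀ n → 1# ≤ fromℕ (suc n)
  1≤fromℕ-suc n = by (fromℕ-nonNeg n) (solve 2 (λ a b → a :+ b :- a := b) refl 1# (fromℕ n))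

  -- Indexed by the predecessor: `fromℕ-pos 9` is the positivity of ten.
  fromℕ-pos : ∀ n → 0# < fromℕ (suc n)
  fromℕ-pos n = <-≤-trans 0<1 (1≤fromℕ-suc n)

-- Finite sums and unit vectors

module Sums (ℝ : CompleteOrderedField) where
  open OrderedField ℝ
  open CommutativeMonoidSum (CommutativeRing.+-commutativeMonoid commutativeRing)
    using (sum-cong-≋; ∑-distrib-+; ∑-comm; sum-replicate-zero) public
  open SemiringSum semiring using (*-distribˡ-sum; *-distribʳ-sum) public
  open LinearAlgebra ℝ using (𝟙)

  sum-cong : ∀ {n} {f g : Vector Carrier n} → (∀ i → f i ≈ g i) → sum f ≈ sum g
  sum-cong = sum-cong-≋

  sum-mono-≤ : ∀ {n} {f g : Vector Carrier n} → (∀ i → f i ≤ g i) → sum f ≤ sum g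
  sum-mono-≤ {zero}  f≤g = ≤-refl
  sum-mono-≤ {suc n} f≤g = +-mono-≤ (f≤g zero) (sum-mono-≤ (λ i → f≤g (suc i)))

  sum-≈0 : ∀ {n} {f : Vector Carrier n} → (∀ i → f i ≈ 0#) → sum f ≈ 0#
  sum-≈0 {n} f≈0 = trans (sum-cong f≈0) (sum-replicate-zero n)

  sum-nonNeg : ∀ {n} {f : Vector Carrier n} → (∀ i → 0# ≤ f i) → 0# ≤ sum f
  sum-nonNeg {n} {f} 0≤f = ≤-trans (≤-reflexive (sym (sum-replicate-zero n))) (sum-mono-≤ 0≤f)

  term≤sum : ∀ {n} {f : Vector Carrier n} → (∀ i → 0# ≤ f i) → ∀ i → f i ≤ sum f
  term≤sum {suc n} {f} 0≤f zero    = by (sum-nonNeg (λ i → 0≤f (suc i)))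
    (solve 2 (λ x y → x :+ y :- x := y) refl (f zero) (sum (λ i → f (suc i))))
  term≤sum {suc n} {f} 0≤f (suc i) = ≤-trans (term≤sum (λ i → 0≤f (suc i)) i)
    (by (0≤f zero) (solve 2 (λ x y → x :+ y :- y := x) refl (f zero) (sum (λ i → f (suc i)))))

  sum-neg : ∀ {n} (f : Vector Carrier n) → sum (λ i → - f i) ≈ - sum f
  sum-neg {zero}  f = solve 0 (con (+ 0) := :- con (+ 0)) refl
  sum-neg {suc n} f = trans (+-congˡ (sum-neg (λ i → f (suc i))))
    (solve 2 (λ x y → :- x :+ :- y := :- (x :+ y)) refl (f zero) (sum (λ i → f (suc i))))

  sum-const : ∀ {n} x → sum {n} (λ _ → x) ≈ fromℕ n * x
  sum-const {zero}  x = sym (zeroˡ x)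
  sum-const {suc n} x = trans (+-congˡ (sum-const {n} x))
    (solve 2 (λ k x → x :+ k :* x := (con (+ 1) :+ k) :* x) refl (fromℕ n) x)

  𝟙-diagonal : ∀ {n} (i : Fin n) → 𝟙 i i ≈ 1#
  𝟙-diagonal i with i ≟ᶠ i
  ... | yes _   = refl
  ... | no  i≢i = contradiction ≡.refl i≢i

  𝟙-off-diagonal : ∀ {n} {i j : Fin n} → i ≢ j → 𝟙 i j ≈ 0#
  𝟙-off-diagonal {i = i} {j} i≢j with i ≟ᶠ j
  ... | yes i≡j = contradiction i≡j i≢j
  ... | no  _   = refl

  𝟙-suc : ∀ {n} (i j : Fin n) → 𝟙 (suc i) (suc j) ≈ 𝟙 i j
  𝟙-suc i j with i ≟ᶠ j
  ... | yes _ = refl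
  ... | no  _ = refl

  𝟙-sym : ∀ {n} (i j : Fin n) → 𝟙 i j ≈ 𝟙 j i
  𝟙-sym i j with i ≟ᶠ j
  ... | yes ≡.refl = sym (𝟙-diagonal i)
  ... | no  i≢j    = sym (𝟙-off-diagonal (λ j≡i → i≢j (≡.sym j≡i)))

  𝟙-nonNeg : ∀ {n} (i j : Fin n) → 0# ≤ 𝟙 i j
  𝟙-nonNeg i j with i ≟ᶠ j
  ... | yes _ = 0≤1
  ... | no  _ = ≤-refl

  sum-𝟙 : ∀ {n} (i : Fin n) (f : Vector Carrier n) → sum (λ j → 𝟙 i j * f j) ≈ f i
  sum-𝟙 {suc n} zero f = trans (+-cong (*-identityˡ (f zero)) (sum-≈0 (λ j → zeroˡ (f (suc j)))))
    (+-identityʳ _)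
  sum-𝟙 {suc n} (suc i) f = trans
    (+-cong (zeroˡ (f zero)) (trans (sum-cong (λ j → *-congʳ (𝟙-suc i j)))
      (sum-𝟙 i (λ j → f (suc j))))) (+-identityˡ _)

-- Suprema, the Archimedean property and square roots

module Suprema (ℝ : CompleteOrderedField) where
  open OrderedField ℝ

  ≤-⨆ : ∀ {P u x} → IsUpperBound P u → P x → x ≤ ⨆ P
  ≤-⨆ {P} {u} {x} u-bound px = proj₁ (⨆-isLeastUpperBound P (x , px) (u , u-bound)) x px

  ⨆-≤ : ∀ {P u} → ∃ P → IsUpperBound P u → ⨆ P ≤ u
  ⨆-≤ {P} {u} inhabited u-bound = proj₂ (⨆-isLeastUpperBound P inhabited (u , u-bound)) u u-bound

  -- If the naturals were bounded, with supremum s, then n + 1 ≤ s for all n, so s - 1 would bound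
  -- them as well and s ≤ s - 1. The argument refutes boundedness without producing an n above x.
  archimedean : ∀ x → ¬ (∀ n → fromℕ n ≤ x)
  archimedean x bounded = <⇒≱ 0<1 (nonPositive s≤s-1)
    where
    P : Carrier → Set
    P y = ∃[ n ] y ≈ fromℕ n
    bound : IsUpperBound P x
    bound y (n , y≈n) = ≤-trans (≤-reflexive y≈n) (bounded n)
    s≤s-1 : ⨆ P ≤ ⨆ P + - 1#
    s≤s-1 = ⨆-≤ (0# , 0 , refl) λ y (n , y≈n) → ≤-trans (≤-reflexive y≈n)
      (by (diff (≤-⨆ bound (suc n , refl)))
        (solve 3 (λ s a b → s :- a :- b := s :- (a :+ b)) refl (⨆ P) 1# (fromℕ n)))
    nonPositive : ∀ {s} → s ≤ s + - 1# → 1# ≤ 0#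
    nonPositive {s} h = by (diff h) (solve 2 (λ s a → con (+ 0) :- a := s :- a :- s) refl s 1#)

  square-cancel-≤ : ∀ {x y} → 0# ≤ y → x * x ≤ y * y → x ≤ y
  square-cancel-≤ {x} {y} 0≤y x²≤y² = ≤-stable λ x≰y → x≰y
    (by (*-cancelˡ-nonNeg (<-≤-trans (≤-<-trans 0≤y (≰⇒> x≰y)) (by 0≤y
      (solve 2 (λ x y → x :+ y :- x := y) refl x y)))
          (nonNeg (diff x²≤y²) (solve 2 (λ x y → (x :+ y) :* (y :- x) := y :* y :- x :* x)
            refl x y))) refl)

  module _ {x : Carrier} (0<x : 0# < x) where
    private
      InSet : Carrier → Set
      InSet y = y * y ≤ x

      bound : IsUpperBound InSet (1# + x)
      bound y y²≤x = square-cancel-≤ (0≤1 ⊕ proj₁ 0<x) (≤-trans y²≤x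
        (by (0≤1 ⊕ proj₁ 0<x ⊕ square-nonNeg x)
          (solve 1 (λ x → (con (+ 1) :+ x) :* (con (+ 1) :+ x) :- x := con (+ 1) :+ x :+ x :* x)
            refl x)))

      0∈ : InSet 0#
      0∈ = ≤-trans (≤-reflexive (zeroʳ 0#)) (proj₁ 0<x)

    √-nonNeg : 0# ≤ √ x
    √-nonNeg = ≤-⨆ bound 0∈

    √-pos : 0# < √ x
    √-pos = <-≤-trans (*-pos 0<x (⁻¹-pos 0<1+x)) (≤-⨆ bound (*-cancelˡ-≤ (*-pos 0<1+x 0<1+x) (begin
      (1# + x) * (1# + x) * (y * y)
        ≈⟨ solve 2 (λ r y → r :* r :* (y :* y) := (r :* y) :* (r :* y)) refl (1# + x) y ⟩
      ((1# + x) * y) * ((1# + x) * y)     ≈⟨ *-cong (*-/-cancel 0<1+x) (*-/-cancel 0<1+x) ⟩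
      x * x                               ≤⟨ by ((0≤1 ⊕ proj₁ 0<x ⊕ square-nonNeg x) ⊛ proj₁ 0<x)
        (solve 1 (λ x → (con (+ 1) :+ x) :* (con (+ 1) :+ x) :* x :- x :* x :=
          (con (+ 1) :+ x :+ x :* x) :* x) refl x) ⟩
      (1# + x) * (1# + x) * x             ∎)))
      where
      open ≤-Reasoning
      -- A positive element of the set whose supremum is the root: y² ≤ x amounts to x ≤ (1 + x)².
      y = x / (1# + x)
      0<1+x : 0# < 1# + x
      0<1+x = <-≤-trans 0<x (by 0≤1 (solve 1 (λ x → con (+ 1) :+ x :- x := con (+ 1)) refl x))

    √-square : √ x * √ x ≈ x
    √-square = antisym s²≤x x≤s²
      where
      open ≤-Reasoning
      s = √ x
      r = s * s + x
      0<r : 0# < r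
      0<r = <-≤-trans 0<x (by (square-nonNeg s)
        (solve 2 (λ s x → s :* s :+ x :- x := s :* s) refl s x))
      0<2s : 0# < s + s
      0<2s = <-≤-trans √-pos (by √-nonNeg (solve 1 (λ s → s :+ s :- s := s) refl s))
      -- Two Newton steps: r/2s is an upper bound and 2sx/r belongs to the set.
      s²≤x : s * s ≤ x
      s²≤x = by (diff (≤-trans (*-monoˡ-≤ (proj₁ 0<2s) (⨆-≤ (0# , 0∈) u-bound))
        (≤-reflexive (*-/-cancel 0<2s))))
        (solve 2 (λ s x → x :- s :* s := s :* s :+ x :- (s :+ s) :* s) refl s x)
        where
        u = r / (s + s)
        u-bound : IsUpperBound InSet u
        u-bound y y²≤x = square-cancel-≤ (proj₁ 0<r ⊛ proj₁ (⁻¹-pos 0<2s)) (≤-trans y²≤x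
          (*-cancelˡ-≤ (*-pos 0<2s 0<2s) (begin
            (s + s) * (s + s) * x               ≤⟨ by (square-nonNeg (s * s + - x))
              (solve 2 (λ s x → (s :* s :+ x) :* (s :* s :+ x) :- (s :+ s) :* (s :+ s) :* x
                             := (s :* s :- x) :* (s :* s :- x)) refl s x) ⟩
            r * r                               ≈⟨ *-cong (*-/-cancel 0<2s) (*-/-cancel 0<2s) ⟨
            ((s + s) * u) * ((s + s) * u)
              ≈⟨ solve 2 (λ r y → (r :* y) :* (r :* y) := r :* r :* (y :* y)) refl (s + s) u ⟩
            (s + s) * (s + s) * (u * u)         ∎)))
      x≤s² : x ≤ s * s
      x≤s² = *-cancelˡ-≤ √-pos (by
        (diff (≤-trans (≤-reflexive (sym (*-/-cancel 0<r)))
        (*-monoˡ-≤ (proj₁ 0<r) (≤-⨆ bound y²≤x))))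
        (solve 2 (λ s x → s :* (s :* s) :- s :* x := (s :* s :+ x) :* s :- (s :+ s) :* x) refl s x))
        where
        y = (s + s) * x / r
        y²≤x : InSet y
        y²≤x = *-cancelˡ-≤ (*-pos 0<r 0<r) (begin
          r * r * (y * y)
            ≈⟨ solve 2 (λ r y → r :* r :* (y :* y) := (r :* y) :* (r :* y)) refl r y ⟩
          (r * y) * (r * y)                      ≈⟨ *-cong (*-/-cancel 0<r) (*-/-cancel 0<r) ⟩
          ((s + s) * x) * ((s + s) * x)          ≤⟨ by (proj₁ 0<x ⊛ square-nonNeg (s * s + - x))
            (solve 2 (λ s x → (s :* s :+ x) :* (s :* s :+ x) :* x :- (s :+ s) :* x :*
              ((s :+ s) :* x)
                           := x :* ((s :* s :- x) :* (s :* s :- x))) refl s x) ⟩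
          r * r * x                              ∎)

-- Estimates for the exponential and the logarithm

module Exponential (ℝ : CompleteOrderedField) where
  open OrderedField ℝ
  open Suprema ℝ
  open Sums ℝ
  open Multiples semiring using (×1-homo-*)

  ^-nonNeg : ∀ {x} n → 0# ≤ x → 0# ≤ x ^ n
  ^-nonNeg zero    0≤x = 0≤1
  ^-nonNeg (suc n) 0≤x = 0≤x ⊛ ^-nonNeg n 0≤x

  ^-monoˡ-≤ : ∀ {x y} n → 0# ≤ x → x ≤ y → x ^ n ≤ y ^ n
  ^-monoˡ-≤ zero    0≤x x≤y = ≤-refl
  ^-monoˡ-≤ (suc n) 0≤x x≤y = *-mono-≤ 0≤x (^-nonNeg n (≤-trans 0≤x x≤y)) x≤y (^-monoˡ-≤ n 0≤x x≤y)

  bernoulli : ∀ {h} n → 0# ≤ h → 1# + fromℕ n * h ≤ (1# + h) ^ n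
  bernoulli {h} zero    0≤h = ≤-reflexive
    (solve 1 (λ h → con (+ 1) :+ con (+ 0) :* h := con (+ 1)) refl h)
  bernoulli {h} (suc n) 0≤h = begin
    1# + (1# + fromℕ n) * h           ≤⟨ by (fromℕ-nonNeg n ⊛ (0≤h ⊛ 0≤h))
      (solve 2 (λ k h → (con (+ 1) :+ h) :* (con (+ 1) :+ k :* h) :- (con (+ 1) :+ (con (+ 1) :+ k)
        :* h)
                     := k :* (h :* h)) refl (fromℕ n) h) ⟩
    (1# + h) * (1# + fromℕ n * h)     ≤⟨ *-monoˡ-≤ (0≤1 ⊕ 0≤h) (bernoulli n 0≤h) ⟩
    (1# + h) * (1# + h) ^ n           ∎
    where open ≤-Reasoning

  -- Without such a k, induction keeps every power of 1 + h below x, and Bernoulli's inequality then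
  -- bounds all naturals by x / h.
  power-bracket : ∀ {x h} → 1# ≤ x → 0# < h →
    ¬ ¬ (∃[ k ] ((1# + h) ^ k ≤ x × x < (1# + h) ^ suc k))
  power-bracket {x} {h} 1≤x 0<h none = archimedean (x / h) λ n → *-cancelˡ-≤ 0<h (begin
    h * fromℕ n          ≤⟨ by 0≤1
      (solve 2 (λ h k → con (+ 1) :+ k :* h :- h :* k := con (+ 1)) refl h (fromℕ n)) ⟩
    1# + fromℕ n * h     ≤⟨ bernoulli n (proj₁ 0<h) ⟩
    (1# + h) ^ n         ≤⟨ below n ⟩
    x                    ≈⟨ *-/-cancel 0<h ⟨
    h * (x / h)          ∎)
    where
    open ≤-Reasoning
    below : ∀ n → (1# + h) ^ n ≤ x
    below zero    = 1≤x
    below (suc n) = ≤-stable λ x<p → none (n , below n , ≰⇒> x<p)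

  -- Convexity of the power: over an interval of length x it grows by at least x times its slope at
  -- the left end and, in `power-increment-upper`, by at most x times its slope at the right end.
  -- Divided by (j + 1)!, these bounds relate neighbouring terms of exponential series.
  power-increment-lower : ∀ {x y} j → 0# ≤ x → 0# ≤ y →
    y ^ suc j + fromℕ (suc j) * (x * y ^ j) ≤ (y + x) ^ suc j
  power-increment-lower {x} {y} zero 0≤x 0≤y = ≤-reflexive
    (solve 2 (λ x y → y :* con (+ 1) :+ (con (+ 1) :+ con (+ 0)) :* (x :* con (+ 1)) := (y :+ x) :*
      con (+ 1)) refl x y)
  power-increment-lower {x} {y} (suc j) 0≤x 0≤y = begin
    y * (y * p) + (1# + k) * (x * (y * p))
      ≤⟨ by (fromℕ-nonNeg (suc j) ⊛ (0≤x ⊛ (0≤x ⊛ ^-nonNeg j 0≤y)))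
      (solve 4 (λ x y k p → (y :+ x) :* (y :* p :+ k :* (x :* p)) :-
        (y :* (y :* p) :+ (con (+ 1) :+ k) :* (x :* (y :* p)))
                         := k :* (x :* (x :* p))) refl x y k p) ⟩
    (y + x) * (y * p + k * (x * p))
      ≤⟨ *-monoˡ-≤ (0≤y ⊕ 0≤x) (power-increment-lower j 0≤x 0≤y) ⟩
    (y + x) * (y + x) ^ suc j                      ∎
    where
    open ≤-Reasoning
    k = fromℕ (suc j)
    p = y ^ j

  power-increment-upper : ∀ {x y} j → 0# ≤ x → 0# ≤ y →
    (y + x) ^ suc j ≤ y ^ suc j + fromℕ (suc j) * (x * (y + x) ^ j)
  power-increment-upper {x} {y} zero 0≤x 0≤y = ≤-reflexive
    (solve 2 (λ x y → (y :+ x) :* con (+ 1) := y :* con (+ 1) :+ (con (+ 1) :+ con (+ 0)) :*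
      (x :* con (+ 1))) refl x y)
  power-increment-upper {x} {y} (suc j) 0≤x 0≤y = begin
    (y + x) * q                                        ≈⟨ distribʳ q y x ⟩
    y * q + x * q
      ≤⟨ +-mono-≤ (*-monoˡ-≤ 0≤y (power-increment-upper j 0≤x 0≤y)) ≤-refl ⟩
    y * (y * p + k * (x * r)) + x * ((y + x) * r)
      ≤⟨ by (fromℕ-nonNeg (suc j) ⊛ (0≤x ⊛ (0≤x ⊛ ^-nonNeg j (0≤y ⊕ 0≤x))))
      (solve 5 (λ x y k p r → y :* (y :* p) :+ (con (+ 1) :+ k) :* (x :* ((y :+ x) :* r))
                              :- (y :* (y :* p :+ k :* (x :* r)) :+ x :* ((y :+ x) :* r))
                           := k :* (x :* (x :* r))) refl x y k p r) ⟩
    y * (y * p) + (1# + k) * (x * ((y + x) * r))       ∎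
    where
    open ≤-Reasoning
    k = fromℕ (suc j)
    p = y ^ j
    r = (y + x) ^ j
    q = (y + x) ^ suc j

  factorial-pos : ∀ j → 0# < fromℕ (j !)
  factorial-pos zero    = fromℕ-pos 0
  factorial-pos (suc j) = <-respʳ (sym (×1-homo-* (suc j) (j !)))
    (*-pos (fromℕ-pos j) (factorial-pos j))

  1/_! : ℕ → Carrier
  1/ j ! = fromℕ (j !) ⁻¹

  1/!-nonNeg : ∀ j → 0# ≤ 1/ j !
  1/!-nonNeg j = proj₁ (⁻¹-pos (factorial-pos j))

  1/!-suc : ∀ j → fromℕ (suc j) * 1/ suc j ! ≈ 1/ j !
  1/!-suc j = begin-equality
    k * s               ≈⟨ *-identityˡ _ ⟨
    1# * (k * s)        ≈⟨ *-congʳ (x*x⁻¹≈1 (factorial-pos j)) ⟨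
    f * f ⁻¹ * (k * s)  ≈⟨ solve 4 (λ f g k s → f :* g :* (k :* s) := g :* (k :* f :* s)) refl f
      (f ⁻¹) k s ⟩
    f ⁻¹ * (k * f * s)  ≈⟨ *-congˡ (*-congʳ (×1-homo-* (suc j) (j !))) ⟨
    f ⁻¹ * (fromℕ (suc j !) * s)  ≈⟨ *-congˡ (x*x⁻¹≈1 (factorial-pos (suc j))) ⟩
    f ⁻¹ * 1#           ≈⟨ *-identityʳ _ ⟩
    f ⁻¹                ∎
    where
    open ≤-Reasoning
    k = fromℕ (suc j)
    f = fromℕ (j !)
    s = 1/ suc j !

  expTerm : Carrier → ℕ → Carrier
  expTerm x j = x ^ j * 1/ j !

  expTerm-nonNeg : ∀ {x} j → 0# ≤ x → 0# ≤ expTerm x j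
  expTerm-nonNeg j 0≤x = ^-nonNeg j 0≤x ⊛ 1/!-nonNeg j

  expTerm-lower : ∀ {x y} j → 0# ≤ x → 0# ≤ y → expTerm y (suc j) + x * expTerm y j ≤ expTerm
    (y + x) (suc j)
  expTerm-lower {x} {y} j 0≤x 0≤y = begin
    y ^ suc j * s + x * (y ^ j * 1/ j !)
      ≈⟨ +-congˡ (*-congˡ (*-congˡ (1/!-suc j))) ⟨
    y ^ suc j * s + x * (y ^ j * (k * s))
      ≈⟨ solve 5 (λ p x q k s → p :* s :+ x :* (q :* (k :* s)) := s :* (p :+ k :* (x :* q))) refl
      (y ^ suc j) x (y ^ j) k s ⟩
    s * (y ^ suc j + k * (x * y ^ j))
      ≤⟨ *-monoˡ-≤ (1/!-nonNeg (suc j)) (power-increment-lower j 0≤x 0≤y) ⟩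
    s * (y + x) ^ suc j                                      ≈⟨ *-comm _ _ ⟩
    (y + x) ^ suc j * s                                      ∎
    where
    open ≤-Reasoning
    k = fromℕ (suc j)
    s = 1/ suc j !

  expTerm-upper : ∀ {x y} j → 0# ≤ x → 0# ≤ y → expTerm (y + x) (suc j) ≤ expTerm y (suc j) + x *
    expTerm (y + x) j
  expTerm-upper {x} {y} j 0≤x 0≤y = begin
    (y + x) ^ suc j * s                                      ≈⟨ *-comm _ _ ⟩
    s * (y + x) ^ suc j
      ≤⟨ *-monoˡ-≤ (1/!-nonNeg (suc j)) (power-increment-upper j 0≤x 0≤y) ⟩
    s * (y ^ suc j + k * (x * (y + x) ^ j))
      ≈⟨ solve 5 (λ p x q k s → s :* (p :+ k :* (x :* q)) := p :* s :+ x :* (q :* (k :* s))) refl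
      (y ^ suc j) x ((y + x) ^ j) k s ⟩
    y ^ suc j * s + x * ((y + x) ^ j * (k * s))
      ≈⟨ +-congˡ (*-congˡ (*-congˡ (1/!-suc j))) ⟩
    y ^ suc j * s + x * ((y + x) ^ j * 1/ j !)               ∎
    where
    open ≤-Reasoning
    k = fromℕ (suc j)
    s = 1/ suc j !

  expPartialSum-mono-ℕ : ∀ {x} N → 0# ≤ x → expPartialSum x N ≤ expPartialSum x (suc N)
  expPartialSum-mono-ℕ {x} N 0≤x = go N (expTerm x) λ j → expTerm-nonNeg j 0≤x
    where
    go : ∀ N (t : ℕ → Carrier) → (∀ j → 0# ≤ t j) → sum {N} (λ k → t (toℕ k)) ≤ sum {suc N}
      (λ k → t (toℕ k))
    go zero    t 0≤t = 0≤t 0 ⊕ ≤-refl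
    go (suc N) t 0≤t = +-monoʳ-≤ (t 0) (go N (λ j → t (suc j)) (λ j → 0≤t (suc j)))

  expPartialSum-monoˡ-≤ : ∀ {x y} N → 0# ≤ x → x ≤ y → expPartialSum x N ≤ expPartialSum y N
  expPartialSum-monoˡ-≤ N 0≤x x≤y = sum-mono-≤ {N} λ k →
    by (1/!-nonNeg (toℕ k) ⊛ diff (^-monoˡ-≤ (toℕ k) 0≤x x≤y))
       (solve 3 (λ p q s → q :* s :- p :* s := s :* (q :- p)) refl _ _ _)

  -- The finite form of (1 + x) exp y ≤ exp (y + x); the next lemma is that of (1 - x) exp (y + x) ≤
  -- exp y. Together they stand in for the addition formula. The right side has one more term
  -- because multiplication by x raises each degree by one.
  1+x*expPartialSum≤ : ∀ {x y} N → 0# ≤ x → 0# ≤ y →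
    (1# + x) * expPartialSum y N ≤ expPartialSum (y + x) (suc N)
  1+x*expPartialSum≤ {x} {y} N 0≤x 0≤y = begin
    (1# + x) * E N
      ≈⟨ solve 2 (λ x e → (con (+ 1) :+ x) :* e := e :+ x :* e) refl x (E N) ⟩
    E N + x * E N
      ≤⟨ +-mono-≤ (expPartialSum-mono-ℕ N 0≤y) (≤-reflexive (*-distribˡ-sum {N} x _)) ⟩
    t₀ + S + sum (λ k → x * expTerm y (toℕ {N} k))     ≈⟨ +-assoc t₀ S _ ⟩
    t₀ + (S + sum (λ k → x * expTerm y (toℕ {N} k)))   ≈⟨ +-congˡ (∑-distrib-+ {N} _ _) ⟨
    t₀ + sum {N} (λ k → expTerm y (suc (toℕ k)) + x * expTerm y (toℕ k))
      ≤⟨ +-monoʳ-≤ t₀ (sum-mono-≤ {N} λ k → expTerm-lower (toℕ k) 0≤x 0≤y) ⟩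
    expPartialSum (y + x) (suc N)           ∎
    where
    open ≤-Reasoning
    E = expPartialSum y
    t₀ = expTerm y 0
    S = sum {N} (λ k → expTerm y (suc (toℕ k)))

  1-x*expPartialSum≤ : ∀ {x y} N → 0# ≤ x → 0# ≤ y →
    (1# + - x) * expPartialSum (y + x) N ≤ expPartialSum y N
  1-x*expPartialSum≤ {x} zero 0≤x 0≤y = ≤-reflexive (zeroʳ _)
  1-x*expPartialSum≤ {x} {y} (suc N) 0≤x 0≤y = begin
    (1# + - x) * E (suc N)
      ≈⟨ solve 2 (λ x e → (con (+ 1) :+ :- x) :* e := e :- x :* e) refl x (E (suc N)) ⟩
    E (suc N) + - (x * E (suc N))           ≤⟨ +-mono-≤ step ≤-refl ⟩
    expPartialSum y (suc N) + x * E (suc N) + - (x * E (suc N))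
      ≈⟨ solve 2 (λ a b → a :+ b :+ :- b := a) refl _ _ ⟩
    expPartialSum y (suc N)                 ∎
    where
    open ≤-Reasoning
    E = expPartialSum (y + x)
    t₀ = expTerm y 0
    S = sum {N} (λ k → expTerm y (suc (toℕ k)))
    step : E (suc N) ≤ expPartialSum y (suc N) + x * E (suc N)
    step = begin
      E (suc N)       ≤⟨ +-monoʳ-≤ t₀ (sum-mono-≤ {N} λ k → expTerm-upper (toℕ k) 0≤x 0≤y) ⟩
      t₀ + sum {N} (λ k → expTerm y (suc (toℕ k)) + x * expTerm (y + x) (toℕ k))
        ≈⟨ +-congˡ (∑-distrib-+ {N} _ _) ⟩
      t₀ + (S + sum {N} (λ k → x * expTerm (y + x) (toℕ k)))    ≈⟨ +-assoc t₀ S _ ⟨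
      t₀ + S + sum {N} (λ k → x * expTerm (y + x) (toℕ k))
        ≈⟨ +-congˡ (*-distribˡ-sum {N} x (λ k → expTerm (y + x) (toℕ k))) ⟨
      t₀ + S + x * E N
        ≤⟨ +-monoʳ-≤ (t₀ + S) (*-monoˡ-≤ 0≤x (expPartialSum-mono-ℕ N (0≤y ⊕ 0≤x))) ⟩
      t₀ + S + x * E (suc N)        ∎

  expPartialSum-0≤1 : ∀ N → expPartialSum 0# N ≤ 1#
  expPartialSum-0≤1 zero    = 0≤1
  expPartialSum-0≤1 (suc N) = ≤-reflexive (begin-equality
    1# * 1/ 0 ! + sum {N} (λ k → expTerm 0# (suc (toℕ k)))
      ≈⟨ +-cong (trans (*-congʳ (sym (+-identityʳ 1#))) (x*x⁻¹≈1 (factorial-pos 0)))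
           (sum-≈0 {N} λ k → trans (*-congʳ (zeroˡ (0# ^ toℕ k))) (zeroˡ (1/ suc (toℕ k) !))) ⟩
    1# + 0#   ≈⟨ +-identityʳ 1# ⟩
    1#        ∎)
    where open ≤-Reasoning

  -- Each factor exp x is at most 1 / (1 - x) ≤ p; the hypothesis on p says this without a division
  -- and excludes x ≥ 1.
  expPartialSum-upper : ∀ {x p} k N → 0# ≤ x → 0# ≤ p → 1# ≤ p * (1# + - x) → expPartialSum
    (fromℕ k * x) N ≤ p ^ k
  expPartialSum-upper {x} {p} zero N 0≤x 0≤p 1≤p[1-x] =
    ≤-trans (expPartialSum-monoˡ-≤ N (fromℕ-nonNeg 0 ⊛ 0≤x) (≤-reflexive (zeroˡ x)))
      (expPartialSum-0≤1 N)
  expPartialSum-upper {x} {p} (suc k) N 0≤x 0≤p 1≤p[1-x] = begin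
    expPartialSum ((1# + fromℕ k) * x) N
      ≤⟨ expPartialSum-monoˡ-≤ N (fromℕ-nonNeg (suc k) ⊛ 0≤x)
      (≤-reflexive (solve 2 (λ k x → (con (+ 1) :+ k) :* x := k :* x :+ x) refl (fromℕ k) x)) ⟩
    e                                           ≈⟨ *-identityˡ e ⟨
    1# * e
      ≤⟨ *-mono-≤ 0≤1 (sum-nonNeg {N} λ j → expTerm-nonNeg (toℕ j) (0≤kx ⊕ 0≤x)) 1≤p[1-x] ≤-refl ⟩
    p * (1# + - x) * e                          ≈⟨ *-assoc p _ e ⟩
    p * ((1# + - x) * e)                        ≤⟨ *-monoˡ-≤ 0≤p (1-x*expPartialSum≤ N 0≤x 0≤kx) ⟩
    p * expPartialSum (fromℕ k * x) N
      ≤⟨ *-monoˡ-≤ 0≤p (expPartialSum-upper k N 0≤x 0≤p 1≤p[1-x]) ⟩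
    p * p ^ k                                   ∎
    where
    open ≤-Reasoning
    0≤kx = fromℕ-nonNeg k ⊛ 0≤x
    e = expPartialSum (fromℕ k * x + x) N

  -- Each factor 1 + x costs one more term of the series, whence `suc K`. The slack y lets
  -- `power≤exp` reach every exponent that is at least K x.
  expPartialSum-lower : ∀ {x y} K → 0# ≤ x → 0# ≤ y → (1# + x) ^ K ≤ expPartialSum (y + fromℕ K * x)
    (suc K)
  expPartialSum-lower {x} {y} zero 0≤x 0≤y = ≤-reflexive (sym (begin-equality
    1# * 1/ 0 ! + 0#  ≈⟨ +-identityʳ _ ⟩
    1# * 1/ 0 !       ≈⟨ *-congʳ (+-identityʳ 1#) ⟨
    (1# + 0#) * 1/ 0 ! ≈⟨ x*x⁻¹≈1 (factorial-pos 0) ⟩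
    1#        ∎))
    where open ≤-Reasoning
  expPartialSum-lower {x} {y} (suc K) 0≤x 0≤y = begin
    (1# + x) * (1# + x) ^ K
      ≤⟨ *-monoˡ-≤ (0≤1 ⊕ 0≤x) (expPartialSum-lower K 0≤x 0≤y) ⟩
    (1# + x) * expPartialSum (y + fromℕ K * x) (suc K)
      ≤⟨ 1+x*expPartialSum≤ (suc K) 0≤x 0≤y+Kx ⟩
    expPartialSum (y + fromℕ K * x + x) (suc (suc K))
      ≤⟨ expPartialSum-monoˡ-≤ (suc (suc K)) (0≤y+Kx ⊕ 0≤x)
      (≤-reflexive (solve 3 (λ k x y → y :+ k :* x :+ x := y :+ (con (+ 1) :+ k) :* x) refl
        (fromℕ K) x y)) ⟩
    expPartialSum (y + fromℕ (suc K) * x) (suc (suc K))    ∎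
    where
    open ≤-Reasoning
    0≤y+Kx = 0≤y ⊕ (fromℕ-nonNeg K ⊛ 0≤x)

  -- For a natural n ≥ 2x the bound is 2^n: there exp x ≤ exp (n/2), and exp ½ ≤ 1 / (1 - ½) = 2.
  -- The double negation comes from the choice of n.
  expPartialSum-bounded : ∀ {x} → 0# ≤ x → ¬ ¬
    (∃ (IsUpperBound (λ y → ∃[ N ] y ≈ expPartialSum x N)))
  expPartialSum-bounded {x} 0≤x unbounded = archimedean (2# * x) λ n → ≤-stable λ n≰2x → unbounded
    (2# ^ n , λ y (N , y≈E) → begin
      y                             ≈⟨ y≈E ⟩
      expPartialSum x N             ≤⟨ expPartialSum-monoˡ-≤ N 0≤x (*-cancelˡ-≤ 0<2 (begin
        2# * x             ≤⟨ ≰⇒≥ n≰2x ⟩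
        fromℕ n            ≈⟨ *-identityʳ _ ⟨
        fromℕ n * 1#       ≈⟨ *-congˡ (x*x⁻¹≈1 0<2) ⟨
        fromℕ n * (2# * ½) ≈⟨ solve 3 (λ n a b → n :* (a :* b) := a :* (n :* b)) refl (fromℕ n) 2# ½
          ⟩
        2# * (fromℕ n * ½) ∎)) ⟩
      expPartialSum (fromℕ n * ½) N
        ≤⟨ expPartialSum-upper n N (proj₁ (⁻¹-pos 0<2)) (proj₁ 0<2) (≤-reflexive (begin-equality
        1#                 ≈⟨ solve 0 (con (+ 1) := con (+ 2) :- con (+ 1)) refl ⟩
        2# + - 1#          ≈⟨ +-congˡ (-‿cong (x*x⁻¹≈1 0<2)) ⟨
        2# + - (2# * ½)    ≈⟨ solve 2 (λ a b → a :- a :* b := a :* (con (+ 1) :- b)) refl 2# ½ ⟩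
        2# * (1# + - ½)    ∎)) ⟩
      2# ^ n                        ∎)
    where
    open ≤-Reasoning
    0<2 = fromℕ-pos 1
    ½ = 2# ⁻¹

  exp≈exp⁺ : ∀ {x} → 0# ≤ x → exp x ≈ exp⁺ x
  exp≈exp⁺ {x} 0≤x with 0# ≤? x
  ... | yes _   = refl
  ... | no  0≰x = contradiction 0≤x 0≰x

  expPartialSum≤exp : ∀ {x} N → 0# ≤ x → expPartialSum x N ≤ exp x
  expPartialSum≤exp {x} N 0≤x = ≤-trans (≤-stable λ E≰exp → expPartialSum-bounded 0≤x λ
    (u , u-bound) →
    E≰exp (≤-⨆ u-bound (N , refl))) (≤-reflexive (sym (exp≈exp⁺ 0≤x)))

  exp≤ : ∀ {x u} → 0# ≤ x → (∀ N → expPartialSum x N ≤ u) → exp x ≤ u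
  exp≤ 0≤x E≤u = ≤-trans (≤-reflexive (exp≈exp⁺ 0≤x))
    (⨆-≤ (_ , 0 , refl) λ y (N , y≈E) → ≤-trans (≤-reflexive y≈E) (E≤u N))

  power≤exp : ∀ {x y} K → 0# ≤ x → fromℕ K * x ≤ y → (1# + x) ^ K ≤ exp y
  power≤exp {x} {y} K 0≤x Kx≤y = begin
    (1# + x) ^ K
      ≤⟨ expPartialSum-lower K 0≤x (diff Kx≤y) ⟩
    expPartialSum (y + - (fromℕ K * x) + fromℕ K * x) (suc K)
      ≤⟨ expPartialSum-monoˡ-≤ (suc K) (diff Kx≤y ⊕ 0≤Kx)
      (≤-reflexive (solve 2 (λ y a → y :- a :+ a := y) refl y (fromℕ K * x))) ⟩
    expPartialSum y (suc K)
      ≤⟨ expPartialSum≤exp (suc K) (≤-trans 0≤Kx Kx≤y) ⟩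
    exp y                                                  ∎
    where
    open ≤-Reasoning
    0≤Kx = fromℕ-nonNeg K ⊛ 0≤x

  -- The supremum that defines `log x` has content only for a bounded set. Here x itself is a bound,
  -- as w ≤ 1 + w ≤ exp w ≤ x for nonnegative w.
  exp≤⇒≤log : ∀ {x y} → 0# ≤ x → 0# ≤ y → exp y ≤ x → y ≤ log x
  exp≤⇒≤log {x} {y} 0≤x 0≤y exp-y≤x = ≤-⨆ bound exp-y≤x
    where
    open ≤-Reasoning
    bound : IsUpperBound (λ w → exp w ≤ x) x
    bound w exp-w≤x with total 0# w
    ... | inj₂ w≤0 = ≤-trans w≤0 0≤x
    ... | inj₁ 0≤w = begin
      w                      ≤⟨ by 0≤1
        (solve 1 (λ w → (con (+ 1) :+ w) :* con (+ 1) :- w := con (+ 1)) refl w) ⟩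
      (1# + w) ^ 1           ≤⟨ power≤exp 1 0≤w (≤-reflexive
        (solve 1 (λ w → (con (+ 1) :+ con (+ 0)) :* w := w) refl w)) ⟩
      exp w                  ≤⟨ exp-w≤x ⟩
      x                      ∎

  -- Used in place of k log p ≤ log u: since exp x ≤ p, the number k x is a lower bound for the
  -- logarithm of p^k.
  multiple≤log : ∀ {x p u} k → 0# ≤ x → 0# ≤ p → 1# ≤ p * (1# + - x) → p ^ k ≤ u → fromℕ k * x ≤ log
    u
  multiple≤log k 0≤x 0≤p 1≤p[1-x] p^k≤u = exp≤⇒≤log (≤-trans (^-nonNeg k 0≤p) p^k≤u) 0≤kx
    (exp≤ 0≤kx λ N → ≤-trans (expPartialSum-upper k N 0≤x 0≤p 1≤p[1-x]) p^k≤u)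
    where 0≤kx = fromℕ-nonNeg k ⊛ 0≤x

-- Semidefinite forms, the smallest eigenvalue and Perron positivity

module QuadraticForms (ℝ : CompleteOrderedField) where
  open OrderedField ℝ
  open Suprema ℝ
  open Sums ℝ
  open LinearAlgebra ℝ

  infix 8 _∙_
  _∙_ : ∀ {n} → Vector Carrier n → Vector Carrier n → Carrier
  x ∙ y = sum (λ i → x i * y i)

  form : ∀ {n} → Matrix n n → Vector Carrier n → Carrier
  form A x = x ∙ (A · x)

  Symmetric PositiveSemidefinite : ∀ {n} → Matrix n n → Set
  Symmetric A = ∀ i j → A i j ≈ A j i
  PositiveSemidefinite A = ∀ x → 0# ≤ form A x

  combination : ∀ {n} → Carrier → Vector Carrier n → Carrier → Vector Carrier n → Vector Carrier n
  combination s x t y i = s * x i + t * y i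

  sum-combination : ∀ {n} s t (f g : Vector Carrier n) → sum (λ i → s * f i + t * g i) ≈ s * sum f +
    t * sum g
  sum-combination {n} s t f g = trans (∑-distrib-+ {n} _ _)
    (sym (+-cong (*-distribˡ-sum {n} s f) (*-distribˡ-sum {n} t g)))

  ∙-cong : ∀ {n} {x x′ y y′ : Vector Carrier n} → (∀ i → x i ≈ x′ i) → (∀ i → y i ≈ y′ i) → x ∙ y ≈
    x′ ∙ y′
  ∙-cong x≈x′ y≈y′ = sum-cong λ i → *-cong (x≈x′ i) (y≈y′ i)

  ∙-combinationˡ : ∀ {n} s (x : Vector Carrier n) t y w → combination s x t y ∙ w ≈ s * x ∙ w + t *
    y ∙ w
  ∙-combinationˡ {n} s x t y w = trans
    (sum-cong λ i → solve 5 (λ s x t y w → (s :* x :+ t :* y) :* w := s :* (x :* w) :+ t :*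
      (y :* w)) refl s (x i) t (y i) (w i))
    (sum-combination {n} s t _ _)

  ∙-combinationʳ : ∀ {n} s (x : Vector Carrier n) t y w → w ∙ combination s x t y ≈ s * w ∙ x + t *
    w ∙ y
  ∙-combinationʳ {n} s x t y w = trans
    (sum-cong λ i → solve 5 (λ s x t y w → w :* (s :* x :+ t :* y) := s :* (w :* x) :+ t :*
      (w :* y)) refl s (x i) t (y i) (w i))
    (sum-combination {n} s t _ _)

  ∙-self-nonNeg : ∀ {n} (x : Vector Carrier n) → 0# ≤ x ∙ x
  ∙-self-nonNeg x = sum-nonNeg λ i → square-nonNeg (x i)

  square≈0⇒≈0 : ∀ {x} → x * x ≈ 0# → x ≈ 0#
  square≈0⇒≈0 {x} x²≈0 with x ≟ 0#
  ... | yes x≈0 = x≈0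
  ... | no  x≉0 = x*y≈0⇒y≈0 x≉0 x²≈0

  ∙-self≈0⇒≈0 : ∀ {n} {x : Vector Carrier n} → x ∙ x ≈ 0# → ∀ i → x i ≈ 0#
  ∙-self≈0⇒≈0 {x = x} x∙x≈0 i = square≈0⇒≈0 (antisym
    (≤-trans (term≤sum (λ j → square-nonNeg (x j)) i) (≤-reflexive x∙x≈0)) (square-nonNeg (x i)))

  ∙-self-pos : ∀ {n} {x : Vector Carrier n} i → ¬ (x i ≈ 0#) → 0# < x ∙ x
  ∙-self-pos {x = x} i xᵢ≉0 = ∙-self-nonNeg x , λ 0≈x∙x → xᵢ≉0 (∙-self≈0⇒≈0 (sym 0≈x∙x) i)

  ·-combination : ∀ {k n} (A : Matrix k n) s x t y i → (A · combination s x t y) i ≈ s * (A · x) i +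
    t * (A · y) i
  ·-combination A s x t y i = ∙-combinationʳ s x t y (A i)

  self-adjoint : ∀ {n} {A : Matrix n n} → Symmetric A → ∀ x y → x ∙ (A · y) ≈ y ∙ (A · x)
  self-adjoint {n} {A} symmetric x y = begin-equality
    sum (λ i → x i * sum (λ j → A i j * y j))
      ≈⟨ sum-cong (λ i → *-distribˡ-sum {n} (x i) _) ⟩
    sum (λ i → sum (λ j → x i * (A i j * y j)))      ≈⟨ ∑-comm (λ i j → x i * (A i j * y j)) ⟩
    sum (λ j → sum (λ i → x i * (A i j * y j)))
      ≈⟨ sum-cong (λ j → sum-cong (λ i → trans (*-congˡ (*-congʳ (symmetric i j)))
      (solve 3 (λ x a y → x :* (a :* y) := y :* (a :* x)) refl (x i) (A j i) (y j)))) ⟩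
    sum (λ j → sum (λ i → y j * (A j i * x i)))
      ≈⟨ sum-cong (λ j → *-distribˡ-sum {n} (y j) _) ⟨
    sum (λ j → y j * sum (λ i → A j i * x i))        ∎
    where open ≤-Reasoning

  form-combination : ∀ {n} {A : Matrix n n} → Symmetric A → ∀ s x t y →
    form A (combination s x t y) ≈ s * s * form A x + 2# * (s * t) * (y ∙ (A · x)) + t * t * form A
      y
  form-combination {A = A} symmetric s x t y = begin-equality
    combination s x t y ∙ (A · combination s x t y)
      ≈⟨ ∙-cong {x = combination s x t y} (λ _ → refl) (·-combination A s x t y) ⟩
    combination s x t y ∙ combination s (A · x) t (A · y)
      ≈⟨ ∙-combinationʳ s (A · x) t (A · y) (combination s x t y) ⟩
    s * combination s x t y ∙ (A · x) + t * combination s x t y ∙ (A · y)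
      ≈⟨ +-cong (*-congˡ (∙-combinationˡ s x t y (A · x)))
        (*-congˡ (∙-combinationˡ s x t y (A · y))) ⟩
    s * (s * form A x + t * y ∙ (A · x)) + t * (s * x ∙ (A · y) + t * form A y)
      ≈⟨ +-congˡ (*-congˡ (+-congʳ (*-congˡ (self-adjoint symmetric x y)))) ⟩
    s * (s * form A x + t * y ∙ (A · x)) + t * (s * y ∙ (A · x) + t * form A y)
      ≈⟨ solve 5 (λ s t p q r → s :* (s :* p :+ t :* q) :+ t :* (s :* q :+ t :* r)
                := s :* s :* p :+ con (+ 2) :* (s :* t) :* q :+ t :* t :* r) refl s t (form A x)
                  (y ∙ (A · x)) (form A y) ⟩
    s * s * form A x + 2# * (s * t) * (y ∙ (A · x)) + t * t * form A y  ∎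
    where open ≤-Reasoning

  -- With u = Ax and r = form A u, the value of the form at (r + 1)x − |u|²u
  -- is −(r + 2)|u|⁴.
  form≈0⇒kernel : ∀ {n} {A : Matrix n n} → Symmetric A → PositiveSemidefinite A →
    ∀ {x} → form A x ≈ 0# → ∀ i → (A · x) i ≈ 0#
  form≈0⇒kernel {A = A} symmetric psd {x} form≈0 = ∙-self≈0⇒≈0
    (square≈0⇒≈0 (antisym p²≤0 (square-nonNeg p)))
    where
    open ≤-Reasoning
    u = A · x
    p = u ∙ u
    r = form A u
    0<r+2 : 0# < r + 2#
    0<r+2 = <-≤-trans (fromℕ-pos 1) (by (psd u)
      (solve 1 (λ r → r :+ con (+ 2) :- con (+ 2) := r) refl r))
    p²≤0 : p * p ≤ 0#
    p²≤0 = *-cancelˡ-≤ 0<r+2 (by (psd (combination (r + 1#) x (- p) u)) (begin-equality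
      (r + 2#) * 0# + - ((r + 2#) * (p * p))
        ≈⟨ solve 2 (λ r p → (r :+ con (+ 2)) :* con (+ 0) :- (r :+ con (+ 2)) :* (p :* p)
                  := (r :+ con (+ 1)) :* (r :+ con (+ 1)) :* con (+ 0) :+ con (+ 2) :*
                    ((r :+ con (+ 1)) :* (:- p)) :* p :+ (:- p) :* (:- p) :* r) refl r p ⟩
      (r + 1#) * (r + 1#) * 0# + 2# * ((r + 1#) * - p) * p + - p * - p * r
        ≈⟨ +-congʳ (+-congʳ (*-congˡ form≈0)) ⟨
      (r + 1#) * (r + 1#) * form A x + 2# * ((r + 1#) * - p) * p + - p * - p * r
        ≈⟨ form-combination symmetric (r + 1#) x (- p) u ⟨
      form A (combination (r + 1#) x (- p) u) ∎))

  -- A Cauchy-Schwarz inequality with a crude constant, by induction from (p + q)² ≤ 2p² + 2q². Some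
  -- finite K is all that `coercive` asks for.
  ∙-bounded : ∀ {n} (b : Vector Carrier n) → ∃[ K ] (0# ≤ K × (∀ y → b ∙ y * b ∙ y ≤ K * y ∙ y))
  ∙-bounded {zero}  b = 0# , ≤-refl , λ y → ≤-refl
  ∙-bounded {suc n} b with ∙-bounded (λ i → b (suc i))
  ... | K , 0≤K , bound = 2# * (b₀ * b₀) + 2# * K ,
    ((fromℕ-nonNeg 2 ⊛ square-nonNeg b₀) ⊕ (fromℕ-nonNeg 2 ⊛ 0≤K)) , λ y →
      let y₀ = y zero
          c  = (λ i → b (suc i)) ∙ (λ i → y (suc i))
          Y  = (λ i → y (suc i)) ∙ (λ i → y (suc i))
      in by (square-nonNeg (b₀ * y₀ + - c) ⊕ fromℕ-nonNeg 2 ⊛ diff (bound (λ i → y (suc i)))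
              ⊕ (fromℕ-nonNeg 2 ⊛ square-nonNeg b₀) ⊛ ∙-self-nonNeg (λ i → y (suc i))
              ⊕ (fromℕ-nonNeg 2 ⊛ 0≤K) ⊛ square-nonNeg y₀)
         (solve 5 (λ b y c k Y → (con (+ 2) :* (b :* b) :+ con (+ 2) :* k) :* (y :* y :+ Y)
                                 :- (b :* y :+ c) :* (b :* y :+ c)
                              := (b :* y :- c) :* (b :* y :- c) :+ con (+ 2) :* (k :* Y :- c :* c)
                                 :+ con (+ 2) :* (b :* b) :* Y :+ con (+ 2) :* k :* (y :* y))
           refl b₀ y₀ c K Y)
    where b₀ = b zero

  IsKernelVector : ∀ {n} → Matrix n n → Vector Carrier n → Set
  IsKernelVector A x = (∃[ i ] ¬ (x i ≈ 0#)) × (∀ i → (A · x) i ≈ 0#)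

  -- Positive definiteness with a uniform margin, so that ε can be subtracted from the diagonal
  -- without losing semidefiniteness.
  IsCoercive : ∀ {n} → Matrix n n → Carrier → Set
  IsCoercive A ε = 0# < ε × (∀ x → ε * x ∙ x ≤ form A x)

  -- One step of Gaussian elimination. The matrix has corner a, first row b and remaining block C;
  -- `a′` is 1/a, and the complement is C minus the outer square of b divided by a.
  module SchurComplement {n} (A : Matrix (suc n) (suc n)) (symmetric : Symmetric A)
    (0<a : 0# < A zero zero) where
    a = A zero zero
    a′ = a ⁻¹
    b : Vector Carrier n
    b i = A zero (suc i)

    C complement : Matrix n n
    C i j = A (suc i) (suc j)
    complement i j = C i j + - (b i * a′ * b j)

    tail : Vector Carrier (suc n) → Vector Carrier n
    tail x i = x (suc i)

    complement-symmetric : Symmetric complement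
    complement-symmetric i j = +-cong (symmetric (suc i) (suc j))
      (-‿cong (solve 3 (λ x a y → x :* a :* y := y :* a :* x) refl (b i) a′ (b j)))

    complement-· : ∀ y i → (complement · y) i ≈ (C · y) i + - (a′ * b ∙ y) * b i
    complement-· y i = begin-equality
      sum (λ j → (C i j + - (b i * a′ * b j)) * y j)
        ≈⟨ sum-cong (λ j → solve 5 (λ c x a b y → (c :- x :* a :* b) :* y := con (+ 1) :* (c :* y)
          :+ (:- (x :* a)) :* (b :* y)) refl (C i j) (b i) a′ (b j) (y j)) ⟩
      sum (λ j → 1# * (C i j * y j) + - (b i * a′) * (b j * y j))
        ≈⟨ sum-combination {n} 1# (- (b i * a′)) _ _ ⟩
      1# * (C · y) i + - (b i * a′) * b ∙ y
        ≈⟨ solve 4 (λ c x a b → con (+ 1) :* c :+ (:- (x :* a)) :* b := c :+ (:- (a :* b)) :* x)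
          refl ((C · y) i) (b i) a′ (b ∙ y) ⟩
      (C · y) i + - (a′ * b ∙ y) * b i ∎
      where open ≤-Reasoning

    complement-form : ∀ y → form complement y ≈ form C y + - (a′ * (b ∙ y * b ∙ y))
    complement-form y = begin-equality
      y ∙ (complement · y)
        ≈⟨ ∙-cong {x = y} (λ _ → refl) (λ i → trans (complement-· y i)
          (+-congʳ (sym (*-identityˡ _)))) ⟩
      y ∙ combination 1# (C · y) (- (a′ * b ∙ y)) b
        ≈⟨ ∙-combinationʳ 1# (C · y) (- (a′ * b ∙ y)) b y ⟩
      1# * form C y + - (a′ * b ∙ y) * y ∙ b
        ≈⟨ +-congˡ (*-congˡ (sum-cong λ i → *-comm (y i) (b i))) ⟩
      1# * form C y + - (a′ * b ∙ y) * b ∙ y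
        ≈⟨ solve 3 (λ c a b → con (+ 1) :* c :+ (:- (a :* b)) :* b := c :- a :* (b :* b)) refl
          (form C y) a′ (b ∙ y) ⟩
      form C y + - (a′ * (b ∙ y * b ∙ y)) ∎
      where open ≤-Reasoning

    form-split : ∀ x → form A x ≈
      a * ((x zero + a′ * b ∙ tail x) * (x zero + a′ * b ∙ tail x)) + form complement (tail x)
    form-split x = begin-equality
      x₀ * (a * x₀ + β) + sum (λ i → y i * (A (suc i) zero * x₀ + (C · y) i))
        ≈⟨ +-congˡ (sum-cong λ i → trans (*-congˡ (+-congʳ (*-congʳ (symmetric (suc i) zero))))
             (solve 4 (λ y b x c → y :* (b :* x :+ c) := x :* (b :* y) :+ con (+ 1) :* (y :* c))
               refl (y i) (b i) x₀ ((C · y) i))) ⟩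
      x₀ * (a * x₀ + β) + sum (λ i → x₀ * (b i * y i) + 1# * (y i * (C · y) i))
        ≈⟨ +-congˡ (sum-combination {n} x₀ 1# _ _) ⟩
      x₀ * (a * x₀ + β) + (x₀ * β + 1# * form C y)
        ≈⟨ solve 4 (λ x a b c → x :* (a :* x :+ b) :+ (x :* b :+ con (+ 1) :* c) := a :* (x :* x) :+
          con (+ 2) :* con (+ 1) :* (x :* b) :+ c) refl x₀ a β (form C y) ⟩
      a * (x₀ * x₀) + 2# * 1# * (x₀ * β) + form C y
        -- The explicit factor 1 from the previous step becomes a a′. With it, completing the square
        -- in x₀ + a′β is a polynomial identity.
        ≈⟨ +-congʳ (+-congˡ (*-congʳ (*-congˡ (x*x⁻¹≈1 0<a)))) ⟨
      a * (x₀ * x₀) + 2# * (a * a′) * (x₀ * β) + form C y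
        ≈⟨ solve 6 (λ x a a′ b c u → a :* (x :* x) :+ con (+ 2) :* (a :* a′) :* (x :* b) :+ c
               := a :* ((x :+ a′ :* b) :* (x :+ a′ :* b)) :+ (c :- (a :* a′) :* (a′ :* (b :* b))))
                 refl x₀ a a′ β (form C y) 0# ⟩
      a * ((x₀ + a′ * β) * (x₀ + a′ * β)) + (form C y + - (a * a′ * (a′ * (β * β))))
        ≈⟨ +-congˡ (+-congˡ (-‿cong (trans (*-congʳ (x*x⁻¹≈1 0<a)) (*-identityˡ _)))) ⟩
      a * ((x₀ + a′ * β) * (x₀ + a′ * β)) + (form C y + - (a′ * (β * β)))
        ≈⟨ +-congˡ (complement-form y) ⟨
      a * ((x₀ + a′ * β) * (x₀ + a′ * β)) + form complement y ∎
      where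
      open ≤-Reasoning
      x₀ = x zero
      y = tail x
      β = b ∙ y

    -- The new coordinate is the one that makes the completed square vanish, so it minimizes the
    -- form of A over all extensions of y.
    extend : Vector Carrier n → Vector Carrier (suc n)
    extend y zero    = - (a′ * b ∙ y)
    extend y (suc i) = y i

    form-extend : ∀ y → form A (extend y) ≈ form complement y
    form-extend y = trans (form-split (extend y))
      (solve 3 (λ a c f → a :* ((:- c :+ c) :* (:- c :+ c)) :+ f := f) refl a (a′ * b ∙ y)
        (form complement y))

    complement-psd : PositiveSemidefinite A → PositiveSemidefinite complement
    complement-psd psd y = nonNeg (psd (extend y)) (sym (form-extend y))

    extend-kernel : PositiveSemidefinite A → ∀ {y} → IsKernelVector complement y → IsKernelVector A
      (extend y)
    extend-kernel psd {y} ((i , yᵢ≉0) , Sy≈0) = (suc i , yᵢ≉0) , form≈0⇒kernel symmetric psd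
      {extend y}
      (trans (form-extend y) (sum-≈0 λ j → trans (*-congˡ (Sy≈0 j)) (zeroʳ (y j))))

    coercive : ∀ {ε} → IsCoercive complement ε → ∃ (IsCoercive A)
    coercive {ε} (0<ε , bound) with ∙-bounded b
    ... | K , 0≤K , b-bound = a * ε / D , *-pos (*-pos 0<a 0<ε) (⁻¹-pos 0<D) , λ x →
      let u = x zero + a′ * b ∙ tail x
          β = b ∙ tail x
          Y = tail x ∙ tail x
      in *-cancelˡ-≤ 0<D (begin
        D * (a * ε / D * x ∙ x)       ≈⟨ *-assoc D _ _ ⟨
        D * (a * ε / D) * x ∙ x       ≈⟨ *-congʳ (*-/-cancel 0<D) ⟩
        a * ε * (x zero * x zero + Y) ≤⟨ *-monoˡ-≤ (proj₁ (*-pos 0<a 0<ε)) (norm-bound x) ⟩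
        a * ε * (2# * (u * u) + L * Y)  ≤⟨ by
          ((fromℕ-nonNeg 2 ⊛ (proj₁ 0<ε ⊛ proj₁ 0<ε)) ⊛ ∙-self-nonNeg (tail x)
           ⊕ (proj₁ 0<a ⊛ proj₁ 0<a) ⊛ (0≤L ⊛ square-nonNeg u))
          (solve 5 (λ a e L s Y → (con (+ 2) :* e :+ a :* L) :* (a :* s :+ e :* Y) :- a :* e :*
            (con (+ 2) :* s :+ L :* Y)
             := con (+ 2) :* (e :* e) :* Y :+ a :* a :* (L :* s)) refl a ε L (u * u) Y) ⟩
        D * (a * (u * u) + ε * Y)     ≤⟨ *-monoˡ-≤ (proj₁ 0<D) (+-mono-≤ ≤-refl (bound (tail x))) ⟩
        D * (a * (u * u) + form complement (tail x))  ≈⟨ *-congˡ (form-split x) ⟨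
        D * form A x                  ∎)
      where
      open ≤-Reasoning
      -- From x₀ = u - a′β follows |x|² ≤ 2u² + L|y|², where y is the tail of x. The resulting
      -- margin aε/D lies below both a/2 and ε/L, the margins that the two squares afford.
      L = 2# * (a′ * a′ * K) + 1#
      D = 2# * ε + a * L
      0≤L : 0# ≤ L
      0≤L = fromℕ-nonNeg 2 ⊛ (square-nonNeg a′ ⊛ 0≤K) ⊕ 0≤1
      norm-bound : ∀ x → x ∙ x ≤ 2# * ((x zero + a′ * b ∙ tail x) * (x zero + a′ * b ∙ tail x)) + L
        * tail x ∙ tail x
      norm-bound x = by
        (square-nonNeg (x zero + 2# * (a′ * b ∙ tail x)) ⊕ fromℕ-nonNeg 2 ⊛
          (square-nonNeg a′ ⊛ diff (b-bound (tail x))))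
        (solve 5 (λ x a′ β k Y → con (+ 2) :* ((x :+ a′ :* β) :* (x :+ a′ :* β)) :+
          (con (+ 2) :* (a′ :* a′ :* k) :+ con (+ 1)) :* Y
               :- (x :* x :+ Y) := (x :+ con (+ 2) :* (a′ :* β)) :* (x :+ con (+ 2) :* (a′ :* β)) :+
                 con (+ 2) :* (a′ :* a′ :* (k :* Y :- β :* β)))
            refl (x zero) a′ (b ∙ tail x) K (tail x ∙ tail x))
      0<D : 0# < D
      0<D = <-≤-trans (*-pos (fromℕ-pos 1) 0<ε) (by (proj₁ 0<a ⊛ 0≤L)
        (solve 2 (λ x y → x :+ y :- x := y) refl (2# * ε) (a * L)))

  -- Elimination decides the alternative and replaces compactness of the unit sphere. A zero corner
  -- makes the first unit vector a null vector of the form, hence of A; a positive corner passes the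
  -- question to the Schur complement, and both answers lift back.
  kernel-or-coercive : ∀ {n} (A : Matrix n n) → Symmetric A → PositiveSemidefinite A →
    ∃ (IsKernelVector A) ⊎ ∃ (IsCoercive A)
  kernel-or-coercive {zero} A symmetric psd = inj₂ (1# , 0<1 , λ x → ≤-reflexive (zeroʳ 1#))
  kernel-or-coercive {suc n} A symmetric psd with A zero zero ≤? 0#
  ... | yes a≤0 = inj₁ (𝟙 zero , (zero , λ 1≈0 → 0≉1 (sym 1≈0)) , form≈0⇒kernel symmetric psd
    {𝟙 zero} (antisym (≤-trans (≤-reflexive form≈a) a≤0) (psd (𝟙 zero))))
    where
    form≈a : form A (𝟙 zero) ≈ A zero zero
    form≈a = trans (sum-𝟙 zero (A · 𝟙 zero))
      (trans (sum-cong {suc n} λ j → *-comm (A zero j) (𝟙 zero j)) (sum-𝟙 zero (A zero)))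
  ... | no a≰0 = [ (λ (y , kernel) → inj₁ (extend y , extend-kernel psd {y} kernel))
                 , (λ (ε , c) → inj₂ (coercive {ε} c)) ]′
                 (kernel-or-coercive complement complement-symmetric (complement-psd psd))
    where open SchurComplement A symmetric (≰⇒> a≰0)

  shift : ∀ {n} → Matrix n n → Carrier → Matrix n n
  shift M t i j = M i j + - (t * 𝟙 i j)

  shift-· : ∀ {n} (M : Matrix n n) t x i → (shift M t · x) i ≈ (M · x) i + - (t * x i)
  shift-· {n} M t x i = begin-equality
    sum (λ j → (M i j + - (t * 𝟙 i j)) * x j)
      ≈⟨ sum-cong (λ j → solve 4 (λ m t e x → (m :- t :* e) :* x := con (+ 1) :* (m :* x) :+ (:- t)
        :* (e :* x)) refl (M i j) t (𝟙 i j) (x j)) ⟩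
    sum (λ j → 1# * (M i j * x j) + (- t) * (𝟙 i j * x j))   ≈⟨ sum-combination {n} 1# (- t) _ _ ⟩
    1# * (M · x) i + (- t) * sum (λ j → 𝟙 i j * x j)         ≈⟨ +-congˡ (*-congˡ (sum-𝟙 i x)) ⟩
    1# * (M · x) i + (- t) * x i
      ≈⟨ solve 3 (λ m t x → con (+ 1) :* m :+ (:- t) :* x := m :- t :* x) refl ((M · x) i) t (x i) ⟩
    (M · x) i + - (t * x i)  ∎
    where open ≤-Reasoning

  form-shift : ∀ {n} (M : Matrix n n) t x → form (shift M t) x ≈ form M x + - (t * x ∙ x)
  form-shift M t x = begin-equality
    x ∙ (shift M t · x)   ≈⟨ ∙-cong {x = x} (λ _ → refl) (λ i → trans (shift-· M t x i)
      (solve 3 (λ m t x → m :- t :* x := con (+ 1) :* m :+ (:- t) :* x) refl ((M · x) i) t (x i))) ⟩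
    x ∙ combination 1# (M · x) (- t) x   ≈⟨ ∙-combinationʳ 1# (M · x) (- t) x x ⟩
    1# * form M x + (- t) * x ∙ x
      ≈⟨ solve 3 (λ m t x → con (+ 1) :* m :+ (:- t) :* x := m :- t :* x) refl (form M x) t (x ∙ x)
      ⟩
    form M x + - (t * x ∙ x) ∎
    where open ≤-Reasoning

  shift-symmetric : ∀ {n} {M : Matrix n n} → Symmetric M → ∀ t → Symmetric (shift M t)
  shift-symmetric symmetric t i j = +-cong (symmetric i j) (-‿cong (*-congˡ (𝟙-sym i j)))

  form-eigenvector : ∀ {n} {M : Matrix n n} {μ w} → (∀ i → (M · w) i ≈ μ * w i) → form M w ≈ μ * w ∙
    w
  form-eigenvector {n} {μ = μ} {w} Mw≈μw = trans
    (sum-cong λ i → trans (*-congˡ (Mw≈μw i))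
      (solve 2 (λ m w → w :* (m :* w) := m :* (w :* w)) refl μ (w i)))
    (sym (*-distribˡ-sum {n} μ _))

  -- The largest t with M − tI positive semidefinite is an eigenvalue, because
  -- a semidefinite matrix without kernel stays semidefinite when a small
  -- multiple of I is subtracted.
  λMin-psd : ∀ {n} {M : Matrix n n} {μ} → Symmetric M → PositiveSemidefinite M → IsλMin M μ →
    PositiveSemidefinite (shift M μ)
  λMin-psd {n} {M} {μ} symmetric psd ((w , (i , wᵢ≉0) , Mw≈μw) , least) x = nonNeg
    (diff (below μ≤t)) (form-shift M μ x)
    where
    Below : Carrier → Set
    Below t = ∀ x → t * x ∙ x ≤ form M x

    bound : IsUpperBound Below μ
    bound t below = *-cancelˡ-≤ (∙-self-pos {x = w} i wᵢ≉0) (≤-trans (≤-reflexive (*-comm _ t))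
      (≤-trans (below w) (≤-reflexive
        (trans (form-eigenvector {M = M} {w = w} Mw≈μw) (*-comm μ _)))))

    0-below : Below 0#
    0-below x = ≤-trans (≤-reflexive (zeroˡ _)) (psd x)

    t = ⨆ Below

    -- The supremum belongs to the set: for x ≠ 0 the Rayleigh quotient of x bounds every member,
    -- hence also t.
    t-below : Below t
    t-below x with x ∙ x ≤? 0#
    ... | yes x∙x≤0 = ≤-trans (≤-reflexive
      (trans (*-congˡ (antisym x∙x≤0 (∙-self-nonNeg x))) (zeroʳ t))) (psd x)
    ... | no  x∙x≰0 = ≤-trans (≤-reflexive (*-comm t _)) (≤-trans (*-monoˡ-≤ (proj₁ 0<x∙x)
      (⨆-≤ (0# , 0-below) λ s s-below → *-cancelˡ-≤ 0<x∙x (≤-trans (≤-reflexive (*-comm _ s))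
        (≤-trans (s-below x) (≤-reflexive (sym (*-/-cancel 0<x∙x)))))))
          (≤-reflexive (*-/-cancel 0<x∙x)))
      where 0<x∙x = ≰⇒> x∙x≰0

    μ≤t : μ ≤ t
    μ≤t = [ from-kernel , from-coercive ]′ (kernel-or-coercive (shift M t)
      (shift-symmetric symmetric t)
      λ x → nonNeg (diff (t-below x)) (form-shift M t x))
      where
      from-kernel : ∃ (IsKernelVector (shift M t)) → μ ≤ t
      -- A kernel vector of M - tI is an eigenvector for t, so minimality of μ applies to it.
      from-kernel (y , nonzero , kernel) = least t (y , nonzero , λ j →
        trans (solve 2 (λ a b → a := a :- b :+ b) refl ((M · y) j) (t * y j))
              (trans (+-congʳ (trans (sym (shift-· M t y j)) (kernel j))) (+-identityˡ _)))
      from-coercive : ∃ (IsCoercive (shift M t)) → μ ≤ t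
      from-coercive (ε , 0<ε , coercive) = contradiction
        (by (diff (≤-⨆ bound t+ε-below))
          (solve 2 (λ t e → con (+ 0) :- e := t :- (t :+ e)) refl t ε)) (<⇒≱ 0<ε)
        where
        t+ε-below : Below (t + ε)
        t+ε-below x = by (diff (≤-trans (coercive x) (≤-reflexive (form-shift M t x))))
          (solve 4 (λ f t e x → f :- (t :+ e) :* x := f :- t :* x :- e :* x) refl (form M x) t ε
            (x ∙ x))

    below : ∀ {s} → s ≤ t → s * x ∙ x ≤ form M x
    below s≤t = ≤-trans (by (diff s≤t ⊛ ∙-self-nonNeg x)
      (solve 3 (λ s t x → t :* x :- s :* x := (t :- s) :* x) refl _ t (x ∙ x))) (t-below x)

  negativePart : ∀ x → ∃[ w ] (0# ≤ w × 0# ≤ x + w × w * (x + w) ≈ 0#)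
  negativePart x with total 0# x
  ... | inj₁ 0≤x = 0# , ≤-refl , (0≤x ⊕ ≤-refl) , zeroˡ _
  ... | inj₂ x≤0 = - x , -nonNeg x≤0 , ≤-reflexive (sym (-‿inverseʳ x)) , trans
    (*-congˡ (-‿inverseʳ x)) (zeroʳ _)

  -- In the application A is M - μI and `_~_` is adjacency in the smoothed graph.
  module Perron {n} {A : Matrix n n} {_~_ : Fin n → Fin n → Set}
    (symmetric : Symmetric A) (psd : PositiveSemidefinite A)
    (off-diagonal : ∀ {i j} → i ≢ j → A i j ≤ 0#)
    (~⇒≢ : ∀ {i j} → i ~ j → i ≢ j) (~⇒≉0 : ∀ {i j} → i ~ j → ¬ (A i j ≈ 0#)) where

    -- At a zero i of w ≥ 0, row i of Aw = 0 is a sum of terms A i k * w k that are all nonpositive,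
    -- so each of them is 0. Where A i k is nonzero, w vanishes too, and the zero travels along the
    -- path.
    kernel-vanishes : ∀ {w} → (∀ i → 0# ≤ w i) → (∀ i → (A · w) i ≈ 0#) →
      ∀ {i j} → Star _~_ i j → w i ≈ 0# → w j ≈ 0#
    kernel-vanishes 0≤w Aw≈0 done wᵢ≈0 = wᵢ≈0
    kernel-vanishes {w} 0≤w Aw≈0 {i} (_◅_ {j = j} i~j path) wᵢ≈0 = kernel-vanishes 0≤w Aw≈0 path
      (x*y≈0⇒y≈0 (~⇒≉0 i~j) (antisym (by (0≤terms j) (+-identityˡ _))
        (by (-nonNeg (≤-trans (term≤sum 0≤terms j)
        (≤-reflexive (trans (sum-neg (λ k → A i k * w k)) (trans (-‿cong (Aw≈0 i)) -0≈0)))))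
          (solve 1 (λ x → x :- con (+ 0) := :- :- x) refl (A i j * w j)))))
      where
      -0≈0 = solve 0 (:- con (+ 0) := con (+ 0)) refl
      0≤terms : ∀ k → 0# ≤ - (A i k * w k)
      0≤terms k with i ≟ᶠ k
      ... | yes ≡.refl = ≤-reflexive (sym (trans (-‿cong (trans (*-congˡ wᵢ≈0) (zeroʳ _))) -0≈0))
      ... | no  i≢k    = nonNeg (-nonNeg (off-diagonal i≢k) ⊛ 0≤w k)
        (solve 2 (λ a w → :- (a :* w) := (:- a) :* w) refl (A i k) (w k))

    module _ {v : Vector Carrier n} (Av≈0 : ∀ i → (A · v) i ≈ 0#) where
      -- For the negative part w of v, ⟨w, Aw⟩ = ⟨w, A(v + w)⟩ ≤ 0 because w and
      -- v + w have disjoint supports; so w lies in the kernel as well.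
      private
        w : Vector Carrier n
        w i = proj₁ (negativePart (v i))
        0≤w : ∀ i → 0# ≤ w i
        0≤w i = proj₁ (proj₂ (negativePart (v i)))
        0≤v+w : ∀ i → 0# ≤ v i + w i
        0≤v+w i = proj₁ (proj₂ (proj₂ (negativePart (v i))))
        w*[v+w]≈0 : ∀ i → w i * (v i + w i) ≈ 0#
        w*[v+w]≈0 i = proj₂ (proj₂ (proj₂ (negativePart (v i))))

        Aw≈A[v+w] : ∀ i → (A · w) i ≈ sum (λ j → A i j * (v j + w j))
        Aw≈A[v+w] i = sym (trans (sum-cong {n} λ j → distribˡ (A i j) (v j) (w j))
          (trans (∑-distrib-+ {n} (λ j → A i j * v j) (λ j → A i j * w j))
            (trans (+-congʳ (Av≈0 i)) (+-identityˡ _))))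

        -term-nonNeg : ∀ i j → 0# ≤ - (w i * (A i j * (v j + w j)))
        -term-nonNeg i j with i ≟ᶠ j
        ... | yes ≡.refl = ≤-reflexive (sym
          (trans (solve 3 (λ w a p → :- (w :* (a :* p)) := (:- a) :* (w :* p)) refl (w i) (A i i)
          (v i + w i))
                (trans (*-congˡ (w*[v+w]≈0 i)) (zeroʳ _))))
        ... | no i≢j = nonNeg (0≤w i ⊛ (-nonNeg (off-diagonal i≢j) ⊛ 0≤v+w j))
                (solve 3 (λ w a p → :- (w :* (a :* p)) := w :* (:- a :* p)) refl (w i) (A i j)
                  (v j + w j))

        form-w≤0 : form A w ≤ 0#
        form-w≤0 = by (sum-nonNeg λ i → sum-nonNeg λ j → -term-nonNeg i j)
          (trans (+-identityˡ _) (trans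
          (-‿cong (sum-cong {n} λ i → trans (*-congˡ (Aw≈A[v+w] i)) (*-distribˡ-sum {n} (w i) _)))
          (trans (sym (sum-neg (λ i → sum (λ j → w i * (A i j * (v j + w j))))))
            (sum-cong {n} λ i → sym (sum-neg (λ j → w i * (A i j * (v j + w j))))))))

        Aw≈0 : ∀ i → (A · w) i ≈ 0#
        Aw≈0 = form≈0⇒kernel symmetric psd {w} (antisym form-w≤0 (psd w))

      -- The negative part w vanishes at i, hence everywhere, so v ≥ 0. A zero of v at j would in
      -- turn spread to i.
      kernel-positive : (∀ i j → Star _~_ i j) → ∀ {i} → 0# < v i → ∀ j → 0# < v j
      kernel-positive connected {i} 0<vᵢ j = ≰⇒> λ vⱼ≤0 → pos≉0 0<vᵢ
        (kernel-vanishes {w = v} 0≤v Av≈0 (connected j i) (antisym vⱼ≤0 (0≤v j)))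
        where
        0<vᵢ+wᵢ : 0# < v i + w i
        0<vᵢ+wᵢ = <-≤-trans 0<vᵢ (by (0≤w i) (solve 2 (λ x y → x :+ y :- x := y) refl (v i) (w i)))
        wᵢ≈0 : w i ≈ 0#
        wᵢ≈0 = x*y≈0⇒y≈0 (pos≉0 0<vᵢ+wᵢ) (trans (*-comm _ _) (w*[v+w]≈0 i))
        0≤v : ∀ k → 0# ≤ v k
        0≤v k = ≤-trans (0≤v+w k) (≤-reflexive (trans
          (+-congˡ (kernel-vanishes {w = w} 0≤w Aw≈0 (connected i k) wᵢ≈0)) (+-identityʳ _)))

-- Extrema of a vector are attained

module Extremes (ℝ : CompleteOrderedField) where
  open OrderedField ℝ

  ≤-maxᵛ : ∀ {n} (z : Vector Carrier (suc n)) i → z i ≤ maxᵛ z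
  ≤-maxᵛ z = tabulate⁻ (Extrema.xs≤max totalOrder (z zero) (List.tabulate z))

  maxᵛ-attained : ∀ {n} (z : Vector Carrier (suc n)) → ∃[ i ] maxᵛ z ≡ z i
  maxᵛ-attained z = [ (zero ,_) , ∈-tabulate⁻ ]′ (Extrema.argmax-sel totalOrder (λ x → x) (z zero)
    (List.tabulate z))

  minᵛ-attained : ∀ {n} (z : Vector Carrier (suc n)) → ∃[ i ] minᵛ z ≡ z i
  minᵛ-attained z = [ (zero ,_) , ∈-tabulate⁻ ]′ (Extrema.argmin-sel totalOrder (λ x → x) (z zero)
    (List.tabulate z))

-- Volumes, cuts and energies as sums over edges

module GraphSums (ℝ : CompleteOrderedField) where
  open OrderedField ℝ
  open Sums ℝ
  open QuadraticForms ℝ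
  open LinearAlgebra ℝ
  open LossyFlow ℝ
  open Multiples semiring using (×-homo-+)

  indicator : Bool → Carrier
  indicator p = if p then 1# else 0#

  fromℕ-sumℕ : ∀ {n} (f : Fin n → ℕ) → fromℕ (sumℕ f) ≈ sum (λ i → fromℕ (f i))
  fromℕ-sumℕ {zero}  f = refl
  fromℕ-sumℕ {suc n} f = trans (×-homo-+ 1# (f zero) _) (+-congˡ (fromℕ-sumℕ (λ i → f (suc i))))

  fromℕ-mono-≤ : ∀ {k l} → k ℕ.≤ l → fromℕ k ≤ fromℕ l
  fromℕ-mono-≤ {l = l} ℕ.z≤n = fromℕ-nonNeg l
  fromℕ-mono-≤ (ℕ.s≤s k≤l) = +-monoʳ-≤ 1# (fromℕ-mono-≤ k≤l)

  fromℕ-cancel-≤ : ∀ {k l} → fromℕ k ≤ fromℕ l → k ℕ.≤ l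
  fromℕ-cancel-≤ {k} {l} k≤l with k ℕ.≤? l
  ... | yes p = p
  ... | no  p = contradiction (≤-trans (fromℕ-mono-≤ (ℕ.≰⇒> p)) k≤l)
    (<⇒≱ l<1+l)
    where
    l<1+l : fromℕ l < fromℕ (suc l)
    l<1+l = by 0≤1 (solve 2 (λ a l → a :+ l :- l := a) refl 1# (fromℕ l)) ,
      λ l≈1+l → 0≉1 (trans (sym (-‿inverseʳ (fromℕ l)))
        (trans (+-congʳ l≈1+l) (solve 2 (λ a l → a :+ l :- l := a) refl 1# (fromℕ l))))

  module _ {n m : ℕ} (G : LossyFlowGraph n m) where
    open LossyFlowGraph G

    -- For an indicator these are the volume and the cut of the set: each edge is counted once per
    -- end inside, and the squared difference detects a crossing. Real arguments allow `volume` to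
    -- measure χ z as well.
    volume cutSize : Vector Carrier n → Carrier
    volume χ  = sum (λ e → χ (a e) + χ (b e))
    cutSize χ = sum (λ e → (χ (a e) + - χ (b e)) * (χ (a e) + - χ (b e)))

    flow : Vector Carrier n → Fin m → Carrier
    flow f e = f (b e) + - (η e * f (a e))

    incidence-· : ∀ f e → (incidence G · f) e ≈ flow f e
    incidence-· f e = begin-equality
      sum (λ u → (𝟙 (b e) u + - (η e * 𝟙 (a e) u)) * f u)
        ≈⟨ sum-cong {n} (λ u → solve 4 (λ p h q f → (p :- h :* q) :* f := con (+ 1) :* (p :* f) :+
          (:- h) :* (q :* f)) refl (𝟙 (b e) u) (η e) (𝟙 (a e) u) (f u)) ⟩
      sum (λ u → 1# * (𝟙 (b e) u * f u) + (- η e) * (𝟙 (a e) u * f u))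
        ≈⟨ sum-combination {n} 1# (- η e) (λ u → 𝟙 (b e) u * f u) (λ u → 𝟙 (a e) u * f u) ⟩
      1# * sum (λ u → 𝟙 (b e) u * f u) + (- η e) * sum (λ u → 𝟙 (a e) u * f u)
        ≈⟨ +-cong (*-congˡ (sum-𝟙 (b e) f)) (*-congˡ (sum-𝟙 (a e) f)) ⟩
      1# * f (b e) + (- η e) * f (a e)
        ≈⟨ solve 3 (λ x h y → con (+ 1) :* x :+ (:- h) :* y := x :- h :* y) refl (f (b e)) (η e)
          (f (a e)) ⟩
      flow f e ∎
      where open ≤-Reasoning

    gram : ∀ (B : Matrix m n) f g → f ∙ ((B ᵀ ⊗ B) · g) ≈ (B · f) ∙ (B · g)
    gram B f g = begin-equality
      sum (λ i → f i * sum (λ j → sum (λ e → B e i * B e j) * g j))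
        ≈⟨ sum-cong {n} (λ i → *-congˡ
          (trans (sum-cong {n} λ j → trans (*-distribʳ-sum {m} (g j) (λ e → B e i * B e j))
          (sum-cong {m} λ e → *-assoc _ _ _))
             (trans (∑-comm (λ j e → B e i * (B e j * g j)))
               (sum-cong {m} λ e → sym (*-distribˡ-sum {n} (B e i) (λ j → B e j * g j)))))) ⟩
      sum (λ i → f i * sum (λ e → B e i * (B · g) e))
        ≈⟨ sum-cong {n} (λ i → trans (*-distribˡ-sum {m} (f i) (λ e → B e i * (B · g) e))
          (sum-cong {m} λ e →
             solve 3 (λ f b g → f :* (b :* g) := b :* f :* g) refl (f i) (B e i) ((B · g) e))) ⟩
      sum (λ i → sum (λ e → B e i * f i * (B · g) e))
        ≈⟨ ∑-comm (λ i e → B e i * f i * (B · g) e) ⟩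
      sum (λ e → sum (λ i → B e i * f i * (B · g) e))
        ≈⟨ sum-cong {m} (λ e → *-distribʳ-sum {n} ((B · g) e) (λ i → B e i * f i)) ⟨
      (B · f) ∙ (B · g)  ∎
      where open ≤-Reasoning

    laplacian-form : ∀ f g → f ∙ (laplacian G · g) ≈ sum (λ e → flow f e * flow g e)
    laplacian-form f g = trans (gram (incidence G) f g) (∙-cong (incidence-· f) (incidence-· g))

    𝟙*𝟙 : ∀ (i : Fin n) u → 𝟙 i u * 𝟙 i u ≈ 𝟙 i u
    𝟙*𝟙 i u with i ≟ᶠ u
    ... | yes _ = *-identityʳ 1#
    ... | no  _ = zeroʳ 0#

    𝟙*𝟙-endpoints : ∀ e u → 𝟙 (a e) u * 𝟙 (b e) u ≈ 0#
    𝟙*𝟙-endpoints e u with a e ≟ᶠ u | b e ≟ᶠ u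
    ... | yes a≡u | yes b≡u = contradiction (≡.trans a≡u (≡.sym b≡u)) (distinct e)
    ... | yes _   | no  _   = zeroʳ 1#
    ... | no  _   | yes _   = zeroˡ 1#
    ... | no  _   | no  _   = zeroʳ 0#

    incidence-square : ∀ e u → incidence G e u * incidence G e u ≈ 𝟙 (b e) u + η e * η e * 𝟙 (a e) u
    incidence-square e u = begin-equality
      (q + - (h * p)) * (q + - (h * p))
        ≈⟨ solve 3 (λ h p q → (q :- h :* p) :* (q :- h :* p) := q :* q :+ h :* h :* (p :* p) :- con
        (+ 2) :* h :* (p :* q)) refl h p q ⟩
      q * q + h * h * (p * p) + - (2# * h * (p * q))
        ≈⟨ +-cong (+-cong (𝟙*𝟙 (b e) u) (*-congˡ (𝟙*𝟙 (a e) u)))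
        (-‿cong (*-congˡ (𝟙*𝟙-endpoints e u))) ⟩
      q + h * h * p + - (2# * h * 0#)
        ≈⟨ solve 3 (λ h p q → q :+ h :* h :* p :- con (+ 2) :* h :* con (+ 0) := q :+ h :* h :* p)
        refl h p q ⟩
      q + h * h * p ∎
      where
      open ≤-Reasoning
      h = η e
      p = 𝟙 (a e) u
      q = 𝟙 (b e) u

    -- One double count for both degree vectors: w is η² for the diagonal of the Laplacian and 1 for
    -- the smoothed graph.
    sum-endpoints : ∀ (w : Fin m → Carrier) (f : Vector Carrier n) →
      sum (λ u → sum (λ e → 𝟙 (b e) u + w e * 𝟙 (a e) u) * f u) ≈ sum
        (λ e → f (b e) + w e * f (a e))
    sum-endpoints w f = begin-equality
      sum (λ u → sum (λ e → 𝟙 (b e) u + w e * 𝟙 (a e) u) * f u)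
        ≈⟨ sum-cong {n} (λ u → trans (*-distribʳ-sum {m} (f u) (λ e → 𝟙 (b e) u + w e * 𝟙 (a e) u))
          (sum-cong {m} λ e →
             solve 4 (λ p h q f → (p :+ h :* q) :* f := con (+ 1) :* (p :* f) :+ h :* (q :* f)) refl
               (𝟙 (b e) u) (w e) (𝟙 (a e) u) (f u))) ⟩
      sum (λ u → sum (λ e → 1# * (𝟙 (b e) u * f u) + w e * (𝟙 (a e) u * f u)))
        ≈⟨ ∑-comm (λ u e → 1# * (𝟙 (b e) u * f u) + w e * (𝟙 (a e) u * f u)) ⟩
      sum (λ e → sum (λ u → 1# * (𝟙 (b e) u * f u) + w e * (𝟙 (a e) u * f u)))
        ≈⟨ sum-cong {m} (λ e → trans (sum-combination {n} 1# (w e) (λ u → 𝟙 (b e) u * f u)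
          (λ u → 𝟙 (a e) u * f u))
             (+-cong (trans (*-identityˡ _) (sum-𝟙 (b e) f)) (*-congˡ (sum-𝟙 (a e) f)))) ⟩
      sum (λ e → f (b e) + w e * f (a e)) ∎
      where open ≤-Reasoning

    sum-degrees : ∀ f → sum (λ u → degrees G u * f u) ≈ sum (λ e → f (b e) + η e * η e * f (a e))
    sum-degrees f = trans (sum-cong {n} λ u → *-congʳ (sum-cong {m} λ e → incidence-square e u))
      (sum-endpoints (λ e → η e * η e) f)

    volume-sum-degree : ∀ f → sum (λ u → fromℕ (degree (smoothed G) u) * f u) ≈ volume f
    volume-sum-degree f = begin-equality
      sum (λ u → fromℕ (degree (smoothed G) u) * f u)
        ≈⟨ sum-cong {n} (λ u → *-congʳ
          (trans (fromℕ-sumℕ {m} _) (sum-cong {m} λ e → endpoints e u))) ⟩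
      sum (λ u → sum (λ e → 𝟙 (b e) u + 1# * 𝟙 (a e) u) * f u)     ≈⟨ sum-endpoints (λ _ → 1#) f ⟩
      sum (λ e → f (b e) + 1# * f (a e))
        ≈⟨ sum-cong {m} (λ e → solve 2 (λ x y → x :+ con (+ 1) :* y := y :+ x) refl (f (b e))
        (f (a e))) ⟩
      volume f ∎
      where
      open ≤-Reasoning
      endpoints : ∀ e u → fromℕ (if does (a e ≟ᶠ u) ∨ does (b e ≟ᶠ u) then 1 else 0) ≈ 𝟙 (b e) u +
        1# * 𝟙 (a e) u
      endpoints e u with a e ≟ᶠ u | b e ≟ᶠ u
      ... | yes a≡u | yes b≡u = contradiction (≡.trans a≡u (≡.sym b≡u)) (distinct e)
      ... | yes _   | no  _   = solve 0 (con (+ 1) :+ con (+ 0) := con (+ 0) :+ con (+ 1) :* con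
        (+ 1)) refl
      ... | no  _   | yes _   = solve 0 (con (+ 1) :+ con (+ 0) := con (+ 1) :+ con (+ 1) :* con
        (+ 0)) refl
      ... | no  _   | no  _   = solve 0 (con (+ 0) := con (+ 0) :+ con (+ 1) :* con (+ 0)) refl

    fromℕ-vol : ∀ S → fromℕ (vol (smoothed G) S) ≈ volume (λ u → indicator (Vec.lookup S u))
    fromℕ-vol S = trans (fromℕ-sumℕ {n} _)
      (trans (sum-cong {n} λ u → restrict (Vec.lookup S u) (degree (smoothed G) u))
      (volume-sum-degree (λ u → indicator (Vec.lookup S u))))
      where
      restrict : ∀ p k → fromℕ (if p then k else 0) ≈ fromℕ k * indicator p
      restrict true  k = sym (*-identityʳ _)
      restrict false k = sym (zeroʳ _)

    fromℕ-cut : ∀ S → fromℕ (cut (smoothed G) S) ≈ cutSize (λ u → indicator (Vec.lookup S u))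
    fromℕ-cut S = trans (fromℕ-sumℕ {m} _) (sum-cong {m} λ e → crossing (Vec.lookup S (a e))
      (Vec.lookup S (b e)))
      where
      crossing : ∀ p q → fromℕ (if p xor q then 1 else 0) ≈ (indicator p + - indicator q) *
        (indicator p + - indicator q)
      crossing true  true  = solve 0 (con (+ 0) := (con (+ 1) :- con (+ 1)) :*
        (con (+ 1) :- con (+ 1))) refl
      crossing true  false = solve 0 (con (+ 1) :+ con (+ 0) := (con (+ 1) :- con (+ 0)) :*
        (con (+ 1) :- con (+ 0))) refl
      crossing false true  = solve 0 (con (+ 1) :+ con (+ 0) := (con (+ 0) :- con (+ 1)) :*
        (con (+ 0) :- con (+ 1))) refl
      crossing false false = solve 0 (con (+ 0) := (con (+ 0) :- con (+ 0)) :*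
        (con (+ 0) :- con (+ 0))) refl

    volume-complement : ∀ χ → volume (λ u → 1# + - χ u) ≈ 2# * fromℕ m + - volume χ
    volume-complement χ = begin-equality
      sum (λ e → 1# + - χ (a e) + (1# + - χ (b e)))
        ≈⟨ sum-cong {m} (λ e → solve 2 (λ x y → con (+ 1) :- x :+ (con (+ 1) :- y) := con (+ 2) :+
          :- (x :+ y)) refl (χ (a e)) (χ (b e))) ⟩
      sum (λ e → 2# + - (χ (a e) + χ (b e)))
        ≈⟨ ∑-distrib-+ {m} (λ _ → 2#) (λ e → - (χ (a e) + χ (b e))) ⟩
      sum {m} (λ e → 2#) + sum (λ e → - (χ (a e) + χ (b e)))    ≈⟨ +-cong
        (trans (sum-const {m} 2#) (*-comm _ _)) (sum-neg (λ e → χ (a e) + χ (b e))) ⟩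
      2# * fromℕ m + - volume χ ∎
      where open ≤-Reasoning

    cutSize-nonNeg : ∀ χ → 0# ≤ cutSize χ
    cutSize-nonNeg χ = sum-nonNeg {m} λ e → square-nonNeg _

    volume-cong : ∀ {χ χ′} → (∀ u → χ u ≈ χ′ u) → volume χ ≈ volume χ′
    volume-cong χ≈χ′ = sum-cong {m} λ e → +-cong (χ≈χ′ (a e)) (χ≈χ′ (b e))

    -- The total volume is 2m, so the hypothesis selects the smaller side of the cut, and `minVol`
    -- is the volume of the set itself.
    expansion : ∀ {φ} → HasExpansion G φ → ∀ (p : Fin n → Bool) → let χ = λ u → indicator (p u) in
      volume χ ≤ fromℕ m → φ * volume χ ≤ cutSize χ
    expansion {φ} (κ , (_ , least) , φ≤κ) p small = cases (ℕ._≟_ (vol H S) 0)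
      where
      open ≤-Reasoning
      H = smoothed G
      χ = λ u → indicator (p u)
      S = Vec.tabulate p
      χS≈χ : ∀ u → indicator (Vec.lookup S u) ≈ χ u
      χS≈χ u = reflexive (≡.cong indicator (Vec.lookup∘tabulate p u))
      vol≈ : fromℕ (vol H S) ≈ volume χ
      vol≈ = trans (fromℕ-vol S) (volume-cong χS≈χ)
      indicator-not : ∀ q → indicator (not q) ≈ 1# + - indicator q
      indicator-not true  = sym (-‿inverseʳ 1#)
      indicator-not false = solve 0 (con (+ 1) := con (+ 1) :- con (+ 0)) refl
      vol∁≈ : fromℕ (vol H (∁ S)) ≈ 2# * fromℕ m + - volume χ
      vol∁≈ = trans (fromℕ-vol (∁ S))
        (trans (volume-cong λ u → trans (reflexive (≡.cong indicator (Vec.lookup-map u not S)))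
        (trans (indicator-not (Vec.lookup S u)) (+-congˡ (-‿cong (χS≈χ u))))) (volume-complement χ))
      minVol≡ : minVol H S ≡ vol H S
      minVol≡ = ℕ.m≤n⇒m⊓n≡m (fromℕ-cancel-≤ (begin
        fromℕ (vol H S)               ≈⟨ vol≈ ⟩
        volume χ                      ≤⟨ by (diff small ⊕ diff small)
          (solve 2 (λ m v → con (+ 2) :* m :- v :- v := m :- v :+ (m :- v)) refl (fromℕ m)
          (volume χ)) ⟩
        2# * fromℕ m + - volume χ     ≈⟨ vol∁≈ ⟨
        fromℕ (vol H (∁ S))           ∎))
      cases : _ → φ * volume χ ≤ cutSize χ
      -- The conductance quotient is undefined here, but the left side is 0.
      cases (yes vol≡0) = ≤-trans (≤-reflexive
        (trans (*-congˡ (trans (sym vol≈) (reflexive (≡.cong fromℕ vol≡0)))) (zeroʳ φ)))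
        (cutSize-nonNeg χ)
      cases (no vol≢0) = begin
        φ * volume χ             ≈⟨ trans (*-comm _ _) (*-congʳ
          (trans (sym vol≈) (reflexive (≡.cong fromℕ (≡.sym minVol≡))))) ⟩
        V * φ                    ≤⟨ *-monoˡ-≤ (fromℕ-nonNeg (minVol H S))
          (≤-trans φ≤κ (least (X / V) (S , 0<minVol , refl))) ⟩
        V * (X / V)              ≈⟨ *-/-cancel (<-≤-trans (fromℕ-pos 0) (fromℕ-mono-≤ 0<minVol)) ⟩
        X                        ≈⟨ fromℕ-cut S ⟩
        cutSize (λ u → indicator (Vec.lookup S u))
          ≈⟨ sum-cong {m} (λ e → *-cong (+-cong (χS≈χ (a e)) (-‿cong (χS≈χ (b e))))
          (+-cong (χS≈χ (a e)) (-‿cong (χS≈χ (b e))))) ⟩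
        cutSize χ                ∎
        where
        V = fromℕ (minVol H S)
        X = fromℕ (cut H S)
        0<minVol : 0 ℕ.< minVol H S
        0<minVol = ≡.subst (0 ℕ.<_) (≡.sym minVol≡) (ℕ.n≢0⇒n>0 vol≢0)

-- Inequalities for a single edge

module EdgeInequalities (ℝ : CompleteOrderedField) where
  open OrderedField ℝ

  module _ {t θ : Carrier} where
    -- How a vertex with value x sits relative to the superlevel sets at t and
    -- at t − θ; the indices are its two indicator values.
    data Superlevel (x : Carrier) : Carrier → Carrier → Set where
      inside  : t ≤ x → Superlevel x 1# 1#
      outside : ∀ {s} → 0# ≤ s → s ≤ 1# → x ≤ t → x + θ * (1# + - s) ≤ t → Superlevel x 0# s

    -- Here x and y are the values at a and b. A crossing edge whose outer end also misses the
    -- larger set drops by at least θ, which shows in the energy. The β term pays for the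
    -- multiplier, which costs at most β y on an edge inside the set and at most β t on an edge
    -- entering it. New ends of other edges only lower the left side.
    superlevel-edge : ∀ {β η x y χx χx′ χy χy′} → 0# ≤ β → 0# ≤ θ → 1# ≤ η → η ≤ 1# + β → 0# ≤ x →
      0# ≤ y →
      Superlevel x χx χx′ → Superlevel y χy χy′ →
      θ * ((χx + - χy) * (χx + - χy) + - (χx′ + χy′ + - (χx + χy)))
        ≤ (χy + - (η * χx)) * (y + - (η * x)) + β * (χx * x + χy * y)
    superlevel-edge {β} {η} {x} {y} 0≤β 0≤θ 1≤η η≤1+β 0≤x 0≤y (inside _) (inside _) =
      by (diff 1≤η ⊛ (≤-trans 0≤1 1≤η ⊛ 0≤x) ⊕ diff η≤1+β ⊛ 0≤y ⊕ 0≤β ⊛ 0≤x)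
        (solve 5 (λ θ β η x y → let i = con (+ 1) in
          (i :- η :* i) :* (y :- η :* x) :+ β :* (i :* x :+ i :* y) :- θ :*
            ((i :- i) :* (i :- i) :- (i :+ i :- (i :+ i)))
          := (η :- i) :* (η :* x) :+ (i :+ β :- η) :* y :+ β :* x) refl θ β η x y)
    superlevel-edge {β} {η} {x} {y} 0≤β 0≤θ 1≤η η≤1+β 0≤x 0≤y (outside {s} 0≤s s≤1 x≤t drop)
      (inside t≤y) =
      by (diff t≤y ⊕ diff drop ⊕ 0≤β ⊛ (diff t≤y ⊕ diff x≤t) ⊕ diff η≤1+β ⊛ 0≤x)
        (solve 7 (λ t θ s β η x y → let i = con (+ 1) ; o = con (+ 0) in
          (i :- η :* o) :* (y :- η :* x) :+ β :* (o :* x :+ i :* y) :- θ :*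
            ((o :- i) :* (o :- i) :- (s :+ i :- (o :+ i)))
          := (y :- t) :+ (t :- (x :+ θ :* (i :- s))) :+ β :* ((y :- t) :+ (t :- x)) :+ (i :+ β :- η)
            :* x) refl t θ s β η x y)
    superlevel-edge {β} {η} {x} {y} 0≤β 0≤θ 1≤η η≤1+β 0≤x 0≤y (inside t≤x)
      (outside {s} 0≤s s≤1 y≤t drop) =
      by (diff t≤x ⊕ diff drop ⊕ diff 1≤η ⊛ (diff t≤x ⊕ diff y≤t) ⊕ diff 1≤η ⊛
        (≤-trans 0≤1 1≤η ⊛ 0≤x) ⊕ 0≤β ⊛ 0≤x)
        (solve 7 (λ t θ s β η x y → let i = con (+ 1) ; o = con (+ 0) in
          (o :- η :* i) :* (y :- η :* x) :+ β :* (i :* x :+ o :* y) :- θ :*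
            ((i :- o) :* (i :- o) :- (i :+ s :- (i :+ o)))
          := (x :- t) :+ (t :- (y :+ θ :* (i :- s))) :+ (η :- i) :* ((x :- t) :+ (t :- y)) :+
            (η :- i) :* (η :* x) :+ β :* x) refl t θ s β η x y)
    superlevel-edge {β} {η} {x} {y} 0≤β 0≤θ 1≤η η≤1+β 0≤x 0≤y (outside {s} 0≤s _ _ _)
      (outside {s′} 0≤s′ _ _ _) =
      by (0≤θ ⊛ (0≤s ⊕ 0≤s′))
        (solve 7 (λ θ s s′ β η x y → let o = con (+ 0) in
          (o :- η :* o) :* (y :- η :* x) :+ β :* (o :* x :+ o :* y) :- θ :*
            ((o :- o) :* (o :- o) :- (s :+ s′ :- (o :+ o)))
          := θ :* (s :+ s′)) refl θ s s′ β η x y)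

  module _ {t δ : Carrier} where
    -- Likewise for the sublevel sets at t and at t(1 + δ).
    data Sublevel (x : Carrier) : Carrier → Carrier → Set where
      inside  : x ≤ t → Sublevel x 1# 1#
      outside : ∀ {s} → 0# ≤ s → s ≤ 1# → t * (1# + δ * (1# + - s)) ≤ x → Sublevel x 0# s

    private
      ratio-bound : ∀ {x y y′ s} → 0# ≤ δ → s ≤ 1# → 0# ≤ y′ → y * y′ ≈ 1# → y ≤ t →
        t * (1# + δ * (1# + - s)) ≤ x → 1# + δ * (1# + - s) ≤ x * y′
      ratio-bound {x} {y} {y′} {s} 0≤δ s≤1 0≤y′ yy′≈1 y≤t rise = begin
        r                 ≈⟨ *-identityˡ r ⟨
        1# * r            ≈⟨ *-congʳ yy′≈1 ⟨
        y * y′ * r        ≤⟨ by (0≤y′ ⊛ (diff rise ⊕ diff y≤t ⊛ (0≤1 ⊕ 0≤δ ⊛ diff s≤1)))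
          (solve 5 (λ x y y′ r t → x :* y′ :- y :* y′ :* r := y′ :*
            ((x :- t :* r) :+ (t :- y) :* r)) refl x y y′ r t) ⟩
        x * y′            ∎
        where
        open ≤-Reasoning
        r = 1# + δ * (1# + - s)

    -- An edge inside the set gives 1 + η² - η(x/y + y/x) ≤ (η - 1)² ≤ β². An edge entering it gives
    -- 1 - η x/y ≤ -δ, and one leaving it gives η² - η y/x ≤ 2β - δ; the δ is dropped if the outer
    -- end lies in the larger set. The reciprocals enter as x′ and y′ with their defining equations,
    -- to keep everything polynomial.
    sublevel-edge : ∀ {β η x y x′ y′ χx χx′ χy χy′} → 0# ≤ β → β ≤ 1# → 0# ≤ δ → 1# ≤ η → η ≤ 1# + β
      →
      0# ≤ x′ → 0# ≤ y′ → x * x′ ≈ 1# → y * y′ ≈ 1# → Sublevel x χx χx′ → Sublevel y χy χy′ →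
      (χy * y′ + - (η * (χx * x′))) * (y + - (η * x)) ≤
        β * β * (χx + χy) + 2# * β * ((χx + - χy) * (χx + - χy))
          + - (δ * ((χx + - χy) * (χx + - χy) + - (χx′ + χy′ + - (χx + χy))))
    sublevel-edge {β} {η} {x} {y} {x′} {y′} 0≤β β≤1 0≤δ 1≤η η≤1+β 0≤x′ 0≤y′ xx′≈1 yy′≈1 (inside _)
      (inside _) = begin
      (1# * y′ + - (η * (1# * x′))) * (y + - (η * x))
        ≈⟨ solve 5 (λ η x y x′ y′ → let i = con (+ 1) in (i :* y′ :- η :* (i :* x′)) :*
          (y :- η :* x)
             := y :* y′ :+ η :* η :* (x :* x′) :- η :* (x :* y′ :+ y :* x′)) refl η x y x′ y′ ⟩
      y * y′ + η * η * (x * x′) + - (η * p)          ≈⟨ +-congʳ (+-cong yy′≈1 (*-congˡ xx′≈1)) ⟩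
      1# + η * η * 1# + - (η * p)
        ≤⟨ by (≤-trans 0≤1 1≤η ⊛ diff 2≤p ⊕ diff η≤1+β ⊛ (0≤β ⊕ diff 1≤η) ⊕ 0≤β ⊛ 0≤β)
        (solve 4 (λ δ β η p → let i = con (+ 1) in
          β :* β :* (i :+ i) :+ con (+ 2) :* β :* ((i :- i) :* (i :- i)) :- δ :*
            ((i :- i) :* (i :- i) :- (i :+ i :- (i :+ i)))
            :- (i :+ η :* η :* i :- η :* p)
          := η :* (p :- con (+ 2)) :+ (i :+ β :- η) :* (β :+ (η :- i)) :+ β :* β) refl δ β η p) ⟩
      β * β * (1# + 1#) + 2# * β * ((1# + - 1#) * (1# + - 1#)) + -
        (δ * ((1# + - 1#) * (1# + - 1#) + - (1# + 1# + - (1# + 1#)))) ∎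
      where
      open ≤-Reasoning
      p = x * y′ + y * x′
      -- AM-GM for x/y and y/x. Factors 1 are inserted and replaced by x x′ and y y′, which turns
      -- the difference into (x - y)² x′ y′.
      2≤p : 2# ≤ p
      2≤p = by (square-nonNeg (x + - y) ⊛ (0≤x′ ⊛ 0≤y′)) (begin-equality
        p + - 2#       ≈⟨ solve 1 (λ p → p :- con (+ 2) := con (+ 1) :* p :- con (+ 2) :*
          (con (+ 1) :* con (+ 1))) refl p ⟩
        1# * p + - (2# * (1# * 1#))        ≈⟨ +-cong
          (solve 1 (λ p → con (+ 1) :* p := p) refl p) (-‿cong (*-congˡ (sym (*-cong xx′≈1 yy′≈1))))
          ⟩
        x * y′ + y * x′ + - (2# * (x * x′ * (y * y′)))
          ≈⟨ +-congʳ (+-cong (sym (trans (*-congʳ xx′≈1) (*-identityˡ _))) (sym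
            (trans (*-congʳ yy′≈1) (*-identityˡ _)))) ⟩
        x * x′ * (x * y′) + y * y′ * (y * x′) + - (2# * (x * x′ * (y * y′)))
          ≈⟨ solve 4 (λ x y x′ y′ → x :* x′ :* (x :* y′) :+ y :* y′ :* (y :* x′) :- con (+ 2) :*
            (x :* x′ :* (y :* y′))
               := (x :- y) :* (x :- y) :* (x′ :* y′)) refl x y x′ y′ ⟩
        (x + - y) * (x + - y) * (x′ * y′)  ∎)
    sublevel-edge {β} {η} {x} {y} {x′} {y′} 0≤β β≤1 0≤δ 1≤η η≤1+β 0≤x′ 0≤y′ xx′≈1 yy′≈1
      (outside {s} 0≤s s≤1 rise) (inside y≤t) = begin
      (1# * y′ + - (η * (0# * x′))) * (y + - (η * x))
        ≈⟨ solve 5 (λ η x y x′ y′ → let i = con (+ 1) in (i :* y′ :- η :* (con (+ 0) :* x′)) :*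
          (y :- η :* x)
             := y :* y′ :- η :* (x :* y′)) refl η x y x′ y′ ⟩
      y * y′ + - (η * p)     ≈⟨ +-congʳ yy′≈1 ⟩
      1# + - (η * p)         ≤⟨ by ((diff 1≤η ⊛ (0≤1 ⊕ 0≤δ ⊛ diff s≤1)) ⊕ ≤-trans 0≤1 1≤η ⊛ diff
        (ratio-bound 0≤δ s≤1 0≤y′ yy′≈1 y≤t rise) ⊕ (0≤β ⊛ 0≤β ⊕ fromℕ-nonNeg 2 ⊛ 0≤β))
        (solve 5 (λ δ s β η p → let i = con (+ 1) ; o = con (+ 0) in
          β :* β :* (o :+ i) :+ con (+ 2) :* β :* ((o :- i) :* (o :- i)) :- δ :*
            ((o :- i) :* (o :- i) :- (s :+ i :- (o :+ i)))
            :- (i :- η :* p)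
          := (η :- i) :* (i :+ δ :* (i :- s)) :+ η :* (p :- (i :+ δ :* (i :- s))) :+
            (β :* β :+ con (+ 2) :* β)) refl δ s β η p) ⟩
      β * β * (0# + 1#) + 2# * β * ((0# + - 1#) * (0# + - 1#)) + -
        (δ * ((0# + - 1#) * (0# + - 1#) + - (s + 1# + - (0# + 1#)))) ∎
      where
      open ≤-Reasoning
      p = x * y′
    sublevel-edge {β} {η} {x} {y} {x′} {y′} 0≤β β≤1 0≤δ 1≤η η≤1+β 0≤x′ 0≤y′ xx′≈1 yy′≈1 (inside x≤t)
      (outside {s} 0≤s s≤1 rise) = begin
      (0# * y′ + - (η * (1# * x′))) * (y + - (η * x))
        ≈⟨ solve 5 (λ η x y x′ y′ → let i = con (+ 1) in (con (+ 0) :* y′ :- η :* (i :* x′)) :*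
          (y :- η :* x)
             := η :* η :* (x :* x′) :- η :* (y :* x′)) refl η x y x′ y′ ⟩
      η * η * (x * x′) + - (η * p)     ≈⟨ +-congʳ (*-congˡ xx′≈1) ⟩
      η * η * 1# + - (η * p)
        ≤⟨ by (≤-trans 0≤1 1≤η ⊛ diff (ratio-bound 0≤δ s≤1 0≤x′ xx′≈1 x≤t rise)
                                             ⊕ diff 1≤η ⊛ (0≤δ ⊛ diff s≤1) ⊕
                                               (≤-trans 0≤1 1≤η ⊛ diff η≤1+β ⊕ 0≤β ⊛ diff η≤1+β ⊕
                                               0≤β ⊛ diff β≤1 ⊕ 0≤β ⊛ 0≤β))
        (solve 5 (λ δ s β η p → let i = con (+ 1) ; o = con (+ 0) in
          β :* β :* (i :+ o) :+ con (+ 2) :* β :* ((i :- o) :* (i :- o)) :- δ :*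
            ((i :- o) :* (i :- o) :- (i :+ s :- (i :+ o)))
            :- (η :* η :* i :- η :* p)
          := η :* (p :- (i :+ δ :* (i :- s))) :+ (η :- i) :* (δ :* (i :- s))
             :+ (η :* (i :+ β :- η) :+ β :* (i :+ β :- η) :+ β :* (i :- β) :+ β :* β)) refl δ s β η
               p) ⟩
      β * β * (1# + 0#) + 2# * β * ((1# + - 0#) * (1# + - 0#)) + -
        (δ * ((1# + - 0#) * (1# + - 0#) + - (1# + s + - (1# + 0#)))) ∎
      where
      open ≤-Reasoning
      p = y * x′
    sublevel-edge {β} {η} {x} {y} {x′} {y′} 0≤β β≤1 0≤δ 1≤η η≤1+β 0≤x′ 0≤y′ xx′≈1 yy′≈1
      (outside {s} 0≤s _ _) (outside {s′} 0≤s′ _ _) =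
      by (0≤δ ⊛ (0≤s ⊕ 0≤s′))
        (trans (+-congˡ (-‿cong (solve 4 (λ η x′ y′ r → (con (+ 0) :* y′ :- η :* (con (+ 0) :* x′))
          :* r := con (+ 0)) refl η x′ y′ (y + - (η * x)))))
        (solve 4 (λ δ s s′ β → let o = con (+ 0) in
          β :* β :* (o :+ o) :+ con (+ 2) :* β :* ((o :- o) :* (o :- o)) :- δ :*
            ((o :- o) :* (o :- o) :- (s :+ s′ :- (o :+ o))) :- o
          := δ :* (s :+ s′)) refl δ s s′ β))

-- Volume growth of level sets

module Growth (ℝ : CompleteOrderedField) where
  open OrderedField ℝ
  open Sums ℝ
  open QuadraticForms ℝ using (sum-combination)
  open LossyFlow ℝ
  open GraphSums ℝ
  open EdgeInequalities ℝ

  -- Monotonicity carries V K ≤ U back to every earlier k, so all K steps apply and force V K above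
  -- U. `Inv` holds the weight condition of superlevel sets; for sublevel sets it is trivial.
  growth-escapes : ∀ {V : ℕ → Carrier} {h U} {Inv : ℕ → Set} → 0# ≤ h → (∀ k → V k ≤ V (suc k)) →
    Inv 0 → 1# ≤ V 0 →
    (∀ k → V k ≤ U → Inv k → Inv (suc k) × (1# + h) * V k ≤ V (suc k)) →
    ∀ K → U < (1# + h) ^ K → ¬ (V K ≤ U)
  growth-escapes {V} {h} {U} {Inv} 0≤h mono inv₀ 1≤V₀ step K U<pᴷ V≤U =
    <⇒≱ U<pᴷ (≤-trans (proj₂ (invariant K V≤U)) V≤U)
    where
    invariant : ∀ k → V k ≤ U → Inv k × (1# + h) ^ k ≤ V k
    invariant zero    _   = inv₀ , 1≤V₀
    invariant (suc k) V≤U with invariant k (≤-trans (mono k) V≤U)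
    ... | inv , pᵏ≤V with step k (≤-trans (mono k) V≤U) inv
    ...   | inv′ , pV≤V′ = inv′ , ≤-trans (*-monoˡ-≤ (0≤1 ⊕ 0≤h) pᵏ≤V) pV≤V′

  above below : Carrier → Carrier → Bool
  above t x = does (t ≤? x)
  below t x = does (x ≤? t)

  indicator-nonNeg : ∀ p → 0# ≤ indicator p
  indicator-nonNeg true  = 0≤1
  indicator-nonNeg false = ≤-refl

  above-true : ∀ {t x} → t ≤ x → indicator (above t x) ≈ 1#
  above-true {t} {x} t≤x with t ≤? x
  ... | yes _   = refl
  ... | no  t≰x = contradiction t≤x t≰x

  below-true : ∀ {t x} → x ≤ t → indicator (below t x) ≈ 1#
  below-true {t} {x} x≤t with x ≤? t
  ... | yes _   = refl
  ... | no  x≰t = contradiction x≤t x≰t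

  above-mono : ∀ {t t′} x → t′ ≤ t → indicator (above t x) ≤ indicator (above t′ x)
  above-mono {t} {t′} x t′≤t with t ≤? x
  ... | yes t≤x = ≤-reflexive (sym (above-true (≤-trans t′≤t t≤x)))
  ... | no  _   = indicator-nonNeg _

  below-mono : ∀ {t t′} x → t ≤ t′ → indicator (below t x) ≤ indicator (below t′ x)
  below-mono {t} {t′} x t≤t′ with x ≤? t
  ... | yes x≤t = ≤-reflexive (sym (below-true (≤-trans x≤t t≤t′)))
  ... | no  _   = indicator-nonNeg _

  above-below-disjoint : ∀ {s t} x → s < t → indicator (above t x) + indicator (below s x) ≤ 1#
  above-below-disjoint {s} {t} x s<t with t ≤? x | x ≤? s
  ... | yes t≤x | yes x≤s = contradiction (≤-trans t≤x x≤s) (<⇒≱ s<t)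
  ... | yes _   | no _    = ≤-reflexive (+-identityʳ 1#)
  ... | no _    | yes _   = ≤-reflexive (+-identityˡ 1#)
  ... | no _    | no _    = ≤-trans (≤-reflexive (+-identityˡ 0#)) 0≤1

  superlevel : ∀ {t t′ θ} x → 0# ≤ θ → t ≈ t′ + θ → Superlevel {t} {θ} x (indicator (above t x))
    (indicator (above t′ x))
  superlevel {t} {t′} {θ} x 0≤θ t≈t′+θ with t ≤? x
  ... | yes t≤x with t′ ≤? x
  ...   | yes _    = inside t≤x
  ...   | no  t′≰x = contradiction (≤-trans (by 0≤θ
    (trans (+-congʳ t≈t′+θ) (solve 2 (λ t θ → t :+ θ :- t := θ) refl t′ θ))) t≤x) t′≰x
  superlevel {t} {t′} {θ} x 0≤θ t≈t′+θ | no t≰x with t′ ≤? x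
  ...   | yes _    = outside 0≤1 ≤-refl (≰⇒≥ t≰x) (by (diff (≰⇒≥ t≰x))
    (solve 3 (λ t θ x → t :- (x :+ θ :* (con (+ 1) :- con (+ 1))) := t :- x) refl t θ x))
  ...   | no  t′≰x = outside ≤-refl 0≤1 (≰⇒≥ t≰x) (by (diff (≰⇒≥ t′≰x)) (trans (+-congʳ t≈t′+θ)
    (solve 3 (λ t θ x → t :+ θ :- (x :+ θ :* (con (+ 1) :- con (+ 0))) := t :- x) refl t′ θ x)))

  sublevel : ∀ {t δ} x → 0# ≤ t → 0# ≤ δ → Sublevel {t} {δ} x (indicator (below t x))
    (indicator (below (t * (1# + δ)) x))
  sublevel {t} {δ} x 0≤t 0≤δ with x ≤? t
  ... | yes x≤t with x ≤? t * (1# + δ)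
  ...   | yes _    = inside x≤t
  ...   | no  x≰t′ = contradiction (≤-trans x≤t (by (0≤t ⊛ 0≤δ)
    (solve 2 (λ t δ → t :* (con (+ 1) :+ δ) :- t := t :* δ) refl t δ))) x≰t′
  sublevel {t} {δ} x 0≤t 0≤δ | no x≰t with x ≤? t * (1# + δ)
  ...   | yes _    = outside 0≤1 ≤-refl (by (diff (≰⇒≥ x≰t))
    (solve 3 (λ t δ x → x :- t :* (con (+ 1) :+ δ :* (con (+ 1) :- con (+ 1))) := x :- t)
      refl t δ x))
  ...   | no  x≰t′ = outside ≤-refl 0≤1 (by (diff (≰⇒≥ x≰t′))
    (solve 3 (λ t δ x → x :- t :* (con (+ 1) :+ δ :* (con (+ 1) :- con (+ 0))) := x :- t :*
      (con (+ 1) :+ δ)) refl t δ x))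

  -- The eigenvector survives only in the two energy hypotheses: nonnegativity drives the sublevel
  -- sets, the upper bound the superlevel sets. In the application ρ is cλ; δ and h are given by
  -- equations, so that no inverse of φ or 2 occurs.
  module LevelSets {n m : ℕ} (G : LossyFlowGraph n m) (β φ ρ δ h : Carrier) (z : Vector Carrier n)
    (balanced : Balanced G β) (expanding : HasExpansion G φ) (z-pos : ∀ u → 0# < z u)
    (0≤β : 0# ≤ β) (β≤φ : β ≤ φ) (φ≤1 : φ ≤ 1#) (3β≤1 : fromℕ 3 * β ≤ 1#) (0≤ρ : 0# ≤ ρ)
      (0<γ : 0# < β + ρ)
    (0≤δ : 0# ≤ δ) (φδ≈10γ : φ * δ ≈ fromℕ 10 * (β + ρ)) (5δ≤φ : fromℕ 5 * δ ≤ φ)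
      (φ≈2h : φ ≈ 2# * h)
    (energy-nonNeg : ∀ f → (∀ u → 0# ≤ f u) → 0# ≤ sum (λ e → flow G f e * flow G z e))
    (energy-bound : ∀ f → (∀ u → 0# ≤ f u) →
      sum (λ e → flow G f e * flow G z e) ≤ ρ * sum (λ u → degrees G u * (f u * z u))) where
    open LossyFlowGraph G

    private
      γ = β + ρ
      V = volume G
      X = cutSize G

      0≤φ : 0# ≤ φ
      0≤φ = ≤-trans 0≤β β≤φ
      β≤1 : β ≤ 1#
      β≤1 = ≤-trans β≤φ φ≤1
      β≤γ : β ≤ γ
      β≤γ = by 0≤ρ (solve 2 (λ b r → b :+ r :- b := r) refl β ρ)

      -- Laplacian degrees are therefore at most twice the degrees of the smoothed graph, the source
      -- of the 2 in `high-flux`.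
      η²≤2 : ∀ e → η e * η e ≤ 2#
      η²≤2 e = by (diff (balanced e) ⊛ (0≤1 ⊕ 0≤β ⊕ ≤-trans 0≤1 (1≤η e)) ⊕ diff 3β≤1 ⊕ 0≤β ⊛ diff
        β≤1)
        (solve 2 (λ η β → let i = con (+ 1) in con (+ 2) :- η :* η
          := (i :+ β :- η) :* (i :+ β :+ η) :+ (i :- con (+ 3) :* β) :+ β :* (i :- β)) refl (η e) β)

      volume-nonNeg : ∀ {χ} → (∀ u → 0# ≤ χ u) → 0# ≤ V χ
      volume-nonNeg 0≤χ = sum-nonNeg {m} λ e → 0≤χ (a e) ⊕ 0≤χ (b e)

    volume-mono : ∀ {χ χ′} → (∀ u → χ u ≤ χ′ u) → V χ ≤ V χ′
    volume-mono χ≤χ′ = sum-mono-≤ {m} λ e → +-mono-≤ (χ≤χ′ (a e)) (χ≤χ′ (b e))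

    private
      sum-cut-growth : ∀ χ χ′ → sum (λ e → (χ (a e) + - χ (b e)) * (χ (a e) + - χ (b e)) + -
        (χ′ (a e) + χ′ (b e) + - (χ (a e) + χ (b e))))
        ≈ X χ + - (V χ′ + - V χ)
      sum-cut-growth χ χ′ = trans
        (∑-distrib-+ {m} (λ e → (χ (a e) + - χ (b e)) * (χ (a e) + - χ (b e)))
        (λ e → - (χ′ (a e) + χ′ (b e) + - (χ (a e) + χ (b e)))))
        (+-congˡ (trans (sum-neg {m} (λ e → χ′ (a e) + χ′ (b e) + - (χ (a e) + χ (b e))))
          (-‿cong (trans (∑-distrib-+ {m} (λ e → χ′ (a e) + χ′ (b e)) (λ e → - (χ (a e) + χ (b e))))
            (+-congˡ (sum-neg {m} (λ e → χ (a e) + χ (b e))))))))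

      -- Expansion makes the cut at least φ v. If half of it turns into new volume, the volume grows
      -- by the factor 1 + φ/2; this is why h is φ/2.
      cut-absorbed⇒growth : ∀ {v v′ x} → φ * v ≤ x → x ≤ 2# * (v′ + - v) → (1# + h) * v ≤ v′
      cut-absorbed⇒growth {v} {v′} {x} φv≤x x≤2[v′-v] = *-cancelˡ-≤ (fromℕ-pos 1)
        (by (diff (≤-trans (≤-trans (≤-reflexive (*-congʳ (sym φ≈2h))) φv≤x) x≤2[v′-v]))
        (solve 3 (λ h v v′ → con (+ 2) :* v′ :- con (+ 2) :* ((con (+ 1) :+ h) :* v) := con (+ 2) :*
          (v′ :- v) :- con (+ 2) :* h :* v) refl h v v′))

    highIndicator lowIndicator : Carrier → Fin n → Carrier
    highIndicator t u = indicator (above t (z u))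
    lowIndicator t u = indicator (below t (z u))

    weight : Carrier → Carrier
    weight t = V (λ u → highIndicator t u * z u)

    -- Vertices that join when the threshold falls from t to t′ have values at most t.
    weight-bound : ∀ {t t′} → t′ ≤ t → weight t′ ≤ weight t + t *
      (V (highIndicator t′) + - V (highIndicator t))
    weight-bound {t} {t′} t′≤t = begin
      sum (λ e → w′ (a e) + w′ (b e))
        ≤⟨ sum-mono-≤ {m} (λ e → +-mono-≤ (vertex (a e)) (vertex (b e))) ⟩
      sum (λ e → w (a e) + t * (χ′ (a e) + - χ (a e)) + (w (b e) + t * (χ′ (b e) + - χ (b e))))
        ≈⟨ sum-cong {m} (λ e → solve 7 (λ t p q x x′ y y′ → p :+ t :* (x′ :- x) :+
          (q :+ t :* (y′ :- y))
             := con (+ 1) :* (p :+ q) :+ t :* (con (+ 1) :* (x′ :+ y′) :+ :- con (+ 1) :* (x :+ y)))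
               refl t (w (a e)) (w (b e)) (χ (a e)) (χ′ (a e)) (χ (b e)) (χ′ (b e))) ⟩
      sum (λ e → 1# * (w (a e) + w (b e)) + t * (1# * (χ′ (a e) + χ′ (b e)) + - 1# *
        (χ (a e) + χ (b e))))
        ≈⟨ sum-combination {m} 1# t (λ e → w (a e) + w (b e)) (λ e → 1# * (χ′ (a e) + χ′ (b e)) + -
          1# * (χ (a e) + χ (b e))) ⟩
      1# * weight t + t * sum (λ e → 1# * (χ′ (a e) + χ′ (b e)) + - 1# * (χ (a e) + χ (b e)))
        ≈⟨ +-congˡ (*-congˡ (sum-combination {m} 1# (- 1#) (λ e → χ′ (a e) + χ′ (b e))
          (λ e → χ (a e) + χ (b e)))) ⟩
      1# * weight t + t * (1# * V χ′ + - 1# * V χ)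
        ≈⟨ solve 4 (λ w t x y → con (+ 1) :* w :+ t :* (con (+ 1) :* x :+ :- con (+ 1) :* y) := w :+
          t :* (x :- y)) refl (weight t) t (V χ′) (V χ) ⟩
      weight t + t * (V χ′ + - V χ) ∎
      where
      open ≤-Reasoning
      χ = highIndicator t
      χ′ = highIndicator t′
      w w′ : Fin n → Carrier
      w u = χ u * z u
      w′ u = χ′ u * z u
      vertex : ∀ u → χ′ u * z u ≤ χ u * z u + t * (χ′ u + - χ u)
      vertex u with t ≤? z u
      ... | yes t≤z = ≤-reflexive (trans (*-congʳ (above-true (≤-trans t′≤t t≤z))) (trans
        (solve 2 (λ t z → con (+ 1) :* z := con (+ 1) :* z :+ t :* (con (+ 1) :- con (+ 1)))
          refl t (z u))
        (+-congˡ (*-congˡ (+-congʳ (sym (above-true (≤-trans t′≤t t≤z))))))))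
      ... | no t≰z = by (indicator-nonNeg (above t′ (z u)) ⊛ diff (≰⇒≥ t≰z))
        (solve 3 (λ t z x → con (+ 0) :* z :+ t :* (x :- con (+ 0)) :- x :* z := x :* (t :- z))
          refl t (z u) (χ′ u))

    -- The difference on the left is at most the number of crossing edges that the larger set fails
    -- to absorb. On the right, the eigenvalue contributes at most 2ρ times the weight and the
    -- multipliers at most β times it.
    high-flux : ∀ {t t′ θ} → 0# ≤ θ → t ≈ t′ +
      θ → let χ = highIndicator t ; χ′ = highIndicator t′ in
      θ * (X χ + - (V χ′ + - V χ)) ≤ 2# * γ * weight t
    high-flux {t} {t′} {θ} 0≤θ t≈t′+θ = begin
      θ * (X χ + - (V χ′ + - V χ))
        ≈⟨ trans (sym (*-distribˡ-sum {m} θ excess)) (*-congˡ (sum-cut-growth χ χ′)) ⟨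
      sum (λ e → θ * excess e)
        ≤⟨ sum-mono-≤ {m} (λ e → superlevel-edge 0≤β 0≤θ (1≤η e) (balanced e) (proj₁ (z-pos (a e)))
        (proj₁ (z-pos (b e)))
                                                       (superlevel (z (a e)) 0≤θ t≈t′+θ)
                                                         (superlevel (z (b e)) 0≤θ t≈t′+θ)) ⟩
      sum (λ e → flow G χ e * flow G z e + β * (χ (a e) * z (a e) + χ (b e) * z (b e)))
        ≈⟨ trans (∑-distrib-+ {m} (λ e → flow G χ e * flow G z e)
          (λ e → β * (χ (a e) * z (a e) + χ (b e) * z (b e))))
          (+-congˡ (sym (*-distribˡ-sum {m} β (λ e → χ (a e) * z (a e) + χ (b e) * z (b e))))) ⟩
      sum (λ e → flow G χ e * flow G z e) + β * W
        ≤⟨ +-mono-≤ (energy-bound χ (λ u → indicator-nonNeg (above t (z u)))) ≤-refl ⟩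
      ρ * sum (λ u → degrees G u * w u) + β * W   ≈⟨ +-congʳ (*-congˡ (sum-degrees G w)) ⟩
      ρ * sum (λ e → w (b e) + η e * η e * w (a e)) + β * W
        ≤⟨ +-mono-≤ (*-monoˡ-≤ 0≤ρ degrees-bound) ≤-refl ⟩
      ρ * (2# * W) + β * W                        ≤⟨ by (0≤β ⊛ volume-nonNeg 0≤w)
        (solve 3 (λ r b w → con (+ 2) :* (b :+ r) :* w :- (r :* (con (+ 2) :* w) :+ b :* w) := b :*
          w) refl ρ β W) ⟩
      2# * γ * W                                  ∎
      where
      open ≤-Reasoning
      χ = highIndicator t
      χ′ = highIndicator t′
      W = weight t
      w : Fin n → Carrier
      w u = χ u * z u
      0≤w : ∀ u → 0# ≤ w u
      0≤w u = indicator-nonNeg (above t (z u)) ⊛ proj₁ (z-pos u)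
      excess : Fin m → Carrier
      excess e = (χ (a e) + - χ (b e)) * (χ (a e) + - χ (b e)) + -
        (χ′ (a e) + χ′ (b e) + - (χ (a e) + χ (b e)))
      degrees-bound : sum (λ e → w (b e) + η e * η e * w (a e)) ≤ 2# * W
      degrees-bound = ≤-trans (sum-mono-≤ {m} λ e → by (0≤w (b e) ⊕ diff (η²≤2 e) ⊛ 0≤w (a e))
          (solve 3 (λ h p q → con (+ 2) :* (p :+ q) :- (q :+ h :* p) := q :+ (con (+ 2) :- h) :* p)
            refl (η e * η e) (w (a e)) (w (b e))))
        (≤-reflexive (sym (*-distribˡ-sum {m} 2# (λ e → w (a e) + w (b e)))))

    high-step : ∀ {t t′} → 0# < t′ → t ≈ t′ + t′ * δ →
      V (highIndicator t) ≤ fromℕ m → weight t ≤ 2# * t * V (highIndicator t) →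
      weight t′ ≤ 2# * t′ * V (highIndicator t′) × (1# + h) * V (highIndicator t) ≤ V
        (highIndicator t′)
    high-step {t} {t′} 0<t′ t≈t′+t′δ small inv = weight′ , growth
      where
      open ≤-Reasoning
      θ = t′ * δ
      v = V (highIndicator t)
      v′ = V (highIndicator t′)
      x = X (highIndicator t)
      0≤θ : 0# ≤ θ
      0≤θ = proj₁ 0<t′ ⊛ 0≤δ
      0≤v′ : 0# ≤ v′
      0≤v′ = volume-nonNeg λ u → indicator-nonNeg (above t′ (z u))
      φv≤x : φ * v ≤ x
      φv≤x = expansion G expanding (λ u → above t (z u)) small
      δ≤¼ : fromℕ 4 * δ ≤ 1#
      δ≤¼ = by (0≤δ ⊕ diff 5δ≤φ ⊕ diff φ≤1)
        (solve 2 (λ d p → con (+ 1) :- con (+ 4) :* d := d :+ (p :- con (+ 5) :* d) :+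
        (con (+ 1) :- p)) refl δ φ)
      -- Write Δ for v′ - v. With φδ = 10γ and the weight condition, the flux bound divided by t′γ
      -- reads 10(x - Δ) ≤ 4(1 + δ)x. As 4δ ≤ 1, the right side is at most 5x, which leaves x ≤ 2Δ.
      absorbed : x ≤ 2# * (v′ + - v)
      absorbed = *-cancelˡ-≤ (*-pos (*-pos (fromℕ-pos 4) 0<t′) 0<γ) (begin
        fromℕ 5 * t′ * γ * x     ≤⟨ by
          (diff flux ⊕ ((proj₁ 0<γ ⊛ proj₁ 0<t′) ⊛ cutSize-nonNeg G (highIndicator t)) ⊛ diff δ≤¼)
          (solve 6 (λ t d g x v v′ →
            con (+ 5) :* t :* g :* (con (+ 2) :* (v′ :- v)) :- con (+ 5) :* t :* g :* x
            := con (+ 4) :* g :* (t :* (con (+ 1) :+ d)) :* x :- t :* (con (+ 10) :* g) :*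
              (x :- (v′ :- v))
               :+ g :* t :* x :* (con (+ 1) :- con (+ 4) :* d)) refl t′ δ γ x v v′) ⟩
        fromℕ 5 * t′ * γ * (2# * (v′ + - v))  ∎)
        where
        0≤4γt : 0# ≤ fromℕ 4 * γ * (t′ * (1# + δ))
        0≤4γt = fromℕ-nonNeg 4 ⊛ proj₁ 0<γ ⊛ (proj₁ 0<t′ ⊛ (0≤1 ⊕ 0≤δ))
        flux : t′ * (fromℕ 10 * γ) * (x + - (v′ + - v)) ≤ fromℕ 4 * γ * (t′ * (1# + δ)) * x
        flux = begin
          t′ * (fromℕ 10 * γ) * (x + - (v′ + - v))     ≈⟨ *-congʳ (*-congˡ φδ≈10γ) ⟨
          t′ * (φ * δ) * (x + - (v′ + - v))
            ≈⟨ solve 4 (λ t p d y → t :* (p :* d) :* y := p :* (t :* d :* y)) refl t′ φ δ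
            (x + - (v′ + - v)) ⟩
          φ * (θ * (x + - (v′ + - v)))
            ≤⟨ *-monoˡ-≤ 0≤φ (≤-trans (high-flux 0≤θ t≈t′+t′δ)
            (*-monoˡ-≤ (fromℕ-nonNeg 2 ⊛ proj₁ 0<γ) inv)) ⟩
          φ * (2# * γ * (2# * t * v))
            ≈⟨ *-congˡ (*-congˡ (*-congʳ (*-congˡ t≈t′+t′δ))) ⟩
          φ * (2# * γ * (2# * (t′ + θ) * v))
            ≈⟨ solve 5 (λ p g t d v → p :* (con (+ 2) :* g :* (con (+ 2) :* (t :+ t :* d) :* v)) :=
            con (+ 4) :* g :* (t :* (con (+ 1) :+ d)) :* (p :* v)) refl φ γ t′ δ v ⟩
          fromℕ 4 * γ * (t′ * (1# + δ)) * (φ * v)      ≤⟨ *-monoˡ-≤ 0≤4γt φv≤x ⟩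
          fromℕ 4 * γ * (t′ * (1# + δ)) * x            ∎
      growth : (1# + h) * v ≤ v′
      growth = cut-absorbed⇒growth φv≤x absorbed
      weight′ : weight t′ ≤ 2# * t′ * v′
      weight′ = begin
        weight t′
          ≤⟨ weight-bound (by 0≤θ (trans (+-congʳ t≈t′+t′δ)
          (solve 2 (λ t θ → t :+ θ :- t := θ) refl t′ θ))) ⟩
        weight t + t * (v′ + - v)         ≤⟨ +-mono-≤ inv ≤-refl ⟩
        2# * t * v + t * (v′ + - v)
          ≈⟨ +-cong (*-congʳ (*-congˡ t≈t′+t′δ)) (*-congʳ t≈t′+t′δ) ⟩
        2# * (t′ + θ) * v + (t′ + θ) * (v′ + - v)
          ≈⟨ solve 4 (λ t d v v′ → con (+ 2) :* (t :+ t :* d) :* v :+ (t :+ t :* d) :* (v′ :- v) :=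
          t :* ((con (+ 1) :+ d) :* (v :+ v′))) refl t′ δ v v′ ⟩
        t′ * ((1# + δ) * (v + v′))        ≤⟨ *-monoˡ-≤ (proj₁ 0<t′) (*-cancelˡ-≤ 0<1+h (by
          ((0≤1 ⊕ 0≤δ) ⊛ diff growth ⊕ diff δ[2+h]≤h ⊛ 0≤v′)
          (solve 4 (λ h d v v′ → let i = con (+ 1) in
             (i :+ h) :* (con (+ 2) :* v′) :- (i :+ h) :* ((i :+ d) :* (v :+ v′))
             := (i :+ d) :* (v′ :- (i :+ h) :* v) :+ (h :- d :* (con (+ 2) :+ h)) :* v′) refl h δ v
               v′))) ⟩
        t′ * (2# * v′)
          ≈⟨ solve 2 (λ t v → t :* (con (+ 2) :* v) := con (+ 2) :* t :* v) refl t′ v′ ⟩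
        2# * t′ * v′                      ∎
        where
        0≤h : 0# ≤ h
        0≤h = *-cancelˡ-nonNeg (fromℕ-pos 1) (≤-trans 0≤φ (≤-reflexive φ≈2h))
        0<1+h : 0# < 1# + h
        0<1+h = <-≤-trans 0<1 (by 0≤h (solve 1 (λ h → con (+ 1) :+ h :- con (+ 1) := h) refl h))
        2h≤1 : 2# * h ≤ 1#
        2h≤1 = ≤-trans (≤-reflexive (sym φ≈2h)) φ≤1
        5δ≤2h : fromℕ 5 * δ ≤ 2# * h
        5δ≤2h = ≤-trans 5δ≤φ (≤-reflexive φ≈2h)
        -- The condition for (1 + δ)(v + v′) ≤ 2v′ when v is as large as v′/(1 + h). It holds
        -- because 2δ(2 + h) ≤ 5δ ≤ 2h.
        δ[2+h]≤h : δ * (2# + h) ≤ h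
        δ[2+h]≤h = *-cancelˡ-≤ (fromℕ-pos 1) (by (diff 5δ≤2h ⊕ 0≤δ ⊛ diff 2h≤1)
          (solve 2 (λ h d → con (+ 2) :* h :- con (+ 2) :* (d :* (con (+ 2) :+ h))
             := con (+ 2) :* h :- con (+ 5) :* d :+ d :* (con (+ 1) :- con (+ 2) :* h)) refl h δ))

    -- The energy of z against χ/z is nonnegative, so the drops on unabsorbed crossing edges cannot
    -- outweigh the gains that the multipliers allow.
    low-flux : ∀ {t} → 0# ≤ t → let χ = lowIndicator t ; χ′ = lowIndicator (t * (1# + δ)) in
      δ * (X χ + - (V χ′ + - V χ)) ≤ β * β * V χ + 2# * β * X χ
    low-flux {t} 0≤t = by energy (trans
      (solve 3 (λ v x d → v :+ x :- d := v :+ x :+ :- d) refl (β * β * V χ) (2# * β * X χ)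
        (δ * (X χ + - (V χ′ + - V χ))))
      (sym (begin-equality
        sum (λ e → β * β * (χ (a e) + χ (b e)) + 2# * β * crossing e + - (δ * excess e))
          ≈⟨ ∑-distrib-+ {m} (λ e → β * β * (χ (a e) + χ (b e)) + 2# * β * crossing e)
            (λ e → - (δ * excess e)) ⟩
        sum (λ e → β * β * (χ (a e) + χ (b e)) + 2# * β * crossing e) + sum (λ e → - (δ * excess e))
          ≈⟨ +-cong (sum-combination {m} (β * β) (2# * β) (λ e → χ (a e) + χ (b e)) crossing)
               (trans (sum-neg {m} (λ e → δ * excess e))
                 (-‿cong (sym (*-distribˡ-sum {m} δ excess)))) ⟩
        β * β * V χ + 2# * β * X χ + - (δ * sum excess)
          ≈⟨ +-congˡ (-‿cong (*-congˡ (sum-cut-growth χ χ′))) ⟩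
        β * β * V χ + 2# * β * X χ + - (δ * (X χ + - (V χ′ + - V χ))) ∎)))
      where
      open ≤-Reasoning
      χ = lowIndicator t
      χ′ = lowIndicator (t * (1# + δ))
      z⁻¹ : Fin n → Carrier
      z⁻¹ u = z u ⁻¹
      0≤z⁻¹ : ∀ u → 0# ≤ z⁻¹ u
      0≤z⁻¹ u = proj₁ (⁻¹-pos (z-pos u))
      crossing excess : Fin m → Carrier
      crossing e = (χ (a e) + - χ (b e)) * (χ (a e) + - χ (b e))
      excess e = crossing e + - (χ′ (a e) + χ′ (b e) + - (χ (a e) + χ (b e)))
      energy : 0# ≤ sum (λ e → β * β * (χ (a e) + χ (b e)) + 2# * β * crossing e + - (δ * excess e))
      energy = ≤-trans (energy-nonNeg (λ u → χ u * z⁻¹ u) (λ u → indicator-nonNeg (below t (z u)) ⊛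
        0≤z⁻¹ u))
        (sum-mono-≤ {m} λ e → sublevel-edge 0≤β β≤1 0≤δ (1≤η e) (balanced e) (0≤z⁻¹ (a e))
          (0≤z⁻¹ (b e))
          (x*x⁻¹≈1 (z-pos (a e))) (x*x⁻¹≈1 (z-pos (b e))) (sublevel (z (a e)) 0≤t 0≤δ)
            (sublevel (z (b e)) 0≤t 0≤δ))

    low-step : ∀ {t} → 0# ≤ t → V (lowIndicator t) ≤ fromℕ m →
      (1# + h) * V (lowIndicator t) ≤ V (lowIndicator (t * (1# + δ)))
    low-step {t} 0≤t small = cut-absorbed⇒growth φv≤x (*-cancelˡ-≤ (*-pos (fromℕ-pos 4) 0<γ) (by
        (diff flux ⊕ (proj₁ 0<γ ⊛ 0≤x) ⊛ (fromℕ-nonNeg 3 ⊛ diff φ≤1 ⊕ fromℕ-nonNeg 2))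
        (solve 5 (λ p g x v v′ →
          con (+ 5) :* g :* (con (+ 2) :* (v′ :- v)) :- con (+ 5) :* g :* x
          := p :* (con (+ 3) :* g :* x) :- con (+ 10) :* g :* (x :- (v′ :- v)) :+ g :* x :*
            (con (+ 3) :* (con (+ 1) :- p) :+ con (+ 2))) refl φ γ x v v′)))
      where
      open ≤-Reasoning
      v = V (lowIndicator t)
      v′ = V (lowIndicator (t * (1# + δ)))
      x = X (lowIndicator t)
      0≤x = cutSize-nonNeg G (lowIndicator t)
      0≤v : 0# ≤ v
      0≤v = volume-nonNeg λ u → indicator-nonNeg (below t (z u))
      φv≤x : φ * v ≤ x
      φv≤x = expansion G expanding (λ u → below t (z u)) small
      -- Here β²v ≤ βφv ≤ βx, so both error terms together are at most 3βx ≤ 3γx. Against the 10γ on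
      -- the left, with φ ≤ 1, the volume gain is at least 7/10 of the cut, more than the half
      -- required.
      flux : fromℕ 10 * γ * (x + - (v′ + - v)) ≤ φ * (fromℕ 3 * γ * x)
      flux = begin
        fromℕ 10 * γ * (x + - (v′ + - v))   ≈⟨ *-congʳ φδ≈10γ ⟨
        φ * δ * (x + - (v′ + - v))          ≈⟨ *-assoc φ δ _ ⟩
        φ * (δ * (x + - (v′ + - v)))        ≤⟨ *-monoˡ-≤ 0≤φ (low-flux 0≤t) ⟩
        φ * (β * β * v + 2# * β * x)        ≤⟨ *-monoˡ-≤ 0≤φ (by
          (0≤β ⊛ (diff β≤φ ⊛ 0≤v) ⊕ 0≤β ⊛ diff φv≤x ⊕ fromℕ-nonNeg 3 ⊛ (diff β≤γ ⊛ 0≤x))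
          (solve 5 (λ b g p v x → con (+ 3) :* g :* x :- (b :* b :* v :+ con (+ 2) :* b :* x)
             := b :* ((p :- b) :* v) :+ b :* (x :- p :* v) :+ con (+ 3) :* ((g :- b) :* x)) refl β γ
               φ v x)) ⟩
        φ * (fromℕ 3 * γ * x)               ∎

-- The ground state of the normalized Laplacian

module Spectrum (ℝ : CompleteOrderedField) where
  open OrderedField ℝ
  open Suprema ℝ
  open Sums ℝ
  open QuadraticForms ℝ
  open LinearAlgebra ℝ
  open LossyFlow ℝ
  open GraphSums ℝ

  module GroundState {n m : ℕ} (G : LossyFlowGraph n m) (connected : Connected (smoothed G))
    (e₀ : Fin m) where
    open LossyFlowGraph G

    private
      L : Matrix n n
      L = laplacian G

      0≤η : ∀ e → 0# ≤ η e
      0≤η e = ≤-trans 0≤1 (1≤η e)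

    -- The first edge of a path from u to an end of `e₀`; an empty path means that u is that end.
    incidentEdge : ∀ u → ∃[ e ] (a e ≡ u ⊎ b e ≡ u)
    incidentEdge u with connected u (a e₀)
    ... | done                  = e₀ , inj₁ ≡.refl
    ... | (e , inj₁ (a≡u , _)) ◅ _ = e , inj₁ a≡u
    ... | (e , inj₂ (_ , b≡u)) ◅ _ = e , inj₂ b≡u

    1≤volume : ∀ {χ} u → (∀ i → 0# ≤ χ i) → 1# ≤ χ u → 1# ≤ volume G χ
    1≤volume {χ} u 0≤χ 1≤χ with incidentEdge u
    ... | e , inj₁ ≡.refl = ≤-trans (by (diff 1≤χ ⊕ 0≤χ (b e))
      (solve 2 (λ x y → x :+ y :- con (+ 1) := x :- con (+ 1) :+ y) refl (χ (a e)) (χ (b e))))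
      (term≤sum {m} (λ e → 0≤χ (a e) ⊕ 0≤χ (b e)) e)
    ... | e , inj₂ ≡.refl = ≤-trans (by (diff 1≤χ ⊕ 0≤χ (a e))
      (solve 2 (λ x y → x :+ y :- con (+ 1) := y :- con (+ 1) :+ x) refl (χ (a e)) (χ (b e))))
      (term≤sum {m} (λ e → 0≤χ (a e) ⊕ 0≤χ (b e)) e)

    degrees-pos : ∀ u → 0# < degrees G u
    degrees-pos u = <-≤-trans 0<1 (1≤degree (incidentEdge u))
      where
      term : ∀ e → incidence G e u * incidence G e u ≤ degrees G u
      term = term≤sum {m} (λ e → square-nonNeg (incidence G e u))
      1≤degree : ∃[ e ] (a e ≡ u ⊎ b e ≡ u) → 1# ≤ degrees G u
      1≤degree (e , inj₁ ≡.refl) = ≤-trans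
        (by (𝟙-nonNeg (b e) (a e) ⊕ diff (*-mono-≤ 0≤1 (0≤η e) (1≤η e) (1≤η e)))
        (trans (+-congʳ (trans (incidence-square G e (a e)) (+-congˡ (*-congˡ (𝟙-diagonal (a e))))))
          (solve 2 (λ q h → q :+ h :* con (+ 1) :- con (+ 1) := q :+ (h :- con (+ 1) :* con (+ 1)))
            refl (𝟙 (b e) (a e)) (η e * η e)))) (term e)
      1≤degree (e , inj₂ ≡.refl) = ≤-trans (by ((0≤η e ⊛ 0≤η e) ⊛ 𝟙-nonNeg (a e) (b e))
        (trans (+-congʳ (trans (incidence-square G e (b e)) (+-congʳ (𝟙-diagonal (b e)))))
          (solve 2 (λ q h → con (+ 1) :+ h :* q :- con (+ 1) := h :* q) refl (𝟙 (a e) (b e))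
            (η e * η e)))) (term e)

    𝟙*𝟙≈0 : ∀ (k : Fin n) {i j : Fin n} → i ≢ j → 𝟙 k i * 𝟙 k j ≈ 0#
    𝟙*𝟙≈0 k {i} {j} i≢j with k ≟ᶠ i | k ≟ᶠ j
    ... | yes ≡.refl | yes ≡.refl = contradiction ≡.refl i≢j
    ... | yes _ | no  _ = zeroʳ 1#
    ... | no  _ | yes _ = zeroˡ 1#
    ... | no  _ | no  _ = zeroʳ 0#

    -- Written as a sum of nonnegative couplings, the entry yields both its sign and, since an edge
    -- joining i and j contributes at least 1, strictness for adjacent vertices.
    -laplacian : ∀ {i j} → i ≢ j → - L i j ≈ sum
      (λ e → η e * (𝟙 (a e) i * 𝟙 (b e) j + 𝟙 (b e) i * 𝟙 (a e) j))
    -laplacian {i} {j} i≢j = trans (sym (sum-neg {m} (λ e → incidence G e i * incidence G e j)))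
      (sum-cong {m} λ e → begin-equality
      - ((𝟙 (b e) i + - (η e * 𝟙 (a e) i)) * (𝟙 (b e) j + - (η e * 𝟙 (a e) j)))
        ≈⟨ solve 5 (λ h p p′ q q′ → :- ((q :- h :* p) :* (q′ :- h :* p′))
             := h :* (p :* q′ :+ q :* p′) :- (q :* q′ :+ h :* h :* (p :* p′))) refl (η e)
               (𝟙 (a e) i) (𝟙 (a e) j) (𝟙 (b e) i) (𝟙 (b e) j) ⟩
      r e + - (𝟙 (b e) i * 𝟙 (b e) j + η e * η e * (𝟙 (a e) i * 𝟙 (a e) j))
        ≈⟨ +-congˡ (-‿cong (+-cong (𝟙*𝟙≈0 (b e) i≢j) (*-congˡ (𝟙*𝟙≈0 (a e) i≢j)))) ⟩
      r e + - (0# + η e * η e * 0#)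
        ≈⟨ solve 2 (λ r h → r :- (con (+ 0) :+ h :* con (+ 0)) := r) refl (r e) (η e * η e) ⟩
      r e ∎)
      where
      open ≤-Reasoning
      r : Fin m → Carrier
      r e = η e * (𝟙 (a e) i * 𝟙 (b e) j + 𝟙 (b e) i * 𝟙 (a e) j)

    private
      coupling-nonNeg : ∀ i j e → 0# ≤ η e * (𝟙 (a e) i * 𝟙 (b e) j + 𝟙 (b e) i * 𝟙 (a e) j)
      coupling-nonNeg i j e = 0≤η e ⊛ (𝟙-nonNeg (a e) i ⊛ 𝟙-nonNeg (b e) j ⊕ 𝟙-nonNeg (b e) i ⊛
        𝟙-nonNeg (a e) j)

    laplacian-off-diagonal : ∀ {i j} → i ≢ j → L i j ≤ 0#
    laplacian-off-diagonal {i} {j} i≢j = by (sum-nonNeg {m} (coupling-nonNeg i j))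
      (trans (+-identityˡ _) (-laplacian i≢j))

    adjacent⇒≢ : ∀ {i j} → Adjacent (smoothed G) i j → i ≢ j
    adjacent⇒≢ (e , inj₁ (≡.refl , ≡.refl)) i≡j = distinct e i≡j
    adjacent⇒≢ (e , inj₂ (≡.refl , ≡.refl)) i≡j = distinct e (≡.sym i≡j)

    adjacent⇒laplacian-neg : ∀ {i j} → Adjacent (smoothed G) i j → 0# < - L i j
    adjacent⇒laplacian-neg {i} {j} adjacent@(e , ends) = <-≤-trans 0<1 (≤-trans (1≤coupling ends)
      (≤-trans (term≤sum {m} (coupling-nonNeg i j) e)
        (≤-reflexive (sym (-laplacian (adjacent⇒≢ adjacent))))))
      where
      1≤coupling : (a e ≡ i × b e ≡ j) ⊎ (a e ≡ j × b e ≡ i) → 1# ≤ η e *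
        (𝟙 (a e) i * 𝟙 (b e) j + 𝟙 (b e) i * 𝟙 (a e) j)
      1≤coupling (inj₁ (≡.refl , ≡.refl)) = by
        (diff (1≤η e) ⊕ 0≤η e ⊛ (𝟙-nonNeg (b e) (a e) ⊛ 𝟙-nonNeg (a e) (b e)))
        (trans (+-congʳ (*-congˡ (+-congʳ (*-cong (𝟙-diagonal (a e)) (𝟙-diagonal (b e))))))
          (solve 2 (λ h p → h :* (con (+ 1) :* con (+ 1) :+ p) :- con (+ 1) := h :- con (+ 1) :+ h
            :* p) refl (η e) (𝟙 (b e) (a e) * 𝟙 (a e) (b e))))
      1≤coupling (inj₂ (≡.refl , ≡.refl)) = by
        (diff (1≤η e) ⊕ 0≤η e ⊛ (𝟙-nonNeg (a e) (b e) ⊛ 𝟙-nonNeg (b e) (a e)))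
        (trans (+-congʳ (*-congˡ (+-congˡ (*-cong (𝟙-diagonal (b e)) (𝟙-diagonal (a e))))))
          (solve 2 (λ h p → h :* (p :+ con (+ 1) :* con (+ 1)) :- con (+ 1) := h :- con (+ 1) :+ h
            :* p) refl (η e) (𝟙 (a e) (b e) * 𝟙 (b e) (a e))))

    module _ {d : Vector Carrier n} (0<d : ∀ i → 0# < d i) where
      private
        M : Matrix n n
        M = normalizedLaplacian G d

        s : Vector Carrier n
        s i = √ (d i) ⁻¹

        0<s : ∀ i → 0# < s i
        0<s i = ⁻¹-pos (√-pos (0<d i))

        scale : Vector Carrier n → Vector Carrier n
        scale x i = s i * x i

      normalized-entry : ∀ i j → M i j ≈ s i * L i j * s j
      normalized-entry i j = begin-equality
        sum (λ h → sum (λ k → s i * 𝟙 i k * L k h) * (s h * 𝟙 h j))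
          ≈⟨ sum-cong {n} (λ h → *-congʳ
            (trans (sum-cong {n} λ k → solve 3 (λ s e l → s :* e :* l := e :* (s :* l))
            refl (s i) (𝟙 i k) (L k h))
               (sum-𝟙 i (λ k → s i * L k h)))) ⟩
        sum (λ h → s i * L i h * (s h * 𝟙 h j))
          ≈⟨ sum-cong {n} (λ h → trans (*-congˡ (*-congˡ (𝟙-sym h j)))
            (solve 4 (λ s l t e → s :* l :* (t :* e) := e :* (s :* l :* t)) refl (s i) (L i h) (s h)
            (𝟙 j h))) ⟩
        sum (λ h → 𝟙 j h * (s i * L i h * s h))   ≈⟨ sum-𝟙 j (λ h → s i * L i h * s h) ⟩
        s i * L i j * s j ∎
        where open ≤-Reasoning

      normalized-· : ∀ x i → (M · x) i ≈ s i * (L · scale x) i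
      normalized-· x i = trans (sum-cong {n} λ j → trans (*-congʳ (normalized-entry i j))
        (solve 4 (λ s l t x → s :* l :* t :* x := s :* (l :* (t :* x))) refl (s i) (L i j) (s j)
          (x j)))
        (sym (*-distribˡ-sum {n} (s i) (λ j → L i j * scale x j)))

      normalized-symmetric : Symmetric M
      normalized-symmetric i j = trans (normalized-entry i j) (trans
        (trans (*-congʳ (*-congˡ (sum-cong {m} λ e → *-comm (incidence G e i) (incidence G e j))))
               (solve 3 (λ s l t → s :* l :* t := t :* l :* s) refl (s i) (L j i) (s j)))
                 (sym (normalized-entry j i)))

      normalized-psd : PositiveSemidefinite M
      normalized-psd x = nonNeg (sum-nonNeg {m} λ e → square-nonNeg (flow G (scale x) e)) (trans
        (sum-cong {n} λ i → trans (*-congˡ (normalized-· x i))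
          (solve 3 (λ s x l → x :* (s :* l) := s :* x :* l) refl (s i) (x i) ((L · scale x) i)))
        (laplacian-form G (scale x) (scale x)))

      eigenvalue-nonNeg : ∀ {μ} → IsEigenvalue M μ → 0# ≤ μ
      eigenvalue-nonNeg {μ} (w , (i , wᵢ≉0) , Mw≈μw) = *-cancelˡ-nonNeg (∙-self-pos {x = w} i wᵢ≉0)
        (≤-trans (normalized-psd w) (≤-reflexive
          (trans (form-eigenvector {M = M} {w = w} Mw≈μw) (*-comm _ _))))

      module _ {v : Vector Carrier n} (v-min : IsVMin M v) where
        open IsVMin v-min

        z : Vector Carrier n
        z i = v i / √ (d i)

        v-pos : ∀ i → 0# < v i
        -- v lies in the kernel of M - μI, and the sign convention on its first nonzero coordinate
        -- supplies the positive entry to start from.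
        v-pos = kernel-positive (λ i → trans (shift-· M μ v i)
          (trans (+-congʳ (proj₂ eigenvector i)) (-‿inverseʳ _)))
          connected (proj₁ (proj₂ firstPositive))
          where
          A≈ : ∀ {i j} → i ≢ j → shift M μ i j ≈ s i * L i j * s j
          A≈ {i} {j} i≢j = trans (+-cong (normalized-entry i j)
            (-‿cong (*-congˡ (𝟙-off-diagonal i≢j))))
            (solve 2 (λ x m → x :- m :* con (+ 0) := x) refl (s i * L i j * s j) μ)
          off-diagonal : ∀ {i j} → i ≢ j → shift M μ i j ≤ 0#
          off-diagonal {i} {j} i≢j = by (proj₁ (0<s i) ⊛ -nonNeg (laplacian-off-diagonal i≢j) ⊛
            proj₁ (0<s j))
            (trans (+-congˡ (-‿cong (A≈ i≢j)))
              (solve 3 (λ s l t → con (+ 0) :- s :* l :* t := s :* (:- l) :* t) refl (s i) (L i j)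
              (s j)))
          adjacent⇒≉0 : ∀ {i j} → Adjacent (smoothed G) i j → ¬ (shift M μ i j ≈ 0#)
          adjacent⇒≉0 {i} {j} adjacent A≈0 = pos≉0
            (*-pos (*-pos (0<s i) (adjacent⇒laplacian-neg adjacent)) (0<s j))
            (trans (solve 3 (λ s l t → s :* (:- l) :* t := :- (s :* l :* t)) refl (s i) (L i j)
              (s j))
              (trans (-‿cong (trans (sym (A≈ (adjacent⇒≢ adjacent))) A≈0))
                (solve 0 (:- con (+ 0) := con (+ 0)) refl)))
          open Perron {A = shift M μ} {_~_ = Adjacent (smoothed G)}
            (shift-symmetric normalized-symmetric μ)
            (λMin-psd normalized-symmetric normalized-psd smallest) off-diagonal adjacent⇒≢
              adjacent⇒≉0

        z-pos : ∀ i → 0# < z i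
        z-pos i = *-pos (v-pos i) (0<s i)

        -- The eigenvector equation for v multiplied by √d in each row: L z = μ D z.
        laplacian-z : ∀ i → (L · z) i ≈ μ * (d i * z i)
        laplacian-z i = begin-equality
          (L · z) i                       ≈⟨ *-identityˡ _ ⟨
          1# * (L · z) i                  ≈⟨ *-congʳ (x*x⁻¹≈1 (√-pos (0<d i))) ⟨
          √ (d i) * s i * (L · z) i       ≈⟨ *-assoc _ _ _ ⟩
          √ (d i) * (s i * (L · z) i)     ≈⟨ *-congˡ
            (trans (*-congˡ (sum-cong {n} λ j → *-congˡ (*-comm (v j) (s j))))
            (sym (normalized-· v i))) ⟩
          √ (d i) * (M · v) i             ≈⟨ *-congˡ (proj₂ eigenvector i) ⟩
          √ (d i) * (μ * v i)             ≈⟨ *-congˡ (*-congˡ (sym (*-/-cancel (√-pos (0<d i))))) ⟩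
          √ (d i) * (μ * (√ (d i) * z i))
            ≈⟨ solve 3 (λ r m z → r :* (m :* (r :* z)) := m :* (r :* r :* z)) refl (√ (d i)) μ (z i)
            ⟩
          μ * (√ (d i) * √ (d i) * z i)   ≈⟨ *-congˡ (*-congʳ (√-square (0<d i))) ⟩
          μ * (d i * z i)                 ∎
          where open ≤-Reasoning

        energy : ∀ f → sum (λ e → flow G f e * flow G z e) ≈ μ * sum (λ i → d i * (f i * z i))
        energy f = trans (sym (laplacian-form G f z)) (trans
          (sum-cong {n} λ i → trans (*-congˡ (laplacian-z i))
            (solve 4 (λ f m d z → f :* (m :* (d :* z)) := m :* (d :* (f :* z))) refl (f i) μ (d i)
            (z i)))
          (sym (*-distribˡ-sum {n} μ (λ i → d i * (f i * z i)))))

-- From volume growth to the ratio bound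

module HarnackInequality (ℝ : CompleteOrderedField) where
  open OrderedField ℝ
  open Sums ℝ
  open Exponential ℝ
  open Extremes ℝ
  open LossyFlow ℝ
  open QuadraticForms ℝ using (∙-self≈0⇒≈0)
  open GraphSums ℝ
  open Growth ℝ
  open Spectrum ℝ
  open Powers semiring using (^-homo-*)
  open Multiples semiring using (×-homo-+)

  -- Multiplication on the right makes the next threshold definitionally t * r, the form in which
  -- `low-step` states it.
  geometric : Carrier → Carrier → ℕ → Carrier
  geometric x r zero    = x
  geometric x r (suc k) = geometric x r k * r

  geometric-pos : ∀ {x r} → 0# < x → 0# < r → ∀ k → 0# < geometric x r k
  geometric-pos 0<x 0<r zero    = 0<x
  geometric-pos 0<x 0<r (suc k) = *-pos (geometric-pos 0<x 0<r k) 0<r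

  geometric≈ : ∀ x r k → geometric x r k ≈ x * r ^ k
  geometric≈ x r zero    = sym (*-identityʳ x)
  geometric≈ x r (suc k) = trans (*-congʳ (geometric≈ x r k))
    (solve 3 (λ x r p → x :* p :* r := x :* (r :* p)) refl x r (r ^ k))

  geometric-inverse : ∀ x {p q} → q * p ≈ 1# → ∀ k → geometric x q k * p ^ k ≈ x
  geometric-inverse x {p} {q} qp≈1 zero    = *-identityʳ x
  geometric-inverse x {p} {q} qp≈1 (suc k) = trans
    (solve 4 (λ g q p r → g :* q :* (p :* r) := q :* p :* (g :* r)) refl (geometric x q k) q p
      (p ^ k))
    (trans (*-cong qp≈1 (geometric-inverse x qp≈1 k)) (*-identityˡ x))

  module _ {n m : ℕ} (G : LossyFlowGraph (suc n) m) (connected : Connected (smoothed G))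
    (e₀ : Fin m)
    {β φ ρ δ h : Carrier} {z : Vector Carrier (suc n)}
    (balanced : Balanced G β) (expanding : HasExpansion G φ) (z-pos : ∀ u → 0# < z u)
    (0≤β : 0# ≤ β) (β≤φ : β ≤ φ) (φ≤1 : φ ≤ 1#) (3β≤1 : fromℕ 3 * β ≤ 1#) (0≤ρ : 0# ≤ ρ)
      (0<γ : 0# < β + ρ)
    (0≤δ : 0# ≤ δ) (φδ≈10γ : φ * δ ≈ fromℕ 10 * (β + ρ)) (5δ≤φ : fromℕ 5 * δ ≤ φ)
      (φ≈2h : φ ≈ 2# * h) (0≤h : 0# ≤ h)
    (energy-nonNeg : ∀ f → (∀ u → 0# ≤ f u) → 0# ≤ sum (λ e → flow G f e * flow G z e))
    (energy-bound : ∀ f → (∀ u → 0# ≤ f u) →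
      sum (λ e → flow G f e * flow G z e) ≤ ρ * sum (λ u → degrees G u * (f u * z u)))
    (K : ℕ) (m<pᴷ : fromℕ m < (1# + h) ^ K) where

    open LossyFlowGraph G
    open GroundState G connected e₀ using (1≤volume)
    open LevelSets G β φ ρ δ h z balanced expanding z-pos 0≤β β≤φ φ≤1 3β≤1 0≤ρ 0<γ 0≤δ φδ≈10γ 5δ≤φ
      φ≈2h energy-nonNeg energy-bound

    private
      V = volume G
      p = 1# + δ
      q = p ⁻¹
      0<p : 0# < p
      0<p = <-≤-trans 0<1 (by 0≤δ (solve 1 (λ d → con (+ 1) :+ d :- con (+ 1) := d) refl δ))
      qp≈1 : q * p ≈ 1#
      qp≈1 = trans (*-comm q p) (x*x⁻¹≈1 0<p)

      Z z₀ : Carrier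
      Z = maxᵛ z
      z₀ = minᵛ z
      0<z₀ : 0# < z₀
      0<z₀ with minᵛ-attained z
      ... | i , z₀≡zᵢ = <-respʳ (reflexive (≡.sym z₀≡zᵢ)) (z-pos i)
      0<Z : 0# < Z
      0<Z = <-≤-trans (z-pos zero) (≤-maxᵛ z zero)

      T S : ℕ → Carrier
      T = geometric Z q
      S = geometric z₀ p

      T-pos : ∀ k → 0# < T k
      T-pos = geometric-pos 0<Z (⁻¹-pos 0<p)
      S-pos : ∀ k → 0# < S k
      S-pos = geometric-pos 0<z₀ 0<p

      T-step : ∀ k → T k ≈ T (suc k) + T (suc k) * δ
      T-step k = trans (sym (*-identityʳ (T k))) (trans (*-congˡ (sym qp≈1))
        (solve 3 (λ t q d → t :* (q :* (con (+ 1) :+ d)) := t :* q :+ t :* q :* d) refl (T k) q δ))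

      1≤highVolume : 1# ≤ V (highIndicator (T 0))
      1≤highVolume with maxᵛ-attained z
      ... | i , Z≡zᵢ = 1≤volume i (λ u → indicator-nonNeg (above (T 0) (z u)))
        (≤-reflexive (sym (above-true (≤-reflexive (reflexive Z≡zᵢ)))))

      1≤lowVolume : 1# ≤ V (lowIndicator (S 0))
      1≤lowVolume with minᵛ-attained z
      ... | i , z₀≡zᵢ = 1≤volume i (λ u → indicator-nonNeg (below (S 0) (z u)))
        (≤-reflexive (sym (below-true (≤-reflexive (reflexive (≡.sym z₀≡zᵢ))))))

      -- No value exceeds Z, so the invariant holds at the start with a factor 2 to spare.
      weight₀ : weight Z ≤ 2# * Z * V (highIndicator Z)
      weight₀ = begin
        weight Z
          ≤⟨ sum-mono-≤ {m} (λ e → +-mono-≤ (vertex (a e)) (vertex (b e))) ⟩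
        sum (λ e → Z * χ (a e) + Z * χ (b e))
          ≈⟨ sum-cong {m} (λ e → distribˡ Z (χ (a e)) (χ (b e))) ⟨
        sum (λ e → Z * (χ (a e) + χ (b e)))      ≈⟨ *-distribˡ-sum {m} Z (λ e → χ (a e) + χ (b e)) ⟨
        Z * V χ                          ≤⟨ by (proj₁ 0<Z ⊛ ≤-trans 0≤1 1≤highVolume)
          (solve 2 (λ z v → con (+ 2) :* z :* v :- z :* v := z :* v) refl Z (V χ)) ⟩
        2# * Z * V χ                     ∎
        where
        open ≤-Reasoning
        χ = highIndicator Z
        vertex : ∀ u → χ u * z u ≤ Z * χ u
        vertex u = ≤-trans (*-monoˡ-≤ (indicator-nonNeg (above Z (z u))) (≤-maxᵛ z u))
          (≤-reflexive (*-comm _ _))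

      high-escapes : ¬ (V (highIndicator (T K)) ≤ fromℕ m)
      high-escapes = growth-escapes {V = λ k → V (highIndicator (T k))}
        {Inv = λ k → weight (T k) ≤ 2# * T k * V (highIndicator (T k))} 0≤h
        (λ k → volume-mono λ u → above-mono (z u) (by (proj₁ (T-pos (suc k)) ⊛ 0≤δ)
          (trans (+-congʳ (T-step k))
            (solve 2 (λ x y → x :+ y :- x := y) refl (T (suc k)) (T (suc k) * δ)))))
        weight₀ 1≤highVolume (λ k → high-step (T-pos (suc k)) (T-step k)) K m<pᴷ

      low-escapes : ¬ (V (lowIndicator (S K)) ≤ fromℕ m)
      low-escapes = growth-escapes {V = λ k → V (lowIndicator (S k))} {Inv = λ _ → ⊤} 0≤h
        (λ k → volume-mono λ u → below-mono (z u) (by (proj₁ (S-pos k) ⊛ 0≤δ)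
          (solve 2 (λ s d → s :* (con (+ 1) :+ d) :- s := s :* d) refl (S k) δ)))
        _ 1≤lowVolume (λ k small _ → _ , low-step (proj₁ (S-pos k)) small) K m<pᴷ

      T≤S : T K ≤ S K
      T≤S = ≤-stable λ T≰S → <⇒≱ (≰⇒> high-escapes)
        (+-cancel (≤-trans (disjoint (≰⇒> T≰S)) (+-mono-≤ ≤-refl (≰⇒≥ low-escapes))))
        where
        H = highIndicator (T K)
        B = lowIndicator (S K)
        disjoint : S K < T K → V H + V B ≤ fromℕ m + fromℕ m
        disjoint S<T = begin
          V H + V B      ≈⟨ ∑-distrib-+ {m} (λ e → H (a e) + H (b e)) (λ e → B (a e) + B (b e)) ⟨
          sum (λ e → H (a e) + H (b e) + (B (a e) + B (b e)))
            ≤⟨ sum-mono-≤ {m} (λ e → by (diff (above-below-disjoint (z (a e)) S<T) ⊕ diff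
              (above-below-disjoint (z (b e)) S<T))
                 (solve 4 (λ p q r s → con (+ 2) :- (p :+ q :+ (r :+ s)) := con (+ 1) :- (p :+ r) :+
                   (con (+ 1) :- (q :+ s))) refl (H (a e)) (H (b e)) (B (a e)) (B (b e)))) ⟩
          sum {m} (λ _ → 2#)     ≈⟨ sum-const {m} 2# ⟩
          fromℕ m * 2#           ≈⟨ solve 1 (λ m → m :* con (+ 2) := m :+ m) refl (fromℕ m) ⟩
          fromℕ m + fromℕ m      ∎
          where open ≤-Reasoning
        +-cancel : ∀ {x y w} → x + w ≤ y + w → x ≤ y
        +-cancel {x} {y} {w} x+w≤y+w = by (diff x+w≤y+w)
          (solve 3 (λ x y w → y :- x := y :+ w :- (x :+ w)) refl x y w)

    -- Once the thresholds descending from the maximum and ascending from the minimum have crossed,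
    -- K factors 1 + δ are paid on each side.
    maxᵛ≤minᵛ*power : maxᵛ z ≤ minᵛ z * (1# + δ) ^ (K ℕ.+ K)
    maxᵛ≤minᵛ*power = begin
      Z                        ≈⟨ geometric-inverse Z qp≈1 K ⟨
      T K * p ^ K              ≤⟨ *-mono-≤ (proj₁ (T-pos K)) (^-nonNeg K (proj₁ 0<p)) T≤S ≤-refl ⟩
      S K * p ^ K              ≈⟨ *-congʳ (geometric≈ z₀ p K) ⟩
      z₀ * p ^ K * p ^ K       ≈⟨ *-assoc _ _ _ ⟩
      z₀ * (p ^ K * p ^ K)     ≈⟨ *-congˡ (^-homo-* p K K) ⟨
      z₀ * p ^ (K ℕ.+ K)       ∎
      where open ≤-Reasoning

  module Bound {n m : ℕ} (2≤m : 2 ℕ.≤ m) (G : LossyFlowGraph (suc n) m) {β φ c lam : Carrier}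
    {d v : Vector Carrier (suc n)}
    (balanced : Balanced G β) (connected : Connected (smoothed G)) (0<φ : 0# < φ)
      (expanding : HasExpansion G φ)
    (0≤d : ∀ i → 0# ≤ d i) (1≤c : 1# ≤ c) (degrees≤d : ∀ i → degrees G i ≤ d i)
      (d≤c*degrees : ∀ i → d i ≤ c * degrees G i)
    (λ-min : LinearAlgebra.IsλMin ℝ (normalizedLaplacian G d) lam) (v-min : LinearAlgebra.IsVMin ℝ
      (normalizedLaplacian G d) v)
    (φ<1/10 : φ < 1# / fromℕ 10) (γ≤ : β + c * lam ≤ (φ * φ) / (fromℕ 100 * log (fromℕ m))) where

    open LossyFlowGraph G

    private
      e₀ : Fin m
      e₀ = fromℕ< (ℕ.≤-trans (ℕ.s≤s ℕ.z≤n) 2≤m)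

    open GroundState G connected e₀

    private
      0<d : ∀ i → 0# < d i
      0<d i = <-≤-trans (degrees-pos i) (degrees≤d i)

      open LinearAlgebra.IsVMin v-min using (μ; smallest)

      -- `IsVMin` carries its own smallest eigenvalue; minimality of both identifies it with `lam`.
      lam≈μ : lam ≈ μ
      lam≈μ = antisym (proj₂ λ-min μ (proj₁ smallest)) (proj₂ smallest lam (proj₁ λ-min))

      x : Vector Carrier (suc n)
      x = z 0<d v-min

      0≤lam : 0# ≤ lam
      0≤lam = eigenvalue-nonNeg 0<d (proj₁ λ-min)

      0≤c : 0# ≤ c
      0≤c = ≤-trans 0≤1 1≤c

      ρ γ ℓ : Carrier
      ρ = c * lam
      γ = β + ρ
      ℓ = log (fromℕ m)

      0≤ρ : 0# ≤ ρ
      0≤ρ = 0≤c ⊛ 0≤lam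

      0≤β : 0# ≤ β
      0≤β = by (diff (1≤η e₀) ⊕ diff (balanced e₀))
        (solve 2 (λ b h → b :- con (+ 0) := h :- con (+ 1) :+ (con (+ 1) :+ b :- h)) refl β (η e₀))

      0≤γ : 0# ≤ γ
      0≤γ = 0≤β ⊕ 0≤ρ

      energy′ : ∀ f → sum (λ e → flow G f e * flow G x e) ≈ lam * sum (λ i → d i * (f i * x i))
      energy′ f = trans (energy 0<d v-min f) (*-congʳ (sym lam≈μ))

      0<x : ∀ i → 0# < x i
      0<x = z-pos 0<d v-min

      energy-nonNeg : ∀ f → (∀ u → 0# ≤ f u) → 0# ≤ sum (λ e → flow G f e * flow G x e)
      energy-nonNeg f 0≤f = nonNeg (0≤lam ⊛ sum-nonNeg {suc n} λ i → 0≤d i ⊛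
        (0≤f i ⊛ proj₁ (0<x i))) (energy′ f)

      energy-bound : ∀ f → (∀ u → 0# ≤ f u) →
        sum (λ e → flow G f e * flow G x e) ≤ ρ * sum (λ u → degrees G u * (f u * x u))
      energy-bound f 0≤f = begin
        sum (λ e → flow G f e * flow G x e)              ≈⟨ energy′ f ⟩
        lam * sum (λ u → d u * (f u * x u))
          ≤⟨ *-monoˡ-≤ 0≤lam (sum-mono-≤ {suc n} λ u →
          *-mono-≤ (0≤d u) (0≤f u ⊛ proj₁ (0<x u)) (d≤c*degrees u) ≤-refl) ⟩
        lam * sum (λ u → c * degrees G u * (f u * x u))  ≈⟨ *-congˡ
          (trans (sum-cong {suc n} λ u → *-assoc c (degrees G u) (f u * x u))
          (sym (*-distribˡ-sum {suc n} c (λ u → degrees G u * (f u * x u))))) ⟩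
        lam * (c * sum (λ u → degrees G u * (f u * x u)))
          ≈⟨ solve 3 (λ l c s → l :* (c :* s) := c :* l :* s) refl lam c
          (sum (λ u → degrees G u * (f u * x u))) ⟩
        ρ * sum (λ u → degrees G u * (f u * x u))        ∎
        where open ≤-Reasoning

      10φ≤1 : fromℕ 10 * φ ≤ 1#
      10φ≤1 = ≤-trans (*-monoˡ-≤ (fromℕ-nonNeg 10) (proj₁ φ<1/10))
        (≤-reflexive (*-/-cancel (fromℕ-pos 9)))

      φ≤1 : φ ≤ 1#
      φ≤1 = by (diff 10φ≤1 ⊕ fromℕ-nonNeg 9 ⊛ proj₁ 0<φ)
        (solve 1 (λ p → con (+ 1) :- p := con (+ 1) :- con (+ 10) :* p :+ con (+ 9) :* p) refl φ)

      -- exp ½ ≤ 1 / (1 - ½) = 2 ≤ m, hence log m ≥ ½.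
      1≤2ℓ : 1# ≤ 2# * ℓ
      1≤2ℓ = begin
        1#                   ≈⟨ x*x⁻¹≈1 (fromℕ-pos 1) ⟨
        2# * ½               ≈⟨ *-congˡ
          (trans (sym (*-identityˡ ½)) (*-congʳ (sym (+-identityʳ 1#)))) ⟩
        2# * (fromℕ 1 * ½)   ≤⟨ *-monoˡ-≤ (fromℕ-nonNeg 2)
          (multiple≤log 1 (proj₁ (⁻¹-pos (fromℕ-pos 1))) (fromℕ-nonNeg 2)
          (≤-reflexive (sym (trans (solve 2 (λ a h → a :* (con (+ 1) :- h) := a :- a :* h)
            refl 2# ½) (trans (+-congˡ (-‿cong (x*x⁻¹≈1 (fromℕ-pos 1))))
            (solve 0 (con (+ 2) :- con (+ 1) := con (+ 1)) refl)))))
          (≤-trans (≤-reflexive (*-identityʳ 2#)) (fromℕ-mono-≤ 2≤m))) ⟩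
        2# * ℓ               ∎
        where
        open ≤-Reasoning
        ½ = 2# ⁻¹

      0<ℓ : 0# < ℓ
      0<ℓ = ≰⇒> λ ℓ≤0 → <⇒≱ 0<1 (≤-trans 1≤2ℓ (≤-trans (*-monoˡ-≤ (fromℕ-nonNeg 2) ℓ≤0)
        (≤-reflexive (zeroʳ 2#))))

      -- Half of the hypothesis' 100 is spent on log m ≥ ½. What remains is exactly 5δ ≤ φ, as φδ =
      -- 10γ.
      50γ≤φφ : fromℕ 50 * γ ≤ φ * φ
      50γ≤φφ = begin
        fromℕ 50 * γ             ≤⟨ by ((fromℕ-nonNeg 50 ⊛ 0≤γ) ⊛ diff 1≤2ℓ)
          (solve 2 (λ g l → con (+ 100) :* l :* g :- con (+ 50) :* g := con (+ 50) :* g :*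
          (con (+ 2) :* l :- con (+ 1))) refl γ ℓ) ⟩
        fromℕ 100 * ℓ * γ        ≤⟨ *-monoˡ-≤ (proj₁ 0<100ℓ) γ≤ ⟩
        fromℕ 100 * ℓ * ((φ * φ) / (fromℕ 100 * ℓ))  ≈⟨ *-/-cancel 0<100ℓ ⟩
        φ * φ                    ∎
        where
        open ≤-Reasoning
        0<100ℓ : 0# < fromℕ 100 * ℓ
        0<100ℓ = *-pos (fromℕ-pos 99) 0<ℓ

      50β≤φφ : fromℕ 50 * β ≤ φ * φ
      50β≤φφ = by (diff 50γ≤φφ ⊕ fromℕ-nonNeg 50 ⊛ 0≤ρ)
        (solve 3 (λ p b r → p :- con (+ 50) :* b := p :- con (+ 50) :* (b :+ r) :+ con (+ 50) :* r)
        refl (φ * φ) β ρ)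

      50β≤φ : fromℕ 50 * β ≤ φ
      50β≤φ = ≤-trans 50β≤φφ (by (proj₁ 0<φ ⊛ diff φ≤1)
        (solve 1 (λ p → p :- p :* p := p :* (con (+ 1) :- p)) refl φ))

      β≤φ : β ≤ φ
      β≤φ = by (diff 50β≤φ ⊕ fromℕ-nonNeg 49 ⊛ 0≤β)
        (solve 2 (λ p b → p :- b := p :- con (+ 50) :* b :+ con (+ 49) :* b) refl φ β)

      3β≤1 : fromℕ 3 * β ≤ 1#
      3β≤1 = by (diff 50β≤φ ⊕ fromℕ-nonNeg 47 ⊛ 0≤β ⊕ diff φ≤1)
        (solve 2 (λ p b → con (+ 1) :- con (+ 3) :* b := p :- con (+ 50) :* b :+ con (+ 47) :* b :+
          (con (+ 1) :- p)) refl φ β)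

      δ h y : Carrier
      δ = fromℕ 10 * γ / φ
      h = φ / 2#
      y = (γ * ℓ) / (φ * φ)

      φδ≈10γ : φ * δ ≈ fromℕ 10 * γ
      φδ≈10γ = *-/-cancel 0<φ

      0≤δ : 0# ≤ δ
      0≤δ = *-cancelˡ-nonNeg 0<φ (nonNeg (fromℕ-nonNeg 10 ⊛ 0≤γ) φδ≈10γ)

      5δ≤φ : fromℕ 5 * δ ≤ φ
      5δ≤φ = *-cancelˡ-≤ 0<φ (begin
        φ * (fromℕ 5 * δ)
          ≈⟨ solve 2 (λ p d → p :* (con (+ 5) :* d) := con (+ 5) :* (p :* d)) refl φ δ ⟩
        fromℕ 5 * (φ * δ)          ≈⟨ *-congˡ φδ≈10γ ⟩
        fromℕ 5 * (fromℕ 10 * γ)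
          ≈⟨ solve 1 (λ g → con (+ 5) :* (con (+ 10) :* g) := con (+ 50) :* g) refl γ ⟩
        fromℕ 50 * γ               ≤⟨ 50γ≤φφ ⟩
        φ * φ                      ∎)
        where open ≤-Reasoning

      0≤h : 0# ≤ h
      0≤h = proj₁ 0<φ ⊛ proj₁ (⁻¹-pos (fromℕ-pos 1))

      φ≈2h : φ ≈ 2# * h
      φ≈2h = sym (*-/-cancel (fromℕ-pos 1))

      2h≤1 : 2# * h ≤ 1#
      2h≤1 = ≤-trans (≤-reflexive (sym φ≈2h)) φ≤1

      0<h : 0# < h
      0<h = *-pos 0<φ (⁻¹-pos (fromℕ-pos 1))

      0<φφ : 0# < φ * φ
      0<φφ = *-pos 0<φ 0<φ

      φφy≈γℓ : φ * φ * y ≈ γ * ℓ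
      φφy≈γℓ = *-/-cancel 0<φφ

      0≤y : 0# ≤ y
      0≤y = *-cancelˡ-nonNeg 0<φφ (nonNeg (0≤γ ⊛ proj₁ 0<ℓ) φφy≈γℓ)

      0≤120y : 0# ≤ fromℕ 120 * y
      0≤120y = fromℕ-nonNeg 120 ⊛ 0≤y

      1≤m : 1# ≤ fromℕ m
      1≤m = ≤-trans (≤-reflexive (sym (+-identityʳ 1#)))
        (fromℕ-mono-≤ (ℕ.≤-trans (ℕ.s≤s ℕ.z≤n) 2≤m))

    0<minᵛ : 0# < minᵛ x
    0<minᵛ with minᵛ-attained x
    ... | i , x₀≡xᵢ = <-respʳ (reflexive (≡.sym x₀≡xᵢ)) (0<x i)

    private
      -- From (1 + h)^k ≤ m follows kφ/4 ≤ log m. With φ ≤ 1 ≤ 2 log m this gives φ(k + 1) ≤ 6 log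
      -- m, and the factor 2φδ = 20γ produces the final constant 120.
      exponent-bound : ∀ k → (1# + h) ^ k ≤ fromℕ m → fromℕ (suc k ℕ.+ suc k) * δ ≤ fromℕ 120 * y
      exponent-bound k pᵏ≤m = *-cancelˡ-≤ 0<φφ (begin
        φ * φ * (fromℕ (suc k ℕ.+ suc k) * δ)
          ≈⟨ *-congˡ (*-congʳ (×-homo-+ 1# (suc k) (suc k))) ⟩
        φ * φ * ((fromℕ (suc k) + fromℕ (suc k)) * δ)
          ≈⟨ solve 3 (λ p k d → p :* p :* ((con (+ 1) :+ k :+ (con (+ 1) :+ k)) :* d) := con (+ 2)
            :* (p :* d) :* (p :* k :+ p)) refl φ (fromℕ k) δ ⟩
        2# * (φ * δ) * (φ * fromℕ k + φ)
          ≈⟨ *-cong (*-congˡ φδ≈10γ) (+-congʳ (*-congʳ φ≈4w)) ⟩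
        2# * (fromℕ 10 * γ) * (2# * (2# * w) * fromℕ k + φ)
          ≤⟨ by ((fromℕ-nonNeg 20 ⊛ 0≤γ) ⊛ (fromℕ-nonNeg 4 ⊛ diff kw≤ℓ ⊕ diff φ≤1 ⊕ diff 1≤2ℓ))
            (solve 5 (λ g l k p w → con (+ 120) :* (g :* l) :- con (+ 2) :* (con (+ 10) :* g) :*
              (con (+ 2) :* (con (+ 2) :* w) :* k :+ p)
               := con (+ 20) :* g :* (con (+ 4) :* (l :- k :* w) :+ (con (+ 1) :- p) :+
                 (con (+ 2) :* l :- con (+ 1)))) refl γ ℓ (fromℕ k) φ w) ⟩
        fromℕ 120 * (γ * ℓ)                        ≈⟨ *-congˡ φφy≈γℓ ⟨
        fromℕ 120 * (φ * φ * y)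
          ≈⟨ solve 2 (λ p y → con (+ 120) :* (p :* y) := p :* (con (+ 120) :* y)) refl (φ * φ) y ⟩
        φ * φ * (fromℕ 120 * y)                    ∎)
        where
        open ≤-Reasoning
        -- w = φ/4 is small enough for 1 / (1 - w) ≤ 1 + 2w = 1 + h, so exp (k w) ≤ (1 + h)^k ≤ m.
        w = h / 2#
        h≈2w : h ≈ 2# * w
        h≈2w = sym (*-/-cancel (fromℕ-pos 1))
        φ≈4w : φ ≈ 2# * (2# * w)
        φ≈4w = trans φ≈2h (*-congˡ h≈2w)
        0≤w : 0# ≤ w
        0≤w = 0≤h ⊛ proj₁ (⁻¹-pos (fromℕ-pos 1))
        1≤[1+h][1-w] : 1# ≤ (1# + h) * (1# + - w)
        1≤[1+h][1-w] = by (0≤w ⊛ (diff φ≤1 ⊕ fromℕ-nonNeg 2 ⊛ 0≤w))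
          (trans (+-congʳ (*-congʳ (+-congˡ h≈2w)))
          (trans (solve 1 (λ w → (con (+ 1) :+ con (+ 2) :* w) :* (con (+ 1) :+ :- w) :- con (+ 1)
                            := w :* (con (+ 1) :- con (+ 2) :* (con (+ 2) :* w) :+ con (+ 2) :* w))
                              refl w)
                 (*-congˡ (+-congʳ (+-congˡ (-‿cong (sym φ≈4w)))))))
        kw≤ℓ : fromℕ k * w ≤ ℓ
        kw≤ℓ = multiple≤log k 0≤w (0≤1 ⊕ 0≤h) 1≤[1+h][1-w] pᵏ≤m

      -- The bracket (1 + h)^k ≤ m < (1 + h)^(k + 1) serves twice: its upper half makes k + 1 steps
      -- enough to pass half of the volume, its lower half bounds k by the logarithm.
      ratio-bound⁺ : 0# < γ → maxᵛ x ≤ minᵛ x * exp (fromℕ 120 * y)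
      ratio-bound⁺ 0<γ = ≤-stable λ unbounded → power-bracket 1≤m 0<h λ (k , pᵏ≤m , m<pᵏ⁺¹) →
        unbounded (≤-trans
        (maxᵛ≤minᵛ*power G connected e₀ {z = x} balanced expanding 0<x 0≤β β≤φ φ≤1 3β≤1 0≤ρ 0<γ 0≤δ
          φδ≈10γ 5δ≤φ φ≈2h 0≤h
          energy-nonNeg energy-bound (suc k) m<pᵏ⁺¹)
        (*-monoˡ-≤ (proj₁ 0<minᵛ) (power≤exp (suc k ℕ.+ suc k) 0≤δ (exponent-bound k pᵏ≤m))))

      -- If β = cλ = 0, then η = 1 and the energy of x vanishes, so x is constant.
      ratio-bound⁰ : γ ≤ 0# → maxᵛ x ≤ minᵛ x * exp (fromℕ 120 * y)
      ratio-bound⁰ γ≤0 = begin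
        maxᵛ x                            ≤⟨ max≤min ⟩
        minᵛ x                            ≈⟨ *-identityʳ _ ⟨
        minᵛ x * 1#
          ≤⟨ *-monoˡ-≤ (proj₁ 0<minᵛ) (power≤exp 0 0≤1 (≤-trans (≤-reflexive (zeroˡ 1#)) 0≤120y)) ⟩
        minᵛ x * exp (fromℕ 120 * y)      ∎
        where
        open ≤-Reasoning
        β≤0 : β ≤ 0#
        β≤0 = by (diff γ≤0 ⊕ 0≤ρ) (solve 2 (λ b r → con (+ 0) :- b := con (+ 0) :- (b :+ r) :+ r)
          refl β ρ)
        lam≈0 : lam ≈ 0#
        lam≈0 = antisym (by (diff γ≤0 ⊕ 0≤β ⊕ diff 1≤c ⊛ 0≤lam)
          (solve 3 (λ b c l → con (+ 0) :- l := con (+ 0) :- (b :+ c :* l) :+ b :+ (c :- con (+ 1))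
            :* l) refl β c lam)) 0≤lam
        η≈1 : ∀ e → η e ≈ 1#
        η≈1 e = antisym (≤-trans (balanced e)
          (≤-trans (+-monoʳ-≤ 1# β≤0) (≤-reflexive (+-identityʳ 1#)))) (1≤η e)
        flow≈0 : ∀ e → flow G x e ≈ 0#
        flow≈0 = ∙-self≈0⇒≈0 {x = flow G x} (trans (energy′ x) (trans (*-congʳ lam≈0) (zeroˡ _)))
        edge-constant : ∀ e → x (b e) ≈ x (a e)
        edge-constant e = trans (solve 3 (λ p q h → p := p :- h :* q :+ h :* q)
          refl (x (b e)) (x (a e)) (η e))
          (trans (+-cong (flow≈0 e) (*-congʳ (η≈1 e))) (trans (+-identityˡ _) (*-identityˡ _)))
        path-constant : ∀ {i j} → Star (Adjacent (smoothed G)) i j → x i ≈ x j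
        path-constant done = refl
        path-constant ((e , inj₁ (≡.refl , ≡.refl)) ◅ path) = trans (sym (edge-constant e))
          (path-constant path)
        path-constant ((e , inj₂ (≡.refl , ≡.refl)) ◅ path) = trans (edge-constant e)
          (path-constant path)
        max≤min : maxᵛ x ≤ minᵛ x
        max≤min with maxᵛ-attained x | minᵛ-attained x
        ... | i , max≡xᵢ | j , min≡xⱼ = ≤-reflexive
          (trans (reflexive max≡xᵢ) (trans (path-constant (connected i j))
          (reflexive (≡.sym min≡xⱼ))))

      -- The growth steps cancel a factor γ, so they need γ > 0; at γ = 0 also δ = 0 and all
      -- thresholds coincide.
      ratio-bound : maxᵛ x ≤ minᵛ x * exp (fromℕ 120 * y)
      ratio-bound with γ ≤? 0#
      ... | yes γ≤0 = ratio-bound⁰ γ≤0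
      ... | no  γ≰0 = ratio-bound⁺ (≰⇒> γ≰0)

    maxᵛ/minᵛ≤exp : maxᵛ x / minᵛ x ≤ exp (fromℕ 120 * y)
    maxᵛ/minᵛ≤exp = *-cancelˡ-≤ 0<minᵛ (≤-trans (≤-reflexive (*-/-cancel 0<minᵛ)) ratio-bound)

-- The constant is chosen before the graph and its parameters. Positivity of the minimum accompanies
-- the bound because the inverse is total, and a quotient by 0 would say nothing. With 2 ≤ m the
-- logarithm is positive, so the denominator in the last hypothesis is nonzero.
theorem5p1 :
  (ℝ : CompleteOrderedField) →
  let open CompleteOrderedField ℝ
      open LinearAlgebra ℝ
      open LossyFlow ℝ
  in
  ∃[ C ] (0# < C ×
    (∀ (n m : ℕ) → 2 ℕ.≤ m →
     (G : LossyFlowGraph (suc n) m) (β φ c lam : Carrier) (d v : Vector Carrier (suc n)) →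
     Balanced G β →
     Connected (smoothed G) →
     0# < φ → HasExpansion G φ →
     (∀ i → 0# ≤ d i) →
     1# ≤ c →
     (∀ i → degrees G i ≤ d i) →
     (∀ i → d i ≤ c * degrees G i) →
     IsλMin (normalizedLaplacian G d) lam →
     IsVMin (normalizedLaplacian G d) v →
     β < 1# / fromℕ 10 →
     φ < 1# / fromℕ 10 →
     c * lam < 1# →
     β + c * lam ≤ (φ * φ) / (fromℕ 100 * log (fromℕ m)) →
     let z = λ i → v i / √ (d i) in
     0# < minᵛ z ×
     maxᵛ z / minᵛ z ≤ exp (C * (((β + c * lam) * log (fromℕ m)) / (φ * φ)))))
theorem5p1 ℝ = CompleteOrderedField.fromℕ ℝ 120 , OrderedField.fromℕ-pos ℝ 119 ,
  λ n m 2≤m G β φ c lam d v balanced connected 0<φ expanding 0≤d 1≤c degrees≤d d≤c*degrees λ-min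
    v-min _ φ<1/10 _ γ≤ →
    let open HarnackInequality.Bound ℝ 2≤m G balanced connected 0<φ expanding 0≤d 1≤c degrees≤d
          d≤c*degrees λ-min v-min φ<1/10 γ≤
    in 0<minᵛ , maxᵛ/minᵛ≤exp
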